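{- The $\mathbb{Z}$-lattice $I_2\perp A_3\perp\langle 3\rangle$ of rank $6$ is an isolation of $I_3$, and no lattice of rank less than $6$ is an isolation of $I_3$. Hence $\mathrm{Iso}(I_3)=6$.
   Context: All $\mathbb{Z}$-lattices are positive definite with integral Gram matrix. $M$ is represented by $L$ if there is a linear map $\sigma:M\to L$ preserving the quadratic form. $\langle a_1,\dots,a_k\rangle$ denotes the diagonal lattice, $\perp$ the orthogonal sum, $I_n=\langle 1,\dots,1\rangle$ ($n$ ones). $A_3$ is the root lattice $\{(a_0,\dots,a_3)\in\mathbb{Z}^4: a_0+\dots+a_3=0\}$, with Gram matrix $\begin{pmatrix}2&-1&0\\-1&2&-1\\0&-1&2\end{pmatrix}$. A lattice $L$ is an isolation of $\ell$ if $L$ represents every sublattice of $\ell$ except $\ell$ itself, and does not represent $\ell$. $\mathrm{Iso}(\ell)$ is the minimum rank of an isolation of $\ell$. -}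

module Defs where

open import Data.Nat using (ℕ; zero; suc)
import Data.Nat as N
open import Data.Fin using (Fin; zero; suc; splitAt)
open import Data.Integer using (ℤ; +_; -[1+_]; _+_; _*_; _<_)
open import Data.Sum using (_⊎_; inj₁; inj₂)
open import Data.Product using (Σ; ∃; _×_)
open import Relation.Binary.PropositionalEquality using (_≡_)
open import Relation.Nullary using (¬_)

-- Gram matrix of a Z-lattice of rank n (the lattice is ℤⁿ with this bilinear form)
Mat : ℕ → Set
Mat n = Fin n → Fin n → ℤ

Vect : ℕ → Set
Vect n = Fin n → ℤ

sumF : ∀ n → (Fin n → ℤ) → ℤ
sumF zero f = + 0
sumF (suc n) f = f zero + sumF n (λ i → f (suc i))

B : ∀ {n} → Mat n → Vect n → Vect n → ℤ
B {n} G x y = sumF n (λ i → sumF n (λ j → x i * G i j * y j))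

IsLattice : ∀ {n} → Mat n → Set
IsLattice {n} G =
  (∀ i j → G i j ≡ G j i) ×
  (∀ (x : Vect n) → ¬ (∀ i → x i ≡ + 0) → + 0 < B G x x)

-- M (Gram GM, rank m) is represented by L (Gram GL, rank n):
-- a ℤ-linear map σ : ℤᵐ → ℤⁿ (given by the images T i of the basis vectors)
-- preserving the bilinear form.
Represents : ∀ {n m} → Mat n → Mat m → Set
Represents {n} {m} GL GM =
  Σ (Fin m → Vect n) λ T → ∀ i j → B GL (T i) (T j) ≡ GM i j

lincomb : ∀ {k n} → (Fin k → Vect n) → Vect k → Vect n
lincomb {k} v c j = sumF k (λ i → c i * v i j)

LinIndep : ∀ {k n} → (Fin k → Vect n) → Set
LinIndep {k} {n} v = ∀ (c : Vect k) → (∀ j → lincomb v c j ≡ + 0) → ∀ i → c i ≡ + 0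

Spans : ∀ {k n} → (Fin k → Vect n) → Set
Spans {k} {n} v = ∀ (x : Vect n) → ∃ λ (c : Vect k) → ∀ j → x j ≡ lincomb v c j

subGram : ∀ {k n} → Mat n → (Fin k → Vect n) → Mat k
subGram G v i j = B G (v i) (v j)

-- L is an isolation of ℓ: L represents every sublattice of ℓ (given by a
-- ℤ-basis v of rank k) other than ℓ itself, and L does not represent ℓ.
IsIsolation : ∀ {n r} → Mat n → Mat r → Set
IsIsolation {n} {r} L ℓ =
  (∀ (k : ℕ) (v : Fin k → Vect r) → LinIndep v → ¬ Spans v → Represents L (subGram ℓ v)) ×
  ¬ Represents L ℓ

_⊥_ : ∀ {m n} → Mat m → Mat n → Mat (m N.+ n)
_⊥_ {m} {n} G H i j with splitAt m i | splitAt m j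
... | inj₁ a | inj₁ b = G a b
... | inj₂ a | inj₂ b = H a b
... | inj₁ _ | inj₂ _ = + 0
... | inj₂ _ | inj₁ _ = + 0

I : ∀ n → Mat n
I zero ()
I (suc n) zero zero = + 1
I (suc n) zero (suc j) = + 0
I (suc n) (suc i) zero = + 0
I (suc n) (suc i) (suc j) = I n i j

diag1 : ℤ → Mat 1
diag1 a zero zero = a

A3 : Mat 3
A3 zero zero = + 2
A3 zero (suc zero) = -[1+ 0 ]
A3 zero (suc (suc zero)) = + 0
A3 (suc zero) zero = -[1+ 0 ]
A3 (suc zero) (suc zero) = + 2
A3 (suc zero) (suc (suc zero)) = -[1+ 0 ]
A3 (suc (suc zero)) zero = + 0
A3 (suc (suc zero)) (suc zero) = -[1+ 0 ]
A3 (suc (suc zero)) (suc (suc zero)) = + 2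

L6 : Mat 6
L6 = I 2 ⊥ (A3 ⊥ diag1 (+ 3))

{-# OPTIONS --safe #-}
module Submission where

{-
A proper subgroup of ℤ³ lies in M = {x : p ∣ a·x} for some prime p and some a ≢ 0 mod p, so L6 has
to represent every such M. Note that A₃ ≅ D₃, so L6 is the sublattice of I₅ ⊥ ⟨3⟩ on which three of
the first five coordinates have an even sum.

For p = 2, put the coordinates with odd aᵢ into D₃ and the others into I₂. For odd p, choose k, l
with p² ∣ |a|² + k² + l² + 3 and p² ∤ |a|². Then M and w/p, where w = (a, k, l, 1), generate an
integral lattice in the quadratic space of I₅ ⊥ ⟨3⟩, which is also that of the sum of the Hurwitz and
the Eisenstein integers. In the latter lattice every rational vector is at distance less than 1 from
a lattice vector, so the Aubry–Davenport–Cassels descent moves M + ℤw/p into it, and rotations by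
units bring M into I₅ ⊥ ⟨3⟩. Modulo 2 the images of the vectors p·eᵢ form one of finitely many
patterns: either three of the first five coordinates have an even sum, possibly after a Hadamard
rotation of four of them, or M lies in I₃ ⊥ 4(I₂ ⊥ ⟨3⟩). In the last case M is not contained in I₃,
because otherwise the projection of w/p to it would have norm |a|²/p²; rotating by the sixth roots of
unity in ℚ(√-3) lowers the power of 2 in the second component until the first case applies.

Conversely, let L have rank at most 5 and represent the proper sublattices of I₃ but not I₃. Then L
contains I₂ ⊥ ⟨9⟩ and D₃, and since L has no unit vector orthogonal to I₂, parity forces D₃ ⊥ I₂. The
rank forces the vector of norm 9 into ℚD₃; a computation modulo 2 puts its coordinates into ℤ³, and
as its norm is odd it differs from an element of D₃ by a unit vector orthogonal to I₂.
-}

open import Defs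
open import Data.Bool using (Bool; true; false; _∧_; _∨_; _xor_; not; if_then_else_)
import Data.Bool.Properties as Bool
open import Data.Empty using (⊥-elim) renaming (⊥ to Empty)
open import Data.Fin using (Fin; zero; suc; punchIn)
import Data.Fin as Fin
open import Data.Fin.Patterns using (0F; 1F; 2F; 3F; 4F; 5F)
import Data.Fin.Properties as Fin
open import Data.Integer using (ℤ; +_; -[1+_]; _+_; _*_; _-_; -_; ∣_∣)
import Data.Integer as ℤ
open import Data.Integer.Divisibility.Signed
import Data.Integer.DivMod as ℤ
import Data.Integer.Properties as ℤ
open import Data.Integer.Tactic.RingSolver using (solve-∀)
open import Data.List using ([]; _∷_)
open import Data.List.Relation.Unary.All using (All; []; _∷_)
open import Data.Nat using (ℕ; zero; suc; _<_)
import Data.Nat as ℕ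
import Data.Nat.Divisibility as ℕ∣
open import Data.Nat.GCD using (module Bézout; module GCD)
open import Data.Nat.Induction using (<-wellFounded)
open import Data.Nat.ListAction using (product)
open import Data.Nat.Primality using (Prime; euclidsLemma; prime[2]; prime⇒irreducible; prime⇒nonTrivial)
open import Data.Nat.Primality.Factorisation using (PrimeFactorisation; factorise)
import Data.Nat.Properties as ℕ
open import Data.Nat.Tactic.RingSolver using () renaming (solve-∀ to solveℕ-∀)
open import Data.Product using (Σ; ∃; ∃-syntax; _×_; _,_; proj₁; proj₂)
open import Data.Sum using (_⊎_; inj₁; inj₂; [_,_]′)
open import Data.Vec using (Vec; []; _∷_; lookup; tabulate)
open import Data.Vec.Functional using (insertAt)
open import Data.Vec.Functional.Properties using (insertAt-lookup; insertAt-punchIn)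
open import Data.Vec.Properties using (lookup∘tabulate)
open import Function using (_∘_)
open import Induction.WellFounded using (Acc; acc)
open import Relation.Binary.PropositionalEquality hiding (J)
open import Relation.Nullary using (¬_; Dec; yes; no)
open import Relation.Nullary.Decidable using (does; dec-true; decidable-stable; from-yes; from-no; ¬?; _⊎-dec_)

-- Sums and bilinear forms

-- For odd p the lattice M maps onto (ℤ/2)³. In the obvious embedding M ⊂ I₃ ⊂ I₅ ⊥ ⟨3⟩, any three
-- of the five coordinates include one of I₃, so their sum is a nonzero linear form modulo 2 and
-- takes odd values on M. A genuinely different embedding is needed, and carrying w/p through the
-- descent is what enforces one.
--
-- The descent cannot be run in I₅ ⊥ ⟨3⟩ itself, whose squared covering radius is 5/4 + 3/4 = 2. For
-- the Hurwitz and the Eisenstein integers the values are 1/2 and 1/3, with sum below 1. The price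
-- is half-integral coordinates: the larger lattice is handled in doubled coordinates, and its
-- rotations as similarities of factor 4.
--
-- Parities may be read off at the vectors p·eᵢ instead of on M because p is odd: the image of a
-- vector of M is 1/p times an integral combination of the images of the p·eᵢ, and dividing by p
-- does not change parity. The norm p² is 1 modulo 4, so modulo 2 and 4 these images look like an
-- orthonormal triple, which leaves finitely many patterns. For p = 2 all this fails, but there D₃
-- accommodates M directly.

+-congʳ : ∀ a {b c} → b ≡ c → a + b ≡ a + c
+-congʳ a = cong (λ t → a + t)

sumF-cong : ∀ n {f g : Fin n → ℤ} → (∀ i → f i ≡ g i) → sumF n f ≡ sumF n g
sumF-cong zero    e = refl
sumF-cong (suc n) e = cong₂ _+_ (e zero) (sumF-cong n (e ∘ suc))

sumF-+ : ∀ n (f g : Fin n → ℤ) → sumF n (λ i → f i + g i) ≡ sumF n f + sumF n g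
sumF-+ zero    f g = refl
sumF-+ (suc n) f g =
  trans (+-congʳ (f zero + g zero) (sumF-+ n (f ∘ suc) (g ∘ suc)))
    (interchange (f zero) (g zero) (sumF n (f ∘ suc)) (sumF n (g ∘ suc)))
  where
  interchange : ∀ a b c d → a + b + (c + d) ≡ a + c + (b + d)
  interchange = solve-∀

sumF-*ˡ : ∀ n c (f : Fin n → ℤ) → sumF n (λ i → c * f i) ≡ c * sumF n f
sumF-*ˡ zero    c f = sym (ℤ.*-zeroʳ c)
sumF-*ˡ (suc n) c f =
  trans (+-congʳ (c * f zero) (sumF-*ˡ n c (f ∘ suc))) (sym (ℤ.*-distribˡ-+ c (f zero) (sumF n (f ∘ suc))))

sumF-*ʳ : ∀ n c (f : Fin n → ℤ) → sumF n (λ i → f i * c) ≡ sumF n f * c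
sumF-*ʳ n c f = trans (sumF-cong n (λ i → ℤ.*-comm (f i) c)) (trans (sumF-*ˡ n c f) (ℤ.*-comm c (sumF n f)))

sumF-0 : ∀ n {f : Fin n → ℤ} → (∀ i → f i ≡ + 0) → sumF n f ≡ + 0
sumF-0 zero    e = refl
sumF-0 (suc n) e = cong₂ _+_ (e zero) (sumF-0 n (e ∘ suc))

sumF-swap : ∀ m n (f : Fin m → Fin n → ℤ) →
  sumF m (λ i → sumF n (f i)) ≡ sumF n (λ j → sumF m (λ i → f i j))
sumF-swap zero    n f = sym (sumF-0 n (λ _ → refl))
sumF-swap (suc m) n f =
  trans (+-congʳ (sumF n (f zero)) (sumF-swap m n (f ∘ suc))) (sym (sumF-+ n (f zero) _))

sumF-punchIn : ∀ n (i : Fin (suc n)) (f : Fin (suc n) → ℤ) →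
  sumF (suc n) f ≡ f i + sumF n (f ∘ punchIn i)
sumF-punchIn n       zero    f = refl
sumF-punchIn (suc n) (suc i) f =
  trans (+-congʳ (f zero) (sumF-punchIn n i (f ∘ suc)))
    (rotate (f zero) (f (suc i)) (sumF n (f ∘ suc ∘ punchIn i)))
  where
  rotate : ∀ a b c → a + (b + c) ≡ b + (a + c)
  rotate = solve-∀

∣-sumF : ∀ n {m} {f : Fin n → ℤ} → (∀ i → m ∣ f i) → m ∣ sumF n f
∣-sumF zero    d = divides (+ 0) refl
∣-sumF (suc n) d = ∣m∣n⇒∣m+n (d zero) (∣-sumF n (d ∘ suc))

-- Comparing the underlying natural numbers makes `δ (suc i) (suc j)` reduce to `δ i j` and all
-- closed entries compute.
δ : ∀ {n} → Mat n
δ i j = if Fin.toℕ i ℕ.≡ᵇ Fin.toℕ j then + 1 else + 0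

sumF-δ : ∀ n i (f : Fin n → ℤ) → sumF n (λ j → δ i j * f j) ≡ f i
sumF-δ (suc n) zero    f =
  trans (cong₂ _+_ (ℤ.*-identityˡ (f zero)) (sumF-0 n (λ j → refl))) (ℤ.+-identityʳ _)
sumF-δ (suc n) (suc i) f = trans (ℤ.+-identityˡ _) (sumF-δ n i (f ∘ suc))

module _ {n : ℕ} (G : Mat n) where

  private
    row : Vect n → Fin n → ℤ
    row z i = sumF n (λ j → G i j * z j)

    B-row : ∀ x z → B G x z ≡ sumF n (λ i → x i * row z i)
    B-row x z = sumF-cong n λ i →
      trans (sumF-cong n (λ j → ℤ.*-assoc (x i) (G i j) (z j))) (sumF-*ˡ n (x i) _)

  B-cong : ∀ {x x′ y y′} → (∀ i → x i ≡ x′ i) → (∀ i → y i ≡ y′ i) → B G x y ≡ B G x′ y′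
  B-cong ex ey = sumF-cong n λ i → sumF-cong n λ j →
    cong₂ _*_ (cong (_* G i j) (ex i)) (ey j)

  B-congˡ : ∀ {x x′} z → (∀ i → x i ≡ x′ i) → B G x z ≡ B G x′ z
  B-congˡ {x} {x′} z e = B-cong {x} {x′} {z} {z} e (λ _ → refl)

  B-congʳ : ∀ {x x′} z → (∀ i → x i ≡ x′ i) → B G z x ≡ B G z x′
  B-congʳ {x} {x′} z e = B-cong {z} {z} {x} {x′} (λ _ → refl) e

  B-congᴳ : ∀ {H : Mat n} x y → (∀ i j → G i j ≡ H i j) → B G x y ≡ B H x y
  B-congᴳ x y e = sumF-cong n λ i → sumF-cong n λ j → cong (λ g → x i * g * y j) (e i j)

  B-combˡ : ∀ a x b y z → B G (λ j → a * x j + b * y j) z ≡ a * B G x z + b * B G y z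
  B-combˡ a x b y z = begin
    B G (λ j → a * x j + b * y j) z
      ≡⟨ B-row (λ j → a * x j + b * y j) z ⟩
    sumF n (λ i → (a * x i + b * y i) * row z i)
      ≡⟨ sumF-cong n (λ i → expand a (x i) b (y i) (row z i)) ⟩
    sumF n (λ i → a * (x i * row z i) + b * (y i * row z i))
      ≡⟨ sumF-+ n _ _ ⟩
    sumF n (λ i → a * (x i * row z i)) + sumF n (λ i → b * (y i * row z i))
      ≡⟨ cong₂ _+_ (sumF-*ˡ n a _) (sumF-*ˡ n b _) ⟩
    a * sumF n (λ i → x i * row z i) + b * sumF n (λ i → y i * row z i)
      ≡⟨ cong₂ (λ s t → a * s + b * t) (B-row x z) (B-row y z) ⟨
    a * B G x z + b * B G y z ∎
    where
    open ≡-Reasoning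
    expand : ∀ a x b y r → (a * x + b * y) * r ≡ a * (x * r) + b * (y * r)
    expand = solve-∀

  B-lincombˡ : ∀ {k} (v : Fin k → Vect n) c z →
    B G (lincomb v c) z ≡ sumF k (λ i → c i * B G (v i) z)
  B-lincombˡ {k} v c z = begin
    B G (lincomb v c) z
      ≡⟨ B-row (lincomb v c) z ⟩
    sumF n (λ j → sumF k (λ i → c i * v i j) * row z j)
      ≡⟨ sumF-cong n (λ j → sumF-*ʳ k (row z j) _) ⟨
    sumF n (λ j → sumF k (λ i → c i * v i j * row z j))
      ≡⟨ sumF-swap n k _ ⟩
    sumF k (λ i → sumF n (λ j → c i * v i j * row z j))
      ≡⟨ sumF-cong k (λ i → sumF-cong n (λ j → ℤ.*-assoc (c i) (v i j) _)) ⟩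
    sumF k (λ i → sumF n (λ j → c i * (v i j * row z j)))
      ≡⟨ sumF-cong k (λ i → sumF-*ˡ n (c i) _) ⟩
    sumF k (λ i → c i * sumF n (λ j → v i j * row z j))
      ≡⟨ sumF-cong k (λ i → cong (c i *_) (B-row (v i) z)) ⟨
    sumF k (λ i → c i * B G (v i) z) ∎
    where open ≡-Reasoning

  B-transpose : ∀ x y → B G x y ≡ B (λ i j → G j i) y x
  B-transpose x y = trans (sumF-swap n n _)
    (sumF-cong n λ j → sumF-cong n λ i → reverse (x i) (G i j) (y j))
    where
    reverse : ∀ a g b → a * g * b ≡ b * g * a
    reverse = solve-∀

module _ {n : ℕ} (G : Mat n) where

  B-lincombʳ : ∀ {k} (v : Fin k → Vect n) c z →
    B G z (lincomb v c) ≡ sumF k (λ i → c i * B G z (v i))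
  B-lincombʳ {k} v c z = begin
    B G z (lincomb v c)                 ≡⟨ B-transpose G z _ ⟩
    B Gᵀ (lincomb v c) z                ≡⟨ B-lincombˡ Gᵀ v c z ⟩
    sumF k (λ i → c i * B Gᵀ (v i) z)   ≡⟨ sumF-cong k (λ i → cong (c i *_) (B-transpose G z (v i))) ⟨
    sumF k (λ i → c i * B G z (v i))    ∎
    where
    open ≡-Reasoning
    Gᵀ = λ i j → G j i

  B-combʳ : ∀ a x b y z → B G z (λ j → a * x j + b * y j) ≡ a * B G z x + b * B G z y
  B-combʳ a x b y z = trans (B-transpose G z _) (trans (B-combˡ (λ i j → G j i) a x b y z)
    (sym (cong₂ (λ s t → a * s + b * t) (B-transpose G z x) (B-transpose G z y))))

  B-comb₂ : ∀ a x b y a′ x′ b′ y′ →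
    B G (λ j → a * x j + b * y j) (λ j → a′ * x′ j + b′ * y′ j) ≡
    a * a′ * B G x x′ + a * b′ * B G x y′ + b * a′ * B G y x′ + b * b′ * B G y y′
  B-comb₂ a x b y a′ x′ b′ y′ = begin
    B G (λ j → a * x j + b * y j) (λ j → a′ * x′ j + b′ * y′ j)
      ≡⟨ B-combˡ G a x b y _ ⟩
    a * B G x (λ j → a′ * x′ j + b′ * y′ j) + b * B G y (λ j → a′ * x′ j + b′ * y′ j)
      ≡⟨ cong₂ (λ s t → a * s + b * t) (B-combʳ a′ x′ b′ y′ x) (B-combʳ a′ x′ b′ y′ y) ⟩
    a * (a′ * B G x x′ + b′ * B G x y′) + b * (a′ * B G y x′ + b′ * B G y y′)
      ≡⟨ expand a b a′ b′ (B G x x′) (B G x y′) (B G y x′) (B G y y′) ⟩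
    a * a′ * B G x x′ + a * b′ * B G x y′ + b * a′ * B G y x′ + b * b′ * B G y y′ ∎
    where
    open ≡-Reasoning
    expand : ∀ a b a′ b′ p q r s → a * (a′ * p + b′ * q) + b * (a′ * r + b′ * s) ≡
      a * a′ * p + a * b′ * q + b * a′ * r + b * b′ * s
    expand = solve-∀

  B-lincomb₂ : ∀ {k} (v : Fin k → Vect n) x y →
    B G (lincomb v x) (lincomb v y) ≡ B (subGram G v) x y
  B-lincomb₂ {k} v x y = begin
    B G (lincomb v x) (lincomb v y)
      ≡⟨ B-lincombˡ G v x _ ⟩
    sumF k (λ i → x i * B G (v i) (lincomb v y))
      ≡⟨ sumF-cong k (λ i → cong (x i *_) (B-lincombʳ v y (v i))) ⟩
    sumF k (λ i → x i * sumF k (λ j → y j * B G (v i) (v j)))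
      ≡⟨ sumF-cong k (λ i → sumF-*ˡ k (x i) _) ⟨
    sumF k (λ i → sumF k (λ j → x i * (y j * B G (v i) (v j))))
      ≡⟨ sumF-cong k (λ i → sumF-cong k (λ j → shuffle (x i) (y j) _)) ⟩
    B (subGram G v) x y ∎
    where
    open ≡-Reasoning
    shuffle : ∀ x y g → x * (y * g) ≡ x * g * y
    shuffle = solve-∀

  B-sym : (∀ i j → G i j ≡ G j i) → ∀ x y → B G x y ≡ B G y x
  B-sym s x y = trans (B-transpose G x y) (B-congᴳ _ y x (λ i j → s j i))

  B-0ˡ : ∀ {x} z → (∀ i → x i ≡ + 0) → B G x z ≡ + 0
  B-0ˡ z e = trans (B-congˡ G z e) (sumF-0 n λ i → sumF-0 n λ j → refl)

  B-*ˡ : ∀ a x z → B G (λ j → a * x j) z ≡ a * B G x z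
  B-*ˡ a x z = trans (B-congˡ G z (λ j → pad a (x j)))
    (trans (B-combˡ G a x (+ 0) x z) (sym (pad a (B G x z))))
    where
    pad : ∀ a y → a * y ≡ a * y + + 0 * y
    pad = solve-∀

  B-*ʳ : ∀ a x z → B G z (λ j → a * x j) ≡ a * B G z x
  B-*ʳ a x z = trans (B-congʳ G z (λ j → pad a (x j)))
    (trans (B-combʳ a x (+ 0) x z) (sym (pad a (B G z x))))
    where
    pad : ∀ a y → a * y ≡ a * y + + 0 * y
    pad = solve-∀

  diagonal : (∀ i j → i ≢ j → G i j ≡ + 0) → ∀ x y → B G x y ≡ sumF n (λ i → G i i * (x i * y i))
  diagonal offdiag x y = sumF-cong n λ i → trans
    (sumF-cong n (λ j → entry i j (i Fin.≟ j)))
    (sumF-δ n i (λ j → G i i * (x i * y i)))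
    where
    δ-refl : ∀ {n} (i : Fin n) → δ i i ≡ + 1
    δ-refl zero    = refl
    δ-refl (suc i) = δ-refl i
    δ-≢ : ∀ {n} (i j : Fin n) → i ≢ j → δ i j ≡ + 0
    δ-≢ zero    zero    i≢j = ⊥-elim (i≢j refl)
    δ-≢ zero    (suc j) i≢j = refl
    δ-≢ (suc i) zero    i≢j = refl
    δ-≢ (suc i) (suc j) i≢j = δ-≢ i j (i≢j ∘ cong suc)
    assoc : ∀ x g y → x * g * y ≡ + 1 * (g * (x * y))
    assoc = solve-∀
    zeroed : ∀ x y → x * + 0 * y ≡ + 0
    zeroed = solve-∀
    entry : ∀ i j → Dec (i ≡ j) → x i * G i j * y j ≡ δ i j * (G i i * (x i * y i))
    entry i .i (yes refl) = trans (assoc (x i) (G i i) (y i)) (cong (_* _) (sym (δ-refl i)))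
    entry i j  (no i≢j)   = trans (cong (λ g → x i * g * y j) (offdiag i j i≢j))
      (trans (zeroed (x i) (y j)) (cong (_* _) (sym (δ-≢ i j i≢j))))

  B-*ᴳ : ∀ a x y → B (λ i j → a * G i j) x y ≡ a * B G x y
  B-*ᴳ a x y = trans (sumF-cong n λ i → trans (sumF-cong n λ j → pull a (x i) (G i j) (y j)) (sumF-*ˡ n a _))
    (sumF-*ˡ n a _)
    where
    pull : ∀ a x g y → x * (a * g) * y ≡ a * (x * g * y)
    pull = solve-∀

-- Bézout identities and cancellation

abs≡sign* : ∀ a → ∃ λ s → + ∣ a ∣ ≡ s * a
abs≡sign* a with ℤ.+∣i∣≡i⊎+∣i∣≡-i a
... | inj₁ e = + 1 , trans e (sym (ℤ.*-identityˡ a))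
... | inj₂ e = ℤ.-1ℤ , trans e (sym (ℤ.-1*i≡-i a))

bezout : ∀ a b → ∃[ d ] ∃[ x ] ∃[ y ] (+ d ∣ a) × (+ d ∣ b) × (+ d ≡ x * a + y * b)
bezout a b with Bézout.lemma ∣ a ∣ ∣ b ∣ | abs≡sign* a | abs≡sign* b
... | Bézout.result d g identity | s , ea | t , eb =
  let x , y , e = xy identity in
  d , x , y , ∣ᵤ⇒∣ (GCD.gcd∣m g) , ∣ᵤ⇒∣ (GCD.gcd∣n g) , e
  where
  cast : ∀ {x y m n} → d ℕ.+ y ℕ.* n ≡ x ℕ.* m → + d + + y * + n ≡ + x * + m
  cast {x} {y} {m} {n} e = trans (cong (λ z → + d + z) (sym (ℤ.pos-* y n)))
    (trans (sym (ℤ.pos-+ d _)) (trans (cong +_ e) (ℤ.pos-* x m)))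
  solveFor : ∀ d p q → d + q ≡ p → d ≡ p - q
  solveFor d p q refl = lemma d q
    where
    lemma : ∀ d q → d ≡ d + q - q
    lemma = solve-∀
  xy : Bézout.Identity d ∣ a ∣ ∣ b ∣ → ∃[ x ] ∃[ y ] + d ≡ x * a + y * b
  xy (Bézout.+- x y e) = + x * s , - (+ y * t) ,
    trans (solveFor _ _ _ (cast {x} {y} e))
      (trans (cong₂ (λ α β → + x * α - + y * β) ea eb) (regroup (+ x) s a (+ y) t b))
    where
    regroup : ∀ x s a y t b → x * (s * a) - y * (t * b) ≡ x * s * a + (- (y * t)) * b
    regroup = solve-∀
  xy (Bézout.-+ x y e) = - (+ x * s) , + y * t ,
    trans (solveFor _ _ _ (cast {y} {x} e))
      (trans (cong₂ (λ α β → + y * β - + x * α) ea eb) (regroup (+ x) s a (+ y) t b))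
    where
    regroup : ∀ x s a y t b → y * (t * b) - x * (s * a) ≡ (- (x * s)) * a + y * t * b
    regroup = solve-∀

bezoutF : ∀ n (f : Fin n → ℤ) →
  ∃[ d ] Σ (Vect n) λ c → (∀ i → + d ∣ f i) × (+ d ≡ sumF n (λ i → c i * f i))
bezoutF zero    f = 0 , (λ ()) , (λ ()) , refl
bezoutF (suc n) f with bezoutF n (f ∘ suc)
... | e , c , e∣f , e≡ with bezout (f zero) (+ e)
... | d , x , y , d∣f₀ , d∣e , d≡ = d , c′ , d∣f , trans d≡ (+-congʳ (x * f zero) tail)
  where
  c′ : Fin (suc n) → ℤ
  c′ zero    = x
  c′ (suc i) = y * c i
  d∣f : ∀ i → + d ∣ f i
  d∣f zero    = d∣f₀
  d∣f (suc i) = ∣-trans d∣e (e∣f i)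
  tail : y * + e ≡ sumF n (λ i → y * c i * f (suc i))
  tail = trans (cong (y *_) e≡) (trans (sym (sumF-*ˡ n y (λ i → c i * f (suc i))))
    (sumF-cong n (λ i → sym (ℤ.*-assoc y (c i) (f (suc i))))))

*-cancelˡ : ∀ k i j → k ≢ + 0 → k * i ≡ k * j → i ≡ j
*-cancelˡ k i j k≢0 = ℤ.*-cancelˡ-≡ k i j {{ℤ.≢-nonZero k≢0}}

*-nonZero : ∀ {i j} → i ≢ + 0 → j ≢ + 0 → i * j ≢ + 0
*-nonZero {i} i≢0 j≢0 e = [ i≢0 , j≢0 ]′ (ℤ.i*j≡0⇒i≡0∨j≡0 i e)

+suc≢0 : ∀ {n} → + suc n ≢ + 0
+suc≢0 ()

-- In these identities q = m′m is half the norm of w, the vectors are (ρᵢw + myᵢ)/m, and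
-- η = B w y, β = B y y′.
module DescentArithmetic (m : ℤ) (m≢0 : m ≢ + 0) where

  -- The lattice is even, so the norm of y enters as 2t and the equation can be halved before it is
  -- read modulo m. For even m, the divisibility of 2ρ²q by m would not be enough.
  halves : ∀ ρ q η t Γ → ρ * ρ * (+ 2 * q) + m * (ρ * η + ρ * η) + m * m * (+ 2 * t) ≡ m * m * (+ 2 * Γ) →
    ρ * (ρ * q) ≡ (m * Γ - ρ * η - m * t) * m
  halves ρ q η t Γ e = *-cancelˡ (+ 2) (ρ * (ρ * q)) ((m * Γ - ρ * η - m * t) * m) (λ ()) (begin
    + 2 * (ρ * (ρ * q))                                                                    ≡⟨ isolate m ρ q η t ⟩
    ρ * ρ * (+ 2 * q) + m * (ρ * η + ρ * η) + m * m * (+ 2 * t) - + 2 * ((ρ * η + m * t) * m)  ≡⟨ cong (λ z → z - + 2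
        * ((ρ * η + m * t) * m)) e ⟩
    m * m * (+ 2 * Γ) - + 2 * ((ρ * η + m * t) * m)                                        ≡⟨ collect m ρ η t Γ ⟩
    + 2 * ((m * Γ - ρ * η - m * t) * m)                                                    ∎)
    where
    open ≡-Reasoning
    isolate : ∀ m ρ q η t → + 2 * (ρ * (ρ * q)) ≡
      ρ * ρ * (+ 2 * q) + m * (ρ * η + ρ * η) + m * m * (+ 2 * t) - + 2 * ((ρ * η + m * t) * m)
    isolate = solve-∀
    collect : ∀ m ρ η t Γ → m * m * (+ 2 * Γ) - + 2 * ((ρ * η + m * t) * m) ≡ + 2 * ((m * Γ - ρ * η - m * t) * m)
    collect = solve-∀

  diagonalStep : ∀ ρ q m′ η t Γ → q ≡ m′ * m → ρ * (ρ * q) ≡ (m * Γ - ρ * η - m * t) * m →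
    ρ * (ρ * m′ + η) ≡ (Γ - t) * m
  diagonalStep ρ .(m′ * m) m′ η t Γ refl e = *-cancelˡ m (ρ * (ρ * m′ + η)) ((Γ - t) * m) m≢0 (begin
    m * (ρ * (ρ * m′ + η))                          ≡⟨ expand m ρ m′ η ⟩
    ρ * (ρ * (m′ * m)) + m * (ρ * η)                ≡⟨ cong (λ z → z + m * (ρ * η)) e ⟩
    (m * Γ - ρ * η - m * t) * m + m * (ρ * η)       ≡⟨ collect m ρ η Γ t ⟩
    m * ((Γ - t) * m)                               ∎)
    where
    open ≡-Reasoning
    expand : ∀ m ρ m′ η → m * (ρ * (ρ * m′ + η)) ≡ ρ * (ρ * (m′ * m)) + m * (ρ * η)
    expand = solve-∀
    collect : ∀ m ρ η Γ t → (m * Γ - ρ * η - m * t) * m + m * (ρ * η) ≡ m * ((Γ - t) * m)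
    collect = solve-∀

  offDiagonalStep : ∀ ρ ρ′ q m′ x β Γ → q ≡ m′ * m →
    ρ * ρ′ * (+ 2 * q) + m * x + m * m * β ≡ m * m * (+ 2 * Γ) →
    + 2 * (ρ * ρ′ * m′) + x ≡ (+ 2 * Γ - β) * m
  offDiagonalStep ρ ρ′ .(m′ * m) m′ x β Γ refl e =
    *-cancelˡ m (+ 2 * (ρ * ρ′ * m′) + x) ((+ 2 * Γ - β) * m) m≢0 (begin
    m * (+ 2 * (ρ * ρ′ * m′) + x)                                       ≡⟨ expand m ρ ρ′ m′ x β ⟩
    ρ * ρ′ * (+ 2 * (m′ * m)) + m * x + m * m * β - m * m * β           ≡⟨ cong (λ z → z - m * m * β) e ⟩
    m * m * (+ 2 * Γ) - m * m * β                                       ≡⟨ collect m Γ β ⟩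
    m * ((+ 2 * Γ - β) * m)                                             ∎)
    where
    open ≡-Reasoning
    expand : ∀ m ρ ρ′ m′ x β → m * (+ 2 * (ρ * ρ′ * m′) + x) ≡ ρ * ρ′ * (+ 2 * (m′ * m)) + m * x + m * m * β - m * m * β
    expand = solve-∀
    collect : ∀ m Γ β → m * m * (+ 2 * Γ) - m * m * β ≡ m * ((+ 2 * Γ - β) * m)
    collect = solve-∀

  -- Eliminating η and η′ through s and s′ turns the old and the new Gram entry into the same
  -- expression `ρ * s′ + ρ′ * s + β`, up to the squares of the denominators.
  gramStep : ∀ ρ ρ′ s s′ q m′ η η′ β γ → q ≡ m′ * m → ρ * m′ + η ≡ s * m → ρ′ * m′ + η′ ≡ s′ * m →
    ρ * ρ′ * (+ 2 * q) + m * (ρ * η′ + ρ′ * η) + m * m * β ≡ m * m * (+ 2 * γ) →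
    - s * - s′ * (+ 2 * q) + m′ * (- s * η′ + - s′ * η) + m′ * m′ * β ≡ m′ * m′ * (+ 2 * γ)
  gramStep ρ ρ′ s s′ .(m′ * m) m′ η η′ β γ refl e e′ g = begin
    - s * - s′ * (+ 2 * (m′ * m)) + m′ * (- s * η′ + - s′ * η) + m′ * m′ * β
      ≡⟨ cong₂ (λ a b → - s * - s′ * (+ 2 * (m′ * m)) + m′ * (- s * b + - s′ * a) + m′ * m′ * β) (η≡ ρ η s e) (η≡ ρ′
          η′ s′ e′) ⟩
    - s * - s′ * (+ 2 * (m′ * m)) + m′ * (- s * (s′ * m - ρ′ * m′) + - s′ * (s * m - ρ * m′)) + m′ * m′ * β
      ≡⟨ simplify m m′ s s′ ρ ρ′ β ⟩
    m′ * m′ * (ρ * s′ + ρ′ * s + β)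
      ≡⟨ cong (m′ * m′ *_) 2γ≡ ⟨
    m′ * m′ * (+ 2 * γ) ∎
    where
    open ≡-Reasoning
    η≡ : ∀ ρ η s → ρ * m′ + η ≡ s * m → η ≡ s * m - ρ * m′
    η≡ ρ η s e = trans (isolate ρ m′ η) (cong (λ z → z - ρ * m′) e)
      where
      isolate : ∀ ρ m′ η → η ≡ ρ * m′ + η - ρ * m′
      isolate = solve-∀
    simplify : ∀ m m′ s s′ ρ ρ′ β →
      - s * - s′ * (+ 2 * (m′ * m)) + m′ * (- s * (s′ * m - ρ′ * m′) + - s′ * (s * m - ρ * m′)) + m′ * m′ * β ≡
      m′ * m′ * (ρ * s′ + ρ′ * s + β)
    simplify = solve-∀
    simplify′ : ∀ m m′ s s′ ρ ρ′ β →
      ρ * ρ′ * (+ 2 * (m′ * m)) + m * (ρ * (s′ * m - ρ′ * m′) + ρ′ * (s * m - ρ * m′)) + m * m * β ≡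
      m * m * (ρ * s′ + ρ′ * s + β)
    simplify′ = solve-∀
    2γ≡ : + 2 * γ ≡ ρ * s′ + ρ′ * s + β
    2γ≡ = *-cancelˡ (m * m) (+ 2 * γ) (ρ * s′ + ρ′ * s + β) (*-nonZero m≢0 m≢0) (begin
      m * m * (+ 2 * γ)
        ≡⟨ g ⟨
      ρ * ρ′ * (+ 2 * (m′ * m)) + m * (ρ * η′ + ρ′ * η) + m * m * β
        ≡⟨ cong₂ (λ a b → ρ * ρ′ * (+ 2 * (m′ * m)) + m * (ρ * b + ρ′ * a) + m * m * β) (η≡ ρ η s e) (η≡ ρ′ η′ s′ e′) ⟩
      ρ * ρ′ * (+ 2 * (m′ * m)) + m * (ρ * (s′ * m - ρ′ * m′) + ρ′ * (s * m - ρ * m′)) + m * m * β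
        ≡⟨ simplify′ m m′ s s′ ρ ρ′ β ⟩
      m * m * (ρ * s′ + ρ′ * s + β) ∎)

-- The Aubry–Davenport–Cassels descent

-- Lengths are measured by half the norm. The bound q < m² in `approx` says that w/m is at distance
-- less than 1 from z, and it makes the next denominator q/m smaller than m.
record Covering {n} (G : Mat n) : Set where
  field
    symmetric : ∀ i j → G i j ≡ G j i
    even      : ∀ x → ∃[ q ] B G x x ≡ + 2 * q
    definite  : ∀ x → B G x x ≡ + 0 → ∀ i → x i ≡ + 0
    approx    : ∀ m → 0 < m → ∀ (w : Vect n) → Σ (Vect n) λ w′ → Σ (Vect n) λ z → Σ ℕ λ q →
      (∀ (j : Fin n) → w j ≡ w′ j + + m * z j) × B G w′ w′ ≡ + 2 * + q × q < m ℕ.* m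

module Descent {n} {G : Mat n} (C : Covering G) where
  open Covering C

  -- The numerators of the vectors yᵢ + (ρᵢ/m)w: all fractional parts are multiples of one vector w,
  -- so a single reflection acts on all of them.
  frac : ∀ {k} → ℤ → (Fin k → ℤ) → Vect n → (Fin k → Vect n) → Fin k → Vect n
  frac m ρ w y i j = ρ i * w j + m * y i j

  private
    pair : ∀ m w ρ y ρ′ y′ → B G (λ j → ρ * w j + m * y j) (λ j → ρ′ * w j + m * y′ j) ≡
      ρ * ρ′ * B G w w + m * (ρ * B G w y′ + ρ′ * B G w y) + m * m * B G y y′
    pair m w ρ y ρ′ y′ = trans (B-comb₂ G ρ w m y ρ′ w m y′)
      (trans (cong (λ t → ρ * ρ′ * B G w w + ρ * m * B G w y′ + m * ρ′ * t + m * m * B G y y′)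
                   (B-sym G symmetric y w))
             (regroup m ρ ρ′ (B G w w) (B G w y) (B G w y′) (B G y y′)))
      where
      regroup : ∀ m ρ ρ′ q η η′ β → ρ * ρ′ * q + ρ * m * η′ + m * ρ′ * η + m * m * β ≡
        ρ * ρ′ * q + m * (ρ * η′ + ρ′ * η) + m * m * β
      regroup = solve-∀

  -- Reflecting in w replaces the denominator m by m′ = Q(w)/m, where Q is half the norm.
  module Reflect {k} (γ : Mat k) (m : ℤ) (m≢0 : m ≢ + 0)
    (ρ : Fin k → ℤ) (w : Vect n) (y : Fin k → Vect n)
    (gram : ∀ i j → B G (frac m ρ w y i) (frac m ρ w y j) ≡ m * m * (+ 2 * γ i j))
    (c₀ : ℤ) (c : Vect k) (unit : + 1 ≡ c₀ * m + sumF k (λ i → c i * ρ i))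
    (q : ℤ) (normw : B G w w ≡ + 2 * q) where

    open DescentArithmetic m m≢0

    private
      η : Fin k → ℤ
      η i = B G w (y i)

      ρc : ℤ
      ρc = sumF k (λ i → c i * ρ i)

      yc : Vect n
      yc = lincomb y c

      ηc : ℤ
      ηc = B G w yc

      vc≡ : ∀ j → lincomb (frac m ρ w y) c j ≡ ρc * w j + m * yc j
      vc≡ j = trans (sumF-cong k (λ i → expand (c i) (ρ i) (w j) m (y i j)))
        (trans (sumF-+ k (λ i → c i * ρ i * w j) (λ i → m * (c i * y i j)))
          (cong₂ _+_ (sumF-*ʳ k (w j) (λ i → c i * ρ i)) (sumF-*ˡ k m (λ i → c i * y i j))))
        where
        expand : ∀ c ρ w m y → c * (ρ * w + m * y) ≡ c * ρ * w + m * (c * y)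
        expand = solve-∀

      -- By `unit`, ρc is invertible modulo m.
      cancelUnit : ∀ {x} → m ∣ ρc * x → m ∣ x
      cancelUnit {x} d = subst (m ∣_) (trans (split c₀ m ρc x) (trans (cong (_* x) (sym unit)) (ℤ.*-identityˡ x)))
        (∣m∣n⇒∣m+n (∣n⇒∣m*n (c₀ * x) ∣-refl) d)
        where
        split : ∀ c₀ m ρ x → c₀ * x * m + ρ * x ≡ (c₀ * m + ρ) * x
        split = solve-∀

      Γ : ℤ
      Γ = sumF k (λ i → c i * sumF k (λ j → c j * γ i j))

      gramcc : B G (lincomb (frac m ρ w y) c) (lincomb (frac m ρ w y) c) ≡ m * m * (+ 2 * Γ)
      gramcc = begin
        B G V V                                                           ≡⟨ B-lincombˡ G (frac m ρ w y) c V ⟩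
        sumF k (λ i → c i * B G (frac m ρ w y i) V)                       ≡⟨ sumF-cong k (λ i → cong (c i *_) (inner
            i)) ⟩
        sumF k (λ i → c i * (m * m * + 2 * sumF k (λ j → c j * γ i j)))   ≡⟨ sumF-cong k (λ i → pull (c i) m (sumF k
            (λ j → c j * γ i j))) ⟩
        sumF k (λ i → m * m * + 2 * (c i * sumF k (λ j → c j * γ i j)))   ≡⟨ sumF-*ˡ k (m * m * + 2) (λ i → c i *
            sumF k (λ j → c j * γ i j)) ⟩
        m * m * + 2 * Γ                                                   ≡⟨ ℤ.*-assoc (m * m) (+ 2) Γ ⟩
        m * m * (+ 2 * Γ)                                                 ∎
        where
        open ≡-Reasoning
        V = lincomb (frac m ρ w y) c
        pull : ∀ c m s → c * (m * m * + 2 * s) ≡ m * m * + 2 * (c * s)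
        pull = solve-∀
        pull′ : ∀ c m s → c * (m * m * (+ 2 * s)) ≡ m * m * + 2 * (c * s)
        pull′ = solve-∀
        inner : ∀ i → B G (frac m ρ w y i) V ≡ m * m * + 2 * sumF k (λ j → c j * γ i j)
        inner i = trans (B-lincombʳ G (frac m ρ w y) c (frac m ρ w y i))
          (trans (sumF-cong k (λ j → trans (cong (c j *_) (gram i j)) (pull′ (c j) m (γ i j)))) (sumF-*ˡ k (m * m * +
              2) (λ j → c j * γ i j)))

      tc : ℤ
      tc = proj₁ (even yc)

      ρρq : ρc * (ρc * q) ≡ (m * Γ - ρc * ηc - m * tc) * m
      ρρq = halves ρc q ηc tc Γ (begin
        ρc * ρc * (+ 2 * q) + m * (ρc * ηc + ρc * ηc) + m * m * (+ 2 * tc)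
          ≡⟨ cong₂ (λ a b → ρc * ρc * a + m * (ρc * ηc + ρc * ηc) + m * m * b) normw (proj₂ (even yc)) ⟨
        ρc * ρc * B G w w + m * (ρc * ηc + ρc * ηc) + m * m * B G yc yc
          ≡⟨ pair m w ρc yc ρc yc ⟨
        B G (λ j → ρc * w j + m * yc j) (λ j → ρc * w j + m * yc j)
          ≡⟨ B-cong G vc≡ vc≡ ⟨
        B G (lincomb (frac m ρ w y) c) (lincomb (frac m ρ w y) c)
          ≡⟨ gramcc ⟩
        m * m * (+ 2 * Γ) ∎)
        where open ≡-Reasoning

      m∣q : m ∣ q
      m∣q = cancelUnit (cancelUnit (divides (m * Γ - ρc * ηc - m * tc) ρρq))

      m′ : ℤ
      m′ = quotient m∣q

      q≡ : q ≡ m′ * m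
      q≡ = _∣_.equality m∣q

      m∣c : m ∣ ρc * m′ + ηc
      m∣c = cancelUnit (divides (Γ - tc) (diagonalStep ρc q m′ ηc tc Γ q≡ ρρq))

      module _ (i : Fin k) where
        Γᵢ : ℤ
        Γᵢ = sumF k (λ j → c j * γ j i)

        gramci : B G (lincomb (frac m ρ w y) c) (frac m ρ w y i) ≡ m * m * (+ 2 * Γᵢ)
        gramci = trans (B-lincombˡ G (frac m ρ w y) c (frac m ρ w y i))
          (trans (sumF-cong k (λ j → trans (cong (c j *_) (gram j i)) (pull (c j) m (γ j i))))
          (trans (sumF-*ˡ k (m * m * + 2) (λ j → c j * γ j i)) (ℤ.*-assoc (m * m) (+ 2) Γᵢ)))
          where
          pull : ∀ c m s → c * (m * m * (+ 2 * s)) ≡ m * m * + 2 * (c * s)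
          pull = solve-∀

        cross : ρc * ρ i * (+ 2 * q) + m * (ρc * η i + ρ i * ηc) + m * m * B G yc (y i) ≡ m * m * (+ 2 * Γᵢ)
        cross = trans (cong (λ a → ρc * ρ i * a + m * (ρc * η i + ρ i * ηc) + m * m * B G yc (y i)) (sym normw))
          (trans (sym (pair m w ρc yc (ρ i) (y i))) (trans (sym (B-congˡ G (frac m ρ w y i) vc≡)) gramci))

        m∣cross : m ∣ + 2 * (ρc * ρ i * m′) + (ρc * η i + ρ i * ηc)
        m∣cross = divides (+ 2 * Γᵢ - B G yc (y i))
          (offDiagonalStep ρc (ρ i) q m′ (ρc * η i + ρ i * ηc) (B G yc (y i)) Γᵢ q≡ cross)

        -- The combination with coefficients c has an integral product with the i-th vector, which
        -- gives `m∣cross`. Subtracting ρᵢ times `m∣c` leaves ρc times the wanted term.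
        m∣s : m ∣ ρ i * m′ + η i
        m∣s = cancelUnit (subst (m ∣_) (eliminate ρc (ρ i) m′ (η i) ηc)
          (∣m∣n⇒∣m-n m∣cross (∣n⇒∣m*n (ρ i) m∣c)))
          where
          eliminate : ∀ ρ ρ′ m′ η′ η → + 2 * (ρ * ρ′ * m′) + (ρ * η′ + ρ′ * η) - ρ′ * (ρ * m′ + η) ≡ ρ * (ρ′ * m′ + η′)
          eliminate = solve-∀

      -- The reflection in w sends yᵢ + (ρᵢ/m)w to yᵢ - (sᵢ/m′)w.
      s : Fin k → ℤ
      s i = quotient (m∣s i)

      gram′ : ∀ i j → B G (frac m′ (λ i → - s i) w y i) (frac m′ (λ i → - s i) w y j) ≡ m′ * m′ * (+ 2 * γ i j)
      gram′ i j = trans (pair m′ w (- s i) (y i) (- s j) (y j))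
        (trans (cong (λ t → - s i * - s j * t + m′ * (- s i * η j + - s j * η i) + m′ * m′ * B G (y i) (y j)) normw)
          (gramStep (ρ i) (ρ j) (s i) (s j) q m′ (η i) (η j) (B G (y i) (y j)) (γ i j)
            q≡ (_∣_.equality (m∣s i)) (_∣_.equality (m∣s j)) integral))
        where
        integral : ρ i * ρ j * (+ 2 * q) + m * (ρ i * η j + ρ j * η i) + m * m * B G (y i) (y j) ≡ m * m * (+ 2 * γ i j)
        integral = trans (cong (λ t → ρ i * ρ j * t + m * (ρ i * η j + ρ j * η i) + m * m * B G (y i) (y j)) (sym
            normw))
          (trans (sym (pair m w (ρ i) (y i) (ρ j) (y j))) (gram i j))

    reflected : Σ ℤ λ m′ → Σ (Fin k → ℤ) λ ρ′ → q ≡ m′ * m ×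
      (∀ i j → B G (frac m′ ρ′ w y i) (frac m′ ρ′ w y j) ≡ m′ * m′ * (+ 2 * γ i j))
    reflected = m′ , (λ i → - s i) , q≡ , gram′

module FullDescent {n} {G : Mat n} (C : Covering G) where
  open Covering C
  open Descent C

  record Gram {k} (γ : Mat k) (m : ℕ) (v : Fin k → Vect n) : Set where
    constructor gramian
    field products : ∀ i j → B G (v i) (v j) ≡ + m * + m * (+ 2 * γ i j)
  open Gram

  Gram-cong : ∀ {k} {γ : Mat k} m {u v} → (∀ i j → u i j ≡ v i j) → Gram γ m u → Gram γ m v
  Gram-cong m {u} {v} e g = gramian λ i j → trans (sym (B-cong G {u i} {v i} {u j} {v j} (e i) (e j))) (products g i j)

  Gram-scale : ∀ {k} {γ : Mat k} d m {u} → 0 < d → Gram γ (m ℕ.* d) (λ i j → + d * u i j) → Gram γ m u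
  Gram-scale {γ = γ} d@(suc _) m {u} d>0 g = gramian λ i j → *-cancelˡ (+ d * + d) (B G (u i) (u j)) (+ m * + m * (+
      2 * γ i j)) (λ ()) (begin
    + d * + d * B G (u i) (u j)                          ≡⟨ ℤ.*-assoc (+ d) (+ d) _ ⟩
    + d * (+ d * B G (u i) (u j))                        ≡⟨ cong (+ d *_) (B-*ʳ G (+ d) (u j) (u i)) ⟨
    + d * B G (u i) (λ l → + d * u j l)                  ≡⟨ B-*ˡ G (+ d) (u i) _ ⟨
    B G (λ l → + d * u i l) (λ l → + d * u j l)          ≡⟨ products g i j ⟩
    + (m ℕ.* d) * + (m ℕ.* d) * (+ 2 * γ i j)            ≡⟨ cong (λ t → t * t * (+ 2 * γ i j)) (ℤ.pos-* m d) ⟩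
    + m * + d * (+ m * + d) * (+ 2 * γ i j)              ≡⟨ regroup (+ m) (+ d) (+ 2 * γ i j) ⟩
    + d * + d * (+ m * + m * (+ 2 * γ i j))              ∎)
    where
    open ≡-Reasoning
    regroup : ∀ m d γ → m * d * (m * d) * γ ≡ d * d * (m * m * γ)
    regroup = solve-∀

  -- A common divisor of m and all ρᵢ is divided out. If there is none, w is reduced modulo m, which
  -- changes only the yᵢ, and the reflection in the reduced w has denominator q/m, less than m
  -- because q < m².
  descend : ∀ {k} (γ : Mat k) m → Acc _<_ m → 0 < m → ∀ ρ w y →
    Gram γ m (frac (+ m) ρ w y) → ∃ (Gram γ 1)
  descend {k} γ m@(suc _) (acc rec) m>0 ρ w y gram = go (bezoutF (suc k) coeffs)
    where
    coeffs : Fin (suc k) → ℤ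
    coeffs zero    = + m
    coeffs (suc i) = ρ i

    go : (∃[ d ] Σ (Vect (suc k)) λ c → (∀ i → + d ∣ coeffs i) × (+ d ≡ sumF (suc k) (λ i → c i * coeffs i))) → ∃
        (Gram γ 1)
    go (zero , c , d∣ , d≡) with 0∣⇒≡0 (d∣ zero)
    ... | ()
    go (d@(suc (suc _)) , c , d∣ , d≡) =
      descend γ m₁ (rec m₁<m) m₁>0 ρ₁ w y (Gram-scale d m₁ (ℕ.s≤s ℕ.z≤n) (subst (λ t → Gram γ t (λ i j → + d * frac
          (+ m₁) ρ₁ w y i j)) m≡ (Gram-cong m pull gram)))
      where
      d∣m = ∣⇒∣ᵤ (d∣ zero)
      m₁ = ℕ∣.quotient d∣m
      m≡ : m ≡ m₁ ℕ.* d
      m≡ = ℕ∣._∣_.equality d∣m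
      m₁<m : m₁ < m
      m₁<m = ℕ∣.quotient-< d∣m
      m₁>0 : 0 < m₁
      m₁>0 = ℕ.n≢0⇒n>0 (λ e → ℕ.1+n≢0 (trans m≡ (cong (ℕ._* d) e)))
      ρ₁ = λ i → quotient (d∣ (suc i))
      pull : ∀ i j → frac (+ m) ρ w y i j ≡ + d * frac (+ m₁) ρ₁ w y i j
      pull i j = trans (cong₂ (λ r t → r * w j + t * y i j) (_∣_.equality (d∣ (suc i))) (trans (cong +_ m≡) (ℤ.pos-*
          m₁ d)))
        (regroup (ρ₁ i) (+ d) (w j) (+ m₁) (y i j))
        where
        regroup : ∀ ρ d w m y → ρ * d * w + m * d * y ≡ d * (ρ * w + m * y)
        regroup = solve-∀
    go (1 , c , d∣ , d≡) = step (approx m m>0 w)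
      where
      step : (Σ (Vect n) λ w′ → Σ (Vect n) λ z → Σ ℕ λ q →
        (∀ (j : Fin n) → w j ≡ w′ j + + m * z j) × B G w′ w′ ≡ + 2 * + q × q < m ℕ.* m) → ∃ (Gram γ 1)
      step (w′ , z , q , w≡ , norm , q<) =
          finish (Reflect.reflected γ (+ m) (λ ()) ρ w′ y′ (products gram₁) (c zero) (c ∘ suc) d≡ (+ q) norm)
        where
        y′ : Fin k → Vect n
        y′ i j = y i j + ρ i * z j
        moved : ∀ i j → frac (+ m) ρ w y i j ≡ frac (+ m) ρ w′ y′ i j
        moved i j = trans (cong (λ t → ρ i * t + + m * y i j) (w≡ j)) (regroup (ρ i) (w′ j) (+ m) (z j) (y i j))
          where
          regroup : ∀ ρ w m z y → ρ * (w + m * z) + m * y ≡ ρ * w + m * (y + ρ * z)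
          regroup = solve-∀
        gram₁ : Gram γ m (frac (+ m) ρ w′ y′)
        gram₁ = Gram-cong m moved gram
        finish : (Σ ℤ λ m′ → Σ (Fin k → ℤ) λ ρ′ → + q ≡ m′ * + m ×
          (∀ i j → B G (frac m′ ρ′ w′ y′ i) (frac m′ ρ′ w′ y′ j) ≡ m′ * m′ * (+ 2 * γ i j))) → ∃ (Gram γ 1)
        finish (m′ , ρ′ , q≡ , gram′) = bySize ∣ m′ ∣ (trans (cong ∣_∣ q≡) (ℤ.abs-* m′ (+ m))) m′≡
          where
          m′≡ : m′ ≡ + ∣ m′ ∣
          m′≡ = ℤ.*-cancelʳ-≡ m′ (+ ∣ m′ ∣) (+ m) (trans (sym q≡)
            (trans (cong +_ (trans (cong ∣_∣ q≡) (ℤ.abs-* m′ (+ m)))) (ℤ.pos-* ∣ m′ ∣ m)))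
          bySize : ∀ t → q ≡ t ℕ.* m → m′ ≡ + t → ∃ (Gram γ 1)
          -- Here w′ has norm 0, so w was a multiple of m and the vectors are the integral y′ᵢ.
          bySize zero e _ = y′ , Gram-scale m 1 m>0 (subst (λ t → Gram γ t (λ i j → + m * y′ i j)) (sym
              (ℕ.*-identityˡ m)) (Gram-cong m vanish gram₁))
            where
            vanish : ∀ i j → frac (+ m) ρ w′ y′ i j ≡ + m * y′ i j
            vanish i j = trans (cong (λ t → ρ i * t + + m * y′ i j) (definite w′ (trans norm (cong (λ t → + 2 * + t)
                e)) j)) (drop (ρ i) (+ m * y′ i j))
              where
              drop : ∀ ρ x → ρ * + 0 + x ≡ x
              drop = solve-∀
          bySize t@(suc _) e m′≡t = descend γ t (rec (ℕ.*-cancelʳ-< m t m (subst (_< m ℕ.* m) e q<))) (ℕ.s≤s ℕ.z≤n)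
              ρ′ w′ y′
            (gramian (subst (λ x → ∀ i j → B G (frac x ρ′ w′ y′ i) (frac x ρ′ w′ y′ j) ≡ x * x * (+ 2 * γ i j)) m′≡t
                gram′))

-- The form ⟨1,1,1,1,1,3⟩ and the Hurwitz-Eisenstein lattice

rows : ∀ {m n} → Vec (Vec ℤ n) m → Fin m → Vect n
rows M i j = lookup (lookup M i) j

≡Mat? : ∀ {m n} (G H : Fin m → Fin n → ℤ) → Dec (∀ i j → G i j ≡ H i j)
≡Mat? G H = Fin.all? λ i → Fin.all? λ j → G i j ℤ.≟ H i j

J : Mat 6
J = I 5 ⊥ diag1 (+ 3)

J-sym : ∀ i j → J i j ≡ J j i
J-sym = from-yes (≡Mat? J (λ i j → J j i))

J-form : ∀ x y → B J x y ≡ x 0F * y 0F + (x 1F * y 1F + (x 2F * y 2F +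
  (x 3F * y 3F + (x 4F * y 4F + + 3 * (x 5F * y 5F)))))
J-form x y = trans (diagonal J offdiag x y)
  (tidy (x 0F * y 0F) (x 1F * y 1F) (x 2F * y 2F) (x 3F * y 3F) (x 4F * y 4F) (x 5F * y 5F))
  where
  offdiag : ∀ i j → i ≢ j → J i j ≡ + 0
  offdiag i j i≢j with from-yes (Fin.all? λ i → Fin.all? λ j → (i Fin.≟ j) ⊎-dec (J i j ℤ.≟ + 0)) i j
  ... | inj₁ i≡j = ⊥-elim (i≢j i≡j)
  ... | inj₂ e   = e
  tidy : ∀ a b c d e f → + 1 * a + (+ 1 * b + (+ 1 * c + (+ 1 * d + (+ 1 * e + (+ 3 * f + + 0))))) ≡
    a + (b + (c + (d + (e + + 3 * f))))
  tidy = solve-∀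

sq : ℤ → ℕ
sq x = ∣ x ∣ ℕ.* ∣ x ∣

+sq : ∀ x → x * x ≡ + sq x
+sq (+ n)     = sym (ℤ.pos-* n n)
+sq (-[1+ n ]) = refl

sq≡0 : ∀ {x} → sq x ≡ 0 → x ≡ + 0
sq≡0 {x} e = ℤ.∣i∣≡0⇒i≡0 ([ (λ z → z) , (λ z → z) ]′ (ℕ.m*n≡0⇒m≡0∨n≡0 ∣ x ∣ e))

J-norm : Vect 6 → ℕ
J-norm x = sq (x 0F) ℕ.+ (sq (x 1F) ℕ.+ (sq (x 2F) ℕ.+ (sq (x 3F) ℕ.+ (sq (x 4F) ℕ.+ 3 ℕ.* sq (x 5F)))))

J-norm-correct : ∀ x → B J x x ≡ + J-norm x
J-norm-correct x = trans (J-form x x) (cong₂ _+_ (+sq (x 0F)) (cong₂ _+_ (+sq (x 1F)) (cong₂ _+_ (+sq (x 2F))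
  (cong₂ _+_ (+sq (x 3F)) (cong₂ _+_ (+sq (x 4F)) (trans (cong (+ 3 *_) (+sq (x 5F))) (sym (ℤ.pos-* 3 (sq (x
      5F))))))))))

J-definite : ∀ x → B J x x ≡ + 0 → ∀ i → x i ≡ + 0
J-definite x e = parts (ℤ.+-injective (trans (sym (J-norm-correct x)) e))
  where
  parts : J-norm x ≡ 0 → ∀ i → x i ≡ + 0
  parts e 0F = sq≡0 (ℕ.m+n≡0⇒m≡0 _ e)
  parts e 1F = sq≡0 (ℕ.m+n≡0⇒m≡0 _ (ℕ.m+n≡0⇒n≡0 (sq (x 0F)) e))
  parts e 2F = sq≡0 (ℕ.m+n≡0⇒m≡0 _ (ℕ.m+n≡0⇒n≡0 (sq (x 1F)) (ℕ.m+n≡0⇒n≡0 (sq (x 0F)) e)))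
  parts e 3F = sq≡0 (ℕ.m+n≡0⇒m≡0 _ (ℕ.m+n≡0⇒n≡0 (sq (x 2F)) (ℕ.m+n≡0⇒n≡0 (sq (x 1F)) (ℕ.m+n≡0⇒n≡0 (sq (x 0F)) e))))
  parts e 4F = sq≡0 (ℕ.m+n≡0⇒m≡0 _ (ℕ.m+n≡0⇒n≡0 (sq (x 3F)) (ℕ.m+n≡0⇒n≡0 (sq (x 2F)) (ℕ.m+n≡0⇒n≡0 (sq (x 1F))
      (ℕ.m+n≡0⇒n≡0 (sq (x 0F)) e)))))
  parts e 5F = sq≡0 (ℕ.m+n≡0⇒m≡0 _ (ℕ.m+n≡0⇒n≡0 (sq (x 4F)) (ℕ.m+n≡0⇒n≡0 (sq (x 3F)) (ℕ.m+n≡0⇒n≡0 (sq (x 2F))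
      (ℕ.m+n≡0⇒n≡0 (sq (x 1F)) (ℕ.m+n≡0⇒n≡0 (sq (x 0F)) e))))))

-- The Hurwitz quaternions ½(x₁ + x₂i + x₃j + x₄k) and the Eisenstein integers ½(x₀ + x₅√-3),
-- written in the doubled coordinates x: doubling multiplies J by 4, hence the Gram matrix HE,
-- which is twice the polarised norm, satisfies 2 · HE = (J in doubled coordinates).
doubled : Fin 6 → Vect 6
doubled = rows
  ( (+ 2 ∷ + 0 ∷ + 0 ∷ + 0 ∷ + 0 ∷ + 0 ∷ [])
  ∷ (+ 0 ∷ + 1 ∷ + 1 ∷ + 1 ∷ + 1 ∷ + 0 ∷ [])
  ∷ (+ 0 ∷ + 0 ∷ + 2 ∷ + 0 ∷ + 0 ∷ + 0 ∷ [])
  ∷ (+ 0 ∷ + 0 ∷ + 0 ∷ + 2 ∷ + 0 ∷ + 0 ∷ [])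
  ∷ (+ 0 ∷ + 0 ∷ + 0 ∷ + 0 ∷ + 2 ∷ + 0 ∷ [])
  ∷ (+ 1 ∷ + 0 ∷ + 0 ∷ + 0 ∷ + 0 ∷ + 1 ∷ []) ∷ [])

HE : Mat 6
HE = rows
  ( (+ 2 ∷ + 0 ∷ + 0 ∷ + 0 ∷ + 0 ∷ + 1 ∷ [])
  ∷ (+ 0 ∷ + 2 ∷ + 1 ∷ + 1 ∷ + 1 ∷ + 0 ∷ [])
  ∷ (+ 0 ∷ + 1 ∷ + 2 ∷ + 0 ∷ + 0 ∷ + 0 ∷ [])
  ∷ (+ 0 ∷ + 1 ∷ + 0 ∷ + 2 ∷ + 0 ∷ + 0 ∷ [])
  ∷ (+ 0 ∷ + 1 ∷ + 0 ∷ + 0 ∷ + 2 ∷ + 0 ∷ [])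
  ∷ (+ 1 ∷ + 0 ∷ + 0 ∷ + 0 ∷ + 0 ∷ + 2 ∷ []) ∷ [])

HE-doubled : ∀ x y → B J (lincomb doubled x) (lincomb doubled y) ≡ + 2 * B HE x y
HE-doubled x y = trans (B-lincomb₂ J doubled x y)
  (trans (B-congᴳ (subGram J doubled) x y (from-yes (≡Mat? (subGram J doubled) (λ i j → + 2 * HE i j))))
         (B-*ᴳ HE (+ 2) x y))

doubled-coords : Vect 6 → Vect 6
doubled-coords x = lookup (+ 2 * x 0F + x 5F ∷ x 1F ∷ x 1F + + 2 * x 2F ∷ x 1F + + 2 * x 3F ∷ x 1F + + 2 * x 4F ∷ x
    5F ∷ [])

lincomb-doubled : ∀ x i → lincomb doubled x i ≡ doubled-coords x i
lincomb-doubled x = λ where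
    0F → e₀ (x 0F) (x 1F) (x 2F) (x 3F) (x 4F) (x 5F)
    1F → e₁ (x 0F) (x 1F) (x 2F) (x 3F) (x 4F) (x 5F)
    2F → e₂ (x 0F) (x 1F) (x 2F) (x 3F) (x 4F) (x 5F)
    3F → e₃ (x 0F) (x 1F) (x 2F) (x 3F) (x 4F) (x 5F)
    4F → e₄ (x 0F) (x 1F) (x 2F) (x 3F) (x 4F) (x 5F)
    5F → e₅ (x 0F) (x 1F) (x 2F) (x 3F) (x 4F) (x 5F)
  where
  e₀ : ∀ a b c d e f → a * + 2 + (b * + 0 + (c * + 0 + (d * + 0 + (e * + 0 + (f * + 1 + + 0))))) ≡ + 2 * a + f
  e₀ = solve-∀
  e₁ : ∀ a b c d e f → a * + 0 + (b * + 1 + (c * + 0 + (d * + 0 + (e * + 0 + (f * + 0 + + 0))))) ≡ b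
  e₁ = solve-∀
  e₂ : ∀ a b c d e f → a * + 0 + (b * + 1 + (c * + 2 + (d * + 0 + (e * + 0 + (f * + 0 + + 0))))) ≡ b + + 2 * c
  e₂ = solve-∀
  e₃ : ∀ a b c d e f → a * + 0 + (b * + 1 + (c * + 0 + (d * + 2 + (e * + 0 + (f * + 0 + + 0))))) ≡ b + + 2 * d
  e₃ = solve-∀
  e₄ : ∀ a b c d e f → a * + 0 + (b * + 1 + (c * + 0 + (d * + 0 + (e * + 2 + (f * + 0 + + 0))))) ≡ b + + 2 * e
  e₄ = solve-∀
  e₅ : ∀ a b c d e f → a * + 0 + (b * + 0 + (c * + 0 + (d * + 0 + (e * + 0 + (f * + 1 + + 0))))) ≡ f
  e₅ = solve-∀

HE-norm : ∀ x → + J-norm (doubled-coords x) ≡ + 2 * B HE x x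
HE-norm x = trans (sym (J-norm-correct (doubled-coords x)))
  (trans (sym (B-cong J (lincomb-doubled x) (lincomb-doubled x))) (HE-doubled x x))

HE-even : ∀ x → ∃[ q ] B HE x x ≡ + 2 * q
HE-even x = q (x 0F) (x 1F) (x 2F) (x 3F) (x 4F) (x 5F) , *-cancelˡ (+ 2) (B HE x x) (+ 2 * q (x 0F) (x 1F) (x 2F) (x
    3F) (x 4F) (x 5F)) (λ ())
  (trans (sym (HE-norm x)) (trans (sym (J-norm-correct (doubled-coords x))) (trans (J-form (doubled-coords x)
      (doubled-coords x))
    (identity (x 0F) (x 1F) (x 2F) (x 3F) (x 4F) (x 5F)))))
  where
  q : (a b c d e f : ℤ) → ℤ
  q a b c d e f = a * a + a * f + f * f + b * b + b * c + b * d + b * e + c * c + d * d + e * e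
  identity : ∀ a b c d e f →
    (+ 2 * a + f) * (+ 2 * a + f) + (b * b + ((b + + 2 * c) * (b + + 2 * c) + ((b + + 2 * d) * (b + + 2 * d) + ((b +
        + 2 * e) * (b + + 2 * e) + + 3 * (f * f)))))
    ≡ + 2 * (+ 2 * (a * a + a * f + f * f + b * b + b * c + b * d + b * e + c * c + d * d + e * e))
  identity = solve-∀

HE-definite : ∀ x → B HE x x ≡ + 0 → ∀ i → x i ≡ + 0
HE-definite x e = coords
  where
  D = doubled-coords x
  D≡0 : ∀ i → D i ≡ + 0
  D≡0 = J-definite D (trans (J-norm-correct D) (trans (HE-norm x) (cong (+ 2 *_) e)))
  halve : ∀ {a b} → b ≡ + 0 → b + + 2 * a ≡ + 0 → a ≡ + 0
  halve {a} refl e = *-cancelˡ (+ 2) a (+ 0) (λ ()) (trans (sym (ℤ.+-identityˡ (+ 2 * a))) e)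
  coords : ∀ i → x i ≡ + 0
  coords 0F = halve (D≡0 5F) (trans (ℤ.+-comm (x 5F) _) (D≡0 0F))
  coords 1F = D≡0 1F
  coords 2F = halve (D≡0 1F) (D≡0 2F)
  coords 3F = halve (D≡0 1F) (D≡0 3F)
  coords 4F = halve (D≡0 1F) (D≡0 4F)
  coords 5F = D≡0 5F

a²+b²≤[a+b]² : ∀ a b → a ℕ.* a ℕ.+ b ℕ.* b ℕ.≤ (a ℕ.+ b) ℕ.* (a ℕ.+ b)
a²+b²≤[a+b]² a b = subst (a ℕ.* a ℕ.+ b ℕ.* b ℕ.≤_) (sym (expand a b)) (ℕ.m≤m+n _ _)
  where
  expand : ∀ a b → (a ℕ.+ b) ℕ.* (a ℕ.+ b) ≡ a ℕ.* a ℕ.+ b ℕ.* b ℕ.+ 2 ℕ.* (a ℕ.* b)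
  expand = solveℕ-∀

-- Let n be the residue of a modulo 2m. The distances from a to suitable even and odd multiples of m
-- are n and m - n, or 2m - n and n - m. In both cases they add up to m, so their squares add up to
-- at most m².
nearest : ∀ m → 0 < m → ∀ a → ∃[ t ] ∃[ t′ ]
  sq (a - + m * (+ 2 * t + + 0)) ℕ.+ sq (a - + m * (+ 2 * t′ + + 1)) ℕ.≤ m ℕ.* m
nearest m@(suc _) m>0 a = split (ℕ.≤-total n m)
  where
  M = 2 ℕ.* m
  n = a ℤ.%ℕ M
  t = a ℤ./ℕ M
  a≡ : a ≡ + n + t * (+ 2 * + m)
  a≡ = trans (ℤ.a≡a%ℕn+[a/ℕn]*n a M) (cong (λ u → + n + t * u) (ℤ.pos-* 2 m))
  bound : ∀ {x y} b c → x ≡ + b ⊎ x ≡ - + b → y ≡ + c ⊎ y ≡ - + c → b ℕ.+ c ≡ m → sq x ℕ.+ sq y ℕ.≤ m ℕ.* m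
  bound {x} {y} b c ex ey b+c≡m = subst₂ ℕ._≤_ (cong₂ ℕ._+_ (sq≡ ex) (sq≡ ey)) (cong (λ k → k ℕ.* k) b+c≡m)
      (a²+b²≤[a+b]² b c)
    where
    sq≡ : ∀ {x b} → x ≡ + b ⊎ x ≡ - + b → b ℕ.* b ≡ sq x
    sq≡ (inj₁ refl) = refl
    sq≡ {b = b} (inj₂ refl) = cong (λ k → k ℕ.* k) (sym (ℤ.∣-i∣≡∣i∣ (+ b)))
  split : n ℕ.≤ m ⊎ m ℕ.≤ n → _
  split (inj₁ n≤m) = t , t , bound n (m ℕ.∸ n)
      (inj₁ (trans (cong (_- + m * (+ 2 * t + + 0)) a≡) (cancel (+ n) t (+ m))))
      (inj₂ (trans (cong (_- + m * (+ 2 * t + + 1)) a≡) (trans (cancel′ (+ n) t (+ m)) (cong -_ (sym +m-n)))))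
      (ℕ.m+[n∸m]≡n n≤m)
    where
    +m-n : + (m ℕ.∸ n) ≡ + m - + n
    +m-n = trans (sym (ℤ.⊖-≥ n≤m)) (sym (ℤ.m-n≡m⊖n m n))
    cancel : ∀ n t m → n + t * (+ 2 * m) - m * (+ 2 * t + + 0) ≡ n
    cancel = solve-∀
    cancel′ : ∀ n t m → n + t * (+ 2 * m) - m * (+ 2 * t + + 1) ≡ - (m - n)
    cancel′ = solve-∀
  split (inj₂ m≤n) = t + + 1 , t , bound (M ℕ.∸ n) (n ℕ.∸ m)
      (inj₂ (trans (cong (_- + m * (+ 2 * (t + + 1) + + 0)) a≡) (trans (cancel (+ n) t (+ m)) (cong -_ (sym +M-n)))))
      (inj₁ (trans (cong (_- + m * (+ 2 * t + + 1)) a≡) (trans (cancel′ (+ n) t (+ m)) (sym +n-m))))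
      (ℕ.+-cancelʳ-≡ m _ _ (trans (ℕ.+-assoc (M ℕ.∸ n) (n ℕ.∸ m) m) (trans (cong (M ℕ.∸ n ℕ.+_) (ℕ.m∸n+n≡m m≤n))
        (trans (ℕ.m∸n+n≡m (ℕ.<⇒≤ n<M)) (cong (m ℕ.+_) (ℕ.+-identityʳ m))))))
    where
    n<M : n < M
    n<M = ℤ.n%ℕd<d a M
    +M-n : + (M ℕ.∸ n) ≡ + 2 * + m - + n
    +M-n = trans (sym (ℤ.⊖-≥ (ℕ.<⇒≤ n<M))) (trans (sym (ℤ.m-n≡m⊖n M n)) (cong (_- + n) (ℤ.pos-* 2 m)))
    +n-m : + (n ℕ.∸ m) ≡ + n - + m
    +n-m = trans (sym (ℤ.⊖-≥ m≤n)) (sym (ℤ.m-n≡m⊖n n m))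
    cancel : ∀ n t m → n + t * (+ 2 * m) - m * (+ 2 * (t + + 1) + + 0) ≡ - (+ 2 * m - n)
    cancel = solve-∀
    cancel′ : ∀ n t m → n + t * (+ 2 * m) - m * (+ 2 * t + + 1) ≡ n - m
    cancel′ = solve-∀

-- In doubled coordinates a Hurwitz quaternion has four even or four odd entries. By `nearest` the
-- squared distances to the two candidates add up to at most 4m², so one of them is at most 2m². The
-- Eisenstein part adds at most m² + 3m²/4. Since the doubled norm is 4q, this gives 16q ≤ 15m².
HE-approx : ∀ m → 0 < m → ∀ (w : Vect 6) → Σ (Vect 6) λ w′ → Σ (Vect 6) λ z → Σ ℕ λ q →
  (∀ (j : Fin 6) → w j ≡ w′ j + + m * z j) × B HE w′ w′ ≡ + 2 * + q × q < m ℕ.* m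
HE-approx m@(suc _) m>0 w =
  [ result (t₁ , t₂ , t₃ , t₄) (+ 0) , result (t₁′ , t₂′ , t₃′ , t₄′) (+ 1) ]′ choice
  where
  M = m ℕ.* m

  -- The coordinate of weight 3 is rounded first, to within m/2. Its parity then fixes that of the
  -- coordinate 0F, which is rounded only to within m.
  u : ℤ
  u = proj₁ (nearest m m>0 (+ 2 * w 5F))
  s : ℤ
  s = proj₁ (nearest m m>0 (+ 2 * w 0F + (w 5F - + m * u)))
  n₁ = nearest m m>0 (doubled-coords w 1F)
  n₂ = nearest m m>0 (doubled-coords w 2F)
  n₃ = nearest m m>0 (doubled-coords w 3F)
  n₄ = nearest m m>0 (doubled-coords w 4F)
  t₁ = proj₁ n₁
  t₂ = proj₁ n₂
  t₃ = proj₁ n₃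
  t₄ = proj₁ n₄
  t₁′ = proj₁ (proj₂ n₁)
  t₂′ = proj₁ (proj₂ n₂)
  t₃′ = proj₁ (proj₂ n₃)
  t₄′ = proj₁ (proj₂ n₄)

  r : ℤ → Fin 6 → ℤ → ℕ
  r ε i t = sq (doubled-coords w i - + m * (+ 2 * t + ε))

  hurwitz : ℤ × ℤ × ℤ × ℤ → ℤ → ℕ
  hurwitz (t₁ , t₂ , t₃ , t₄) ε = r ε 1F t₁ ℕ.+ (r ε 2F t₂ ℕ.+ (r ε 3F t₃ ℕ.+ r ε 4F t₄))

  choice : hurwitz (t₁ , t₂ , t₃ , t₄) (+ 0) ℕ.≤ 2 ℕ.* M ⊎ hurwitz (t₁′ , t₂′ , t₃′ , t₄′) (+ 1) ℕ.≤ 2 ℕ.* M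
  choice = oneOf (hurwitz (t₁ , t₂ , t₃ , t₄) (+ 0)) (hurwitz (t₁′ , t₂′ , t₃′ , t₄′) (+ 1)) (2 ℕ.* M)
      (interleave (r (+ 0) 1F t₁) (r (+ 0) 2F t₂) (r (+ 0) 3F t₃) (r (+ 0) 4F t₄)
        (r (+ 1) 1F t₁′) (r (+ 1) 2F t₂′) (r (+ 1) 3F t₃′) (r (+ 1) 4F t₄′)
        (proj₂ (proj₂ n₁)) (proj₂ (proj₂ n₂)) (proj₂ (proj₂ n₃)) (proj₂ (proj₂ n₄)))
    where
    interleave : ∀ a b c d a′ b′ c′ d′ → a ℕ.+ a′ ℕ.≤ M → b ℕ.+ b′ ℕ.≤ M → c ℕ.+ c′ ℕ.≤ M → d ℕ.+ d′ ℕ.≤ M →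
      (a ℕ.+ (b ℕ.+ (c ℕ.+ d))) ℕ.+ (a′ ℕ.+ (b′ ℕ.+ (c′ ℕ.+ d′))) ℕ.≤ 2 ℕ.* M ℕ.+ 2 ℕ.* M
    interleave a b c d a′ b′ c′ d′ p q r s =
      subst₂ ℕ._≤_ (shuffle a b c d a′ b′ c′ d′) (four M) (ℕ.+-mono-≤ (ℕ.+-mono-≤ p q) (ℕ.+-mono-≤ r s))
      where
      shuffle : ∀ a b c d a′ b′ c′ d′ → (a ℕ.+ a′ ℕ.+ (b ℕ.+ b′)) ℕ.+ ((c ℕ.+ c′) ℕ.+ (d ℕ.+ d′)) ≡
        (a ℕ.+ (b ℕ.+ (c ℕ.+ d))) ℕ.+ (a′ ℕ.+ (b′ ℕ.+ (c′ ℕ.+ d′)))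
      shuffle = solveℕ-∀
      four : ∀ M → M ℕ.+ M ℕ.+ (M ℕ.+ M) ≡ 2 ℕ.* M ℕ.+ 2 ℕ.* M
      four = solveℕ-∀
    oneOf : ∀ a b c → a ℕ.+ b ℕ.≤ c ℕ.+ c → a ℕ.≤ c ⊎ b ℕ.≤ c
    oneOf a b c le with a ℕ.≤? c
    ... | yes a≤c = inj₁ a≤c
    ... | no  a≰c = inj₂ (ℕ.≮⇒≥ λ c<b → ℕ.<⇒≱ (ℕ.+-mono-< (ℕ.≰⇒> a≰c) c<b) le)

  result : ∀ t ε → hurwitz t ε ℕ.≤ 2 ℕ.* M → Σ (Vect 6) λ w′ → Σ (Vect 6) λ z → Σ ℕ λ q →
    (∀ (j : Fin 6) → w j ≡ w′ j + + m * z j) × B HE w′ w′ ≡ + 2 * + q × q < M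
  result t@(τ₁ , τ₂ , τ₃ , τ₄) ε h = w′ , z , ∣ q ∣ , split , trans (proj₂ (HE-even w′)) (cong (+ 2 *_) q≡∣q∣) , q<M
    where
    -- Chosen so that `doubled-coords z` has the entries 2τᵢ + ε at 1F to 4F.
    z : Vect 6
    z = lookup (s ∷ + 2 * τ₁ + ε ∷ τ₂ - τ₁ ∷ τ₃ - τ₁ ∷ τ₄ - τ₁ ∷ u ∷ [])
    w′ : Vect 6
    w′ j = w j - + m * z j
    split : ∀ j → w j ≡ w′ j + + m * z j
    split j = cancel (w j) (+ m * z j)
      where
      cancel : ∀ a b → a ≡ a - b + b
      cancel = solve-∀
    q : ℤ
    q = proj₁ (HE-even w′)
    D = doubled-coords w′
    4q : + J-norm D ≡ + 2 * (+ 2 * q)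
    4q = trans (HE-norm w′) (cong (+ 2 *_) (proj₂ (HE-even w′)))
    4∣q∣ : J-norm D ≡ 2 ℕ.* (2 ℕ.* ∣ q ∣)
    4∣q∣ = trans (cong ∣_∣ 4q) (trans (ℤ.abs-* (+ 2) (+ 2 * q)) (cong (2 ℕ.*_) (ℤ.abs-* (+ 2) q)))
    q≡∣q∣ : q ≡ + ∣ q ∣
    q≡∣q∣ = *-cancelˡ (+ 2) q (+ ∣ q ∣) (λ ()) (*-cancelˡ (+ 2) (+ 2 * q) (+ 2 * + ∣ q ∣) (λ ()) (trans (sym 4q)
        (trans (cong +_ 4∣q∣)
      (trans (ℤ.pos-* 2 (2 ℕ.* ∣ q ∣)) (cong (+ 2 *_) (ℤ.pos-* 2 ∣ q ∣))))))
    c≤ : sq (D 0F) ℕ.≤ M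
    c≤ = ℕ.≤-trans (ℕ.≤-reflexive (cong sq (regroup (w 0F) (w 5F) (+ m) u s)))
      (ℕ.m+n≤o⇒m≤o _ (proj₂ (proj₂ (nearest m m>0 (+ 2 * w 0F + (w 5F - + m * u))))))
      where
      regroup : ∀ a f m u s → + 2 * (a - m * s) + (f - m * u) ≡ + 2 * a + (f - m * u) - m * (+ 2 * s + + 0)
      regroup = solve-∀
    e≤ : 4 ℕ.* sq (D 5F) ℕ.≤ M
    e≤ = ℕ.≤-trans (ℕ.≤-reflexive (trans (sq-double (D 5F)) (cong sq (regroup (w 5F) (+ m) u))))
      (ℕ.m+n≤o⇒m≤o _ (proj₂ (proj₂ (nearest m m>0 (+ 2 * w 5F)))))
      where
      sq-double : ∀ x → 4 ℕ.* sq x ≡ sq (+ 2 * x)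
      sq-double x = sym (trans (cong (λ k → k ℕ.* k) (ℤ.abs-* (+ 2) x)) (expand ∣ x ∣))
        where
        expand : ∀ n → 2 ℕ.* n ℕ.* (2 ℕ.* n) ≡ 4 ℕ.* (n ℕ.* n)
        expand = solveℕ-∀
      regroup : ∀ f m u → + 2 * (f - m * u) ≡ + 2 * f - m * (+ 2 * u + + 0)
      regroup = solve-∀
    h≤ : sq (D 1F) ℕ.+ (sq (D 2F) ℕ.+ (sq (D 3F) ℕ.+ sq (D 4F))) ℕ.≤ 2 ℕ.* M
    h≤ = ℕ.≤-trans (ℕ.≤-reflexive (cong (sq (D 1F) ℕ.+_) (cong₂ ℕ._+_ (cong sq (regroup (w 1F) (w 2F) (+ m) τ₁ τ₂ ε))
      (cong₂ ℕ._+_ (cong sq (regroup (w 1F) (w 3F) (+ m) τ₁ τ₃ ε)) (cong sq (regroup (w 1F) (w 4F) (+ m) τ₁ τ₄ ε)))))) h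
      where
      regroup : ∀ b c m τ₁ τ ε → b - m * (+ 2 * τ₁ + ε) + + 2 * (c - m * (τ - τ₁)) ≡ b + + 2 * c - m * (+ 2 * τ + ε)
      regroup = solve-∀
    q<M : ∣ q ∣ < M
    q<M = ℕ.*-cancelˡ-< 16 ∣ q ∣ M (ℕ.≤-<-trans 16q≤15M (15M<16M M (ℕ.s≤s ℕ.z≤n)))
      where
      15M<16M : ∀ M → 0 < M → 15 ℕ.* M < 16 ℕ.* M
      15M<16M M M>0 = ℕ.*-monoˡ-< M {{ℕ.>-nonZero M>0}} (ℕ.n<1+n 15)
      16q≤15M : 16 ℕ.* ∣ q ∣ ℕ.≤ 15 ℕ.* M
      16q≤15M = subst₂ ℕ._≤_
        (trans (regroup (sq (D 0F)) (sq (D 1F)) (sq (D 2F)) (sq (D 3F)) (sq (D 4F)) (sq (D 5F)))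
          (trans (cong (4 ℕ.*_) 4∣q∣) (sixteen ∣ q ∣)))
        (fifteen M)
        (ℕ.+-mono-≤ (ℕ.*-monoʳ-≤ 4 (ℕ.+-mono-≤ c≤ h≤)) (ℕ.*-monoʳ-≤ 3 e≤))
        where
        regroup : ∀ a b c d e f → 4 ℕ.* (a ℕ.+ (b ℕ.+ (c ℕ.+ (d ℕ.+ e)))) ℕ.+ 3 ℕ.* (4 ℕ.* f) ≡
          4 ℕ.* (a ℕ.+ (b ℕ.+ (c ℕ.+ (d ℕ.+ (e ℕ.+ 3 ℕ.* f)))))
        regroup = solveℕ-∀
        sixteen : ∀ q → 4 ℕ.* (2 ℕ.* (2 ℕ.* q)) ≡ 16 ℕ.* q
        sixteen = solveℕ-∀
        fifteen : ∀ M → 4 ℕ.* (M ℕ.+ 2 ℕ.* M) ℕ.+ 3 ℕ.* M ≡ 15 ℕ.* M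
        fifteen = solveℕ-∀

HE-covering : Covering HE
HE-covering = record
  { symmetric = from-yes (≡Mat? HE (λ i j → HE j i))
  ; even      = HE-even
  ; definite  = HE-definite
  ; approx    = HE-approx
  }

nonzero? : ∀ x → Dec (x ≢ + 0)
nonzero? x = ¬? (x ℤ.≟ + 0)

¬nonzero : ∀ {x} → ¬ (x ≢ + 0) → x ≡ + 0
¬nonzero {x} = decidable-stable (x ℤ.≟ + 0)

-- Parity

true≢false : true ≢ false
true≢false ()

Bool-≢ : ∀ {b} → b ≢ true → b ≡ false
Bool-≢ {false} _ = refl
Bool-≢ {true}  b = ⊥-elim (b refl)

bit : Bool → ℤ
bit false = + 0
bit true  = + 1

par : ℤ → Bool
par x with x ℤ.%ℕ 2
... | 0 = false
... | _ = true

par-spec : ∀ x → ∃[ q ] x ≡ + 2 * q + bit (par x)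
par-spec x with x ℤ.%ℕ 2 | ℤ.a≡a%ℕn+[a/ℕn]*n x 2 | ℤ.n%ℕd<d x 2
... | 0           | e | _ = x ℤ./ℕ 2 , trans e (swap (x ℤ./ℕ 2) (+ 0))
  where
  swap : ∀ q b → b + q * + 2 ≡ + 2 * q + b
  swap = solve-∀
... | 1           | e | _ = x ℤ./ℕ 2 , trans e (swap (x ℤ./ℕ 2) (+ 1))
  where
  swap : ∀ q b → b + q * + 2 ≡ + 2 * q + b
  swap = solve-∀
... | suc (suc _) | _ | ℕ.s≤s (ℕ.s≤s ())

2∤1 : ∀ q → + 2 * q ≢ + 1
2∤1 q e with ℕ.m*n≡1⇒m≡1 2 ∣ q ∣ (trans (sym (ℤ.abs-* (+ 2) q)) (cong ∣_∣ e))
... | ()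

bit-unique : ∀ b b′ q q′ → + 2 * q + bit b ≡ + 2 * q′ + bit b′ → b ≡ b′
bit-unique false false q q′ e = refl
bit-unique true  true  q q′ e = refl
bit-unique false true  q q′ e = ⊥-elim (2∤1 (q - q′) (trans (expand q q′) (trans (cong (λ t → t - + 2 * q′) e)
    (collect q′))))
  where
  expand : ∀ a b → + 2 * (a - b) ≡ + 2 * a + + 0 - + 2 * b
  expand = solve-∀
  collect : ∀ b → + 2 * b + + 1 - + 2 * b ≡ + 1
  collect = solve-∀
bit-unique true  false q q′ e = sym (bit-unique false true q′ q (sym e))

par-unique : ∀ {x} q b → x ≡ + 2 * q + bit b → par x ≡ b
par-unique {x} q b e = bit-unique (par x) b (proj₁ (par-spec x)) q (trans (sym (proj₂ (par-spec x))) e)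

even⇒par : ∀ {x} → + 2 ∣ x → par x ≡ false
even⇒par {x} (divides q e) = par-unique {x} q false (trans e (swap q))
  where
  swap : ∀ q → q * + 2 ≡ + 2 * q + + 0
  swap = solve-∀

par⇒even : ∀ {x} → par x ≡ false → + 2 ∣ x
par⇒even {x} e with par x | par-spec x | e
... | false | q , eq | refl = divides q (trans eq (swap q))
  where
  swap : ∀ q → + 2 * q + + 0 ≡ q * + 2
  swap = solve-∀

par-+ : ∀ x y → par (x + y) ≡ par x xor par y
par-+ x y = combine (par x) (par y) (par-spec x) (par-spec y)
  where
  add : ∀ a b → bit a + bit b ≡ + 2 * bit (a ∧ b) + bit (a xor b)
  add false false = refl
  add false true  = refl
  add true  false = refl
  add true  true  = refl
  regroup : ∀ q a r b → + 2 * q + a + (+ 2 * r + b) ≡ + 2 * (q + r) + (a + b)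
  regroup = solve-∀
  reassoc : ∀ s c b → + 2 * s + (+ 2 * c + b) ≡ + 2 * (s + c) + b
  reassoc = solve-∀
  combine : ∀ a b → (∃[ q ] x ≡ + 2 * q + bit a) → (∃[ r ] y ≡ + 2 * r + bit b) → par (x + y) ≡ a xor b
  combine a b (q , eq) (r , er) = par-unique (q + r + bit (a ∧ b)) (a xor b)
    (trans (cong₂ _+_ eq er) (trans (regroup q (bit a) r (bit b))
      (trans (+-congʳ (+ 2 * (q + r)) (add a b)) (reassoc (q + r) (bit (a ∧ b)) (bit (a xor b))))))

par-* : ∀ x y → par (x * y) ≡ par x ∧ par y
par-* x y = combine (par x) (par y) (par-spec x) (par-spec y)
  where
  mul : ∀ a b → bit a * bit b ≡ bit (a ∧ b)
  mul false b     = refl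
  mul true  false = refl
  mul true  true  = refl
  expand : ∀ q a r b → (+ 2 * q + a) * (+ 2 * r + b) ≡ + 2 * (+ 2 * q * r + q * b + a * r) + a * b
  expand = solve-∀
  combine : ∀ a b → (∃[ q ] x ≡ + 2 * q + bit a) → (∃[ r ] y ≡ + 2 * r + bit b) → par (x * y) ≡ a ∧ b
  combine a b (q , eq) (r , er) = par-unique (+ 2 * q * r + q * bit b + bit a * r) (a ∧ b)
    (trans (cong₂ _*_ eq er) (trans (expand q (bit a) r (bit b))
      (+-congʳ (+ 2 * (+ 2 * q * r + q * bit b + bit a * r)) (mul a b))))

par-neg : ∀ x → par (- x) ≡ par x
par-neg x = combine (par x) (par-spec x)
  where
  flip : ∀ q b → - (+ 2 * q + b) ≡ + 2 * (- q - b) + b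
  flip = solve-∀
  combine : ∀ a → (∃[ q ] x ≡ + 2 * q + bit a) → par (- x) ≡ a
  combine a (q , eq) = par-unique (- q - bit a) a (trans (cong -_ eq) (flip q (bit a)))

odd⇒ : ∀ {x} → par x ≡ true → ∃[ q ] x ≡ + 2 * q + + 1
odd⇒ {x} e with par x | par-spec x | e
... | true | q , eq | refl = q , eq

-- Frames

odd-cancel : ∀ {n} h → n ≡ + 2 * h + + 1 → ∀ {x} → n ∣ + 2 * x → n ∣ x
odd-cancel {n} h n-odd {x} (divides q e) = divides (x - h * q)
  (trans (expand h x) (trans (cong₂ (λ P t → P * x - h * t) (sym n-odd) e) (collect n x h q)))
  where
  expand : ∀ h x → x ≡ (+ 2 * h + + 1) * x - h * (+ 2 * x)
  expand = solve-∀
  collect : ∀ n x h q → n * x - h * (q * n) ≡ (x - h * q) * n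
  collect = solve-∀

odd-cancel-^ : ∀ {n} h → n ≡ + 2 * h + + 1 → ∀ e {x} → n ∣ + (2 ℕ.^ e) * x → n ∣ x
odd-cancel-^ {n} h n-odd zero    {x} d = subst (n ∣_) (ℤ.*-identityˡ x) d
odd-cancel-^ {n} h n-odd (suc e) {x} d = odd-cancel-^ h n-odd e (odd-cancel h n-odd (subst (n ∣_)
  (trans (cong (_* x) (ℤ.pos-* 2 (2 ℕ.^ e))) (ℤ.*-assoc (+ 2) (+ (2 ℕ.^ e)) x)) d))

module Similarities {n} (G : Mat n) where

  -- Twice an isometry: the factor 2 makes the half-integral rotations integral.
  Similarity : (Fin n → Vect n) → Set
  Similarity A = ∀ i j → subGram G A i j ≡ + 4 * G i j

  similarity? : ∀ A → Dec (Similarity A)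
  similarity? A = ≡Mat? (subGram G A) (λ i j → + 4 * G i j)

  B-similarity : ∀ {A} → Similarity A → ∀ x y → B G (lincomb A x) (lincomb A y) ≡ + 4 * B G x y
  B-similarity {A} sim x y = trans (B-lincomb₂ G A x y) (trans (B-congᴳ (subGram G A) x y sim) (B-*ᴳ G (+ 4) x y))

module Frames {n} (G : Mat n) (p : ℕ) (h : ℤ) (p-odd : + p ≡ + 2 * h + + 1) {k d} (v : Fin k → Vect d) (a : Vect d)
    where

  open Similarities G

  -- With s = p², f c is the image of p·e_c under an isometry of ℚ³ that is integral at the vectors v i.
  record Frame (s : ℤ) (f : Fin d → Vect n) : Set where
    field
      orth : ∀ c c′ → B G (f c) (f c′) ≡ s * δ c c′
      div  : ∀ i r → + p ∣ lincomb f (v i) r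
  open Frame public

  -- g is the image of a/p, up to a power of 2 and a vector orthogonal to the f c.
  Dual : (Fin d → Vect n) → Set
  Dual f = ∃[ g ] ∃[ e ] ∀ c → B G g (f c) ≡ + (2 ℕ.^ e) * a c

  scale : ∀ {s f f′} → (∀ c r → f c r ≡ + 2 * f′ c r) → Frame (+ 4 * s) f → Frame s f′
  scale {s} {f} {f′} eq F = record
    { orth = λ c c′ → *-cancelˡ (+ 4) (B G (f′ c) (f′ c′)) (s * δ c c′) (λ ()) (trans (sym (double c c′)) (trans
        (orth F c c′) (ℤ.*-assoc (+ 4) s _)))
    ; div  = λ i r → odd-cancel h p-odd (subst (+ p ∣_) (trans (sumF-cong d (λ c → trans (cong (v i c *_) (eq c r))
        (swap (v i c) (f′ c r)))) (sumF-*ˡ d (+ 2) _)) (div F i r))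
    }
    where
    swap : ∀ x y → x * (+ 2 * y) ≡ + 2 * (x * y)
    swap = solve-∀
    double : ∀ c c′ → B G (f c) (f c′) ≡ + 4 * B G (f′ c) (f′ c′)
    double c c′ = trans (B-cong G (eq c) (eq c′)) (trans (B-*ˡ G (+ 2) (f′ c) _) (trans (cong (+ 2 *_) (B-*ʳ G (+ 2)
        (f′ c′) (f′ c))) (sym (ℤ.*-assoc (+ 2) (+ 2) _))))

  -- Nothing says that g can be halved along with f, so g is doubled instead. This is how powers of
  -- 2 accumulate in `Dual`; they are harmless because only divisibility by p² is read off in the
  -- end.
  scale-dual : ∀ {f f′} → (∀ c r → f c r ≡ + 2 * f′ c r) → Dual f → Dual f′
  scale-dual {f} {f′} eq (g , e , g·f) = (λ r → + 2 * g r) , e , λ c →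
    trans (B-*ˡ G (+ 2) g (f′ c)) (trans (sym (B-*ʳ G (+ 2) (f′ c) g)) (trans (sym (B-congʳ G g (eq c))) (g·f c)))

  apply-frame : ∀ {A s f} → Similarity A → Frame s f → Frame (+ 4 * s) (λ c → lincomb A (f c))
  apply-frame {A} {s} {f} sim F = record
    { orth = λ c c′ → trans (B-similarity sim (f c) (f c′)) (trans (cong (+ 4 *_) (orth F c c′)) (sym (ℤ.*-assoc (+
        4) s _)))
    ; div  = λ i r → subst (+ p ∣_) (exchange i r) (∣-sumF n (λ t → ∣m⇒∣m*n (A t r) (div F i t)))
    }
    where
    exchange : ∀ i r → sumF n (λ t → lincomb f (v i) t * A t r) ≡ lincomb (λ c → lincomb A (f c)) (v i) r
    exchange i r = trans (sumF-cong n (λ t → sym (sumF-*ʳ d (A t r) _))) (trans (sumF-swap n d _)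
      (sumF-cong d (λ c → trans (sumF-cong n (λ t → ℤ.*-assoc (v i c) (f c t) (A t r))) (sumF-*ˡ n (v i c) _))))

  apply-dual : ∀ {A f} → Similarity A → Dual f → Dual (λ c → lincomb A (f c))
  apply-dual {A} {f} sim (g , e , g·f) = lincomb A g , 2 ℕ.+ e , λ c →
    trans (B-similarity sim g (f c)) (trans (cong (+ 4 *_) (g·f c)) (trans (sym (ℤ.*-assoc (+ 4) (+ (2 ℕ.^ e)) (a c)))
      (cong (_* a c) (trans (sym (ℤ.pos-* 4 (2 ℕ.^ e))) (cong +_ (ℕ.*-assoc 2 2 (2 ℕ.^ e)))))))

  Moved : ∀ A (f f′ : Fin d → Vect n) → Set
  Moved A f f′ = ∀ c r → lincomb A (f c) r ≡ + 2 * f′ c r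

  move : ∀ {A s f f′} → Similarity A → Moved A f f′ → Frame s f → Frame s f′
  move sim eq F = scale eq (apply-frame sim F)

  move-dual : ∀ {A f f′} → Similarity A → Moved A f f′ → Dual f → Dual f′
  move-dual sim eq D = scale-dual eq (apply-dual sim D)

  resign : ∀ {s f} (σ : Fin n → ℤ) → (∀ x y → B G (λ r → σ r * x r) (λ r → σ r * y r) ≡ B G x y) → Frame s f → Frame
      s (λ c r → σ r * f c r)
  resign {s} {f} σ inv F = record
    { orth = λ c c′ → trans (inv (f c) (f c′)) (orth F c c′)
    ; div  = λ i r → subst (+ p ∣_) (trans (sym (sumF-*ˡ d (σ r) _)) (sumF-cong d (λ c → swap (σ r) (v i c) (f c
        r)))) (∣n⇒∣m*n (σ r) (div F i r))
    }
    where
    swap : ∀ s v f → s * (v * f) ≡ v * (s * f)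
    swap = solve-∀

  resign-dual : ∀ {f} (σ : Fin n → ℤ) → (∀ x y → B G (λ r → σ r * x r) (λ r → σ r * y r) ≡ B G x y) → Dual f → Dual
      (λ c r → σ r * f c r)
  resign-dual {f} σ inv (g , e , g·f) = (λ r → σ r * g r) , e , λ c → trans (inv g (f c)) (g·f c)

B-resign : ∀ (σ : Fin 6 → ℤ) → (∀ r → σ r * σ r ≡ + 1) → ∀ x y →
  B J (λ r → σ r * x r) (λ r → σ r * y r) ≡ B J x y
B-resign σ σ² x y = trans (J-form (λ r → σ r * x r) (λ r → σ r * y r)) (trans
  (cong₂ _+_ (c 0F) (cong₂ _+_ (c 1F) (cong₂ _+_ (c 2F) (cong₂ _+_ (c 3F) (cong₂ _+_ (c 4F) (cong (+ 3 *_) (c 5F)))))))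
  (sym (J-form x y)))
  where
  c : ∀ r → σ r * x r * (σ r * y r) ≡ x r * y r
  c r = trans (regroup (σ r) (x r) (y r)) (trans (cong (_* (x r * y r)) (σ² r)) (ℤ.*-identityˡ _))
    where
    regroup : ∀ s x y → s * x * (s * y) ≡ s * s * (x * y)
    regroup = solve-∀

-- Doubled rotations: permutations, a Hadamard matrix, a sixth root of unity

permute : ∀ {n} → (Fin n → Fin n) → Fin n → Vect n
permute π i r = + 2 * δ (π r) i

apply-permute : ∀ {n} π (x : Vect n) r → lincomb (permute π) x r ≡ + 2 * x (π r)
apply-permute {n} π x r = trans (sumF-cong n (λ i → swap (x i) (δ (π r) i)))
  (trans (sumF-*ˡ n (+ 2) _) (cong (+ 2 *_) (sumF-δ n (π r) x)))
  where
  swap : ∀ x d → x * (+ 2 * d) ≡ + 2 * (d * x)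
  swap = solve-∀

-- Half of this matrix acts on the Hurwitz quaternions as an isometry that maps ½(1 + i + j + k) to
-- 1.
hadamard : Fin 6 → Vect 6
hadamard = rows
  ( (+ 2 ∷ + 0 ∷ + 0 ∷ + 0 ∷ + 0 ∷ + 0 ∷ [])
  ∷ (+ 0 ∷ + 1 ∷ + 1 ∷ + 1 ∷ + 1 ∷ + 0 ∷ [])
  ∷ (+ 0 ∷ + 1 ∷ + 1 ∷ -[1+ 0 ] ∷ -[1+ 0 ] ∷ + 0 ∷ [])
  ∷ (+ 0 ∷ + 1 ∷ -[1+ 0 ] ∷ + 1 ∷ -[1+ 0 ] ∷ + 0 ∷ [])
  ∷ (+ 0 ∷ + 1 ∷ -[1+ 0 ] ∷ -[1+ 0 ] ∷ + 1 ∷ + 0 ∷ [])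
  ∷ (+ 0 ∷ + 0 ∷ + 0 ∷ + 0 ∷ + 0 ∷ + 2 ∷ []) ∷ [])

-- Twice the product of x₀ - x₅√-3 with the sixth root of unity ½(1 + √-3).
hexagonal : Fin 6 → Vect 6
hexagonal = rows
  ( (+ 1 ∷ + 0 ∷ + 0 ∷ + 0 ∷ + 0 ∷ + 1 ∷ [])
  ∷ (+ 0 ∷ + 2 ∷ + 0 ∷ + 0 ∷ + 0 ∷ + 0 ∷ [])
  ∷ (+ 0 ∷ + 0 ∷ + 2 ∷ + 0 ∷ + 0 ∷ + 0 ∷ [])
  ∷ (+ 0 ∷ + 0 ∷ + 0 ∷ + 2 ∷ + 0 ∷ + 0 ∷ [])
  ∷ (+ 0 ∷ + 0 ∷ + 0 ∷ + 0 ∷ + 2 ∷ + 0 ∷ [])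
  ∷ (+ 3 ∷ + 0 ∷ + 0 ∷ + 0 ∷ + 0 ∷ -[1+ 0 ] ∷ []) ∷ [])

open Similarities J

hadamard-similarity : Similarity hadamard
hadamard-similarity = from-yes (similarity? hadamard)

hexagonal-similarity : Similarity hexagonal
hexagonal-similarity = from-yes (similarity? hexagonal)

apply-hadamard : ∀ x r → lincomb hadamard x r ≡ lookup
  ( + 2 * x 0F ∷ x 1F + x 2F + x 3F + x 4F ∷ x 1F + x 2F - x 3F - x 4F
  ∷ x 1F - x 2F + x 3F - x 4F ∷ x 1F - x 2F - x 3F + x 4F ∷ + 2 * x 5F ∷ []) r
apply-hadamard x = λ where
    0F → e₀ (x 0F) (x 1F) (x 2F) (x 3F) (x 4F) (x 5F)
    1F → e₁ (x 0F) (x 1F) (x 2F) (x 3F) (x 4F) (x 5F)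
    2F → e₂ (x 0F) (x 1F) (x 2F) (x 3F) (x 4F) (x 5F)
    3F → e₃ (x 0F) (x 1F) (x 2F) (x 3F) (x 4F) (x 5F)
    4F → e₄ (x 0F) (x 1F) (x 2F) (x 3F) (x 4F) (x 5F)
    5F → e₅ (x 0F) (x 1F) (x 2F) (x 3F) (x 4F) (x 5F)
  where
  e₀ : ∀ a b c d e f → a * + 2 + (b * + 0 + (c * + 0 + (d * + 0 + (e * + 0 + (f * + 0 + + 0))))) ≡ + 2 * a
  e₀ = solve-∀
  e₁ : ∀ a b c d e f → a * + 0 + (b * + 1 + (c * + 1 + (d * + 1 + (e * + 1 + (f * + 0 + + 0))))) ≡ b + c + d + e
  e₁ = solve-∀
  e₂ : ∀ a b c d e f → a * + 0 + (b * + 1 + (c * + 1 + (d * -[1+ 0 ] + (e * -[1+ 0 ] + (f * + 0 + + 0))))) ≡ b + c -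
      d - e
  e₂ = solve-∀
  e₃ : ∀ a b c d e f → a * + 0 + (b * + 1 + (c * -[1+ 0 ] + (d * + 1 + (e * -[1+ 0 ] + (f * + 0 + + 0))))) ≡ b - c +
      d - e
  e₃ = solve-∀
  e₄ : ∀ a b c d e f → a * + 0 + (b * + 1 + (c * -[1+ 0 ] + (d * -[1+ 0 ] + (e * + 1 + (f * + 0 + + 0))))) ≡ b - c -
      d + e
  e₄ = solve-∀
  e₅ : ∀ a b c d e f → a * + 0 + (b * + 0 + (c * + 0 + (d * + 0 + (e * + 0 + (f * + 2 + + 0))))) ≡ + 2 * f
  e₅ = solve-∀

total : Vect 6 → ℤ
total x = x 1F + x 2F + x 3F + x 4F

halved : Vect 6 → ℤ → Vect 6
halved x k = lookup (x 0F ∷ + 2 * k ∷ + 2 * k - x 3F - x 4F ∷ + 2 * k - x 2F - x 4F ∷ + 2 * k - x 2F - x 3F ∷ x 5F ∷ [])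

hadamard-halved : ∀ x k → total x ≡ k * + 4 → ∀ r → lincomb hadamard x r ≡ + 2 * halved x k r
hadamard-halved x k e = λ where
    0F → apply-hadamard x 0F
    1F → trans (apply-hadamard x 1F) (trans e (double k))
    2F → trans (apply-hadamard x 2F) (trans (e₂ (x 1F) (x 2F) (x 3F) (x 4F)) (half (x 3F) (x 4F)))
    3F → trans (apply-hadamard x 3F) (trans (e₃ (x 1F) (x 2F) (x 3F) (x 4F)) (half (x 2F) (x 4F)))
    4F → trans (apply-hadamard x 4F) (trans (e₄ (x 1F) (x 2F) (x 3F) (x 4F)) (half (x 2F) (x 3F)))
    5F → apply-hadamard x 5F
  where
  double : ∀ k → k * + 4 ≡ + 2 * (+ 2 * k)
  double = solve-∀
  e₂ : ∀ a b c d → a + b - c - d ≡ a + b + c + d - + 2 * (c + d)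
  e₂ = solve-∀
  e₃ : ∀ a b c d → a - b + c - d ≡ a + b + c + d - + 2 * (b + d)
  e₃ = solve-∀
  e₄ : ∀ a b c d → a - b - c + d ≡ a + b + c + d - + 2 * (b + c)
  e₄ = solve-∀
  half : ∀ s t → total x - + 2 * (s + t) ≡ + 2 * (+ 2 * k - s - t)
  half s t = trans (cong (λ z → z - + 2 * (s + t)) e) (expand k s t)
    where
    expand : ∀ k s t → k * + 4 - + 2 * (s + t) ≡ + 2 * (+ 2 * k - s - t)
    expand = solve-∀

apply-hexagonal : ∀ x r → lincomb hexagonal x r ≡ lookup
  (x 0F + + 3 * x 5F ∷ + 2 * x 1F ∷ + 2 * x 2F ∷ + 2 * x 3F ∷ + 2 * x 4F ∷ x 0F - x 5F ∷ []) r
apply-hexagonal x = λ where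
    0F → e₀ (x 0F) (x 1F) (x 2F) (x 3F) (x 4F) (x 5F)
    1F → e₁ (x 0F) (x 1F) (x 2F) (x 3F) (x 4F) (x 5F)
    2F → e₂ (x 0F) (x 1F) (x 2F) (x 3F) (x 4F) (x 5F)
    3F → e₃ (x 0F) (x 1F) (x 2F) (x 3F) (x 4F) (x 5F)
    4F → e₄ (x 0F) (x 1F) (x 2F) (x 3F) (x 4F) (x 5F)
    5F → e₅ (x 0F) (x 1F) (x 2F) (x 3F) (x 4F) (x 5F)
  where
  e₀ : ∀ a b c d e f → a * + 1 + (b * + 0 + (c * + 0 + (d * + 0 + (e * + 0 + (f * + 3 + + 0))))) ≡ a + + 3 * f
  e₀ = solve-∀
  e₁ : ∀ a b c d e f → a * + 0 + (b * + 2 + (c * + 0 + (d * + 0 + (e * + 0 + (f * + 0 + + 0))))) ≡ + 2 * b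
  e₁ = solve-∀
  e₂ : ∀ a b c d e f → a * + 0 + (b * + 0 + (c * + 2 + (d * + 0 + (e * + 0 + (f * + 0 + + 0))))) ≡ + 2 * c
  e₂ = solve-∀
  e₃ : ∀ a b c d e f → a * + 0 + (b * + 0 + (c * + 0 + (d * + 2 + (e * + 0 + (f * + 0 + + 0))))) ≡ + 2 * d
  e₃ = solve-∀
  e₄ : ∀ a b c d e f → a * + 0 + (b * + 0 + (c * + 0 + (d * + 0 + (e * + 2 + (f * + 0 + + 0))))) ≡ + 2 * e
  e₄ = solve-∀
  e₅ : ∀ a b c d e f → a * + 1 + (b * + 0 + (c * + 0 + (d * + 0 + (e * + 0 + (f * -[1+ 0 ] + + 0))))) ≡ a - f
  e₅ = solve-∀

-- From the Hurwitz-Eisenstein lattice back to integral coordinates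

record InHE (x : Vect 6) : Set where
  field
    e s₂ s₃ s₄ : ℤ
    x₀≡ : x 0F ≡ x 5F + + 2 * e
    x₂≡ : x 2F ≡ x 1F + + 2 * s₂
    x₃≡ : x 3F ≡ x 1F + + 2 * s₃
    x₄≡ : x 4F ≡ x 1F + + 2 * s₄

-- The Hurwitz component is integral; the Eisenstein component may still be half-integral.
record HalfEven (x : Vect 6) : Set where
  field
    e k₁ k₂ k₃ k₄ : ℤ
    x₀≡ : x 0F ≡ x 5F + + 2 * e
    x₁≡ : x 1F ≡ + 2 * k₁
    x₂≡ : x 2F ≡ + 2 * k₂
    x₃≡ : x 3F ≡ + 2 * k₃
    x₄≡ : x 4F ≡ + 2 * k₄

doubled-InHE : ∀ u → InHE (doubled-coords u)
doubled-InHE u = record { e = u 0F ; s₂ = u 2F ; s₃ = u 3F ; s₄ = u 4F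
                        ; x₀≡ = ℤ.+-comm (+ 2 * u 0F) (u 5F) ; x₂≡ = refl ; x₃≡ = refl ; x₄≡ = refl }

-- For an odd first coordinate, an odd norm forces the Eisenstein component into 2ℤ[ω].
odd-hurwitz : ∀ x₁ s₂ s₃ s₄ x₅ e y → par x₁ ≡ true →
  (x₅ + + 2 * e) * (x₅ + + 2 * e) + (x₁ * x₁ + ((x₁ + + 2 * s₂) * (x₁ + + 2 * s₂) + ((x₁ + + 2 * s₃) * (x₁ + + 2 * s₃) +
    ((x₁ + + 2 * s₄) * (x₁ + + 2 * s₄) + + 3 * (x₅ * x₅))))) ≡ + 4 * (+ 2 * y + + 1) →
  par x₅ ≡ false × par e ≡ false
odd-hurwitz x₁ s₂ s₃ s₄ x₅ e y odd norm with odd⇒ {x₁} odd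
... | t , refl = decide (par x₅) (par e) (trans (sym parity) (even⇒par evenForm))
  where
  u : ℤ → ℤ
  u s = (t + s) * (t + s + + 1)
  u-even : ∀ s → + 2 ∣ u s
  u-even s = par⇒even (trans (par-* (t + s) (t + s + + 1)) (trans (cong (par (t + s) ∧_) (par-+ (t + s) (+ 1))) (a∧¬a
      (par (t + s)))))
    where
    a∧¬a : ∀ a → a ∧ (a xor true) ≡ false
    a∧¬a false = refl
    a∧¬a true  = refl
  form : ℤ
  form = x₅ * x₅ + x₅ * e + e * e
  identity : ∀ t s₂ s₃ s₄ x₅ e →
    (x₅ + + 2 * e) * (x₅ + + 2 * e) + ((+ 2 * t + + 1) * (+ 2 * t + + 1) + ((+ 2 * t + + 1 + + 2 * s₂) * (+ 2 * t + +
        1 + + 2 * s₂) +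
      ((+ 2 * t + + 1 + + 2 * s₃) * (+ 2 * t + + 1 + + 2 * s₃) + ((+ 2 * t + + 1 + + 2 * s₄) * (+ 2 * t + + 1 + + 2 *
          s₄) + + 3 * (x₅ * x₅))))) ≡
    + 4 * ((x₅ * x₅ + x₅ * e + e * e) + ((t + + 0) * (t + + 0 + + 1) + (t + s₂) * (t + s₂ + + 1) + (t + s₃) * (t + s₃
        + + 1) + (t + s₄) * (t + s₄ + + 1)) + + 1)
  identity = solve-∀
  U : ℤ
  U = u (+ 0) + u s₂ + u s₃ + u s₄
  reduced : form + U + + 1 ≡ + 2 * y + + 1
  reduced = *-cancelˡ (+ 4) (form + U + + 1) (+ 2 * y + + 1) (λ ()) (trans (sym (identity t s₂ s₃ s₄ x₅ e)) norm)
  evenForm : + 2 ∣ form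
  evenForm = subst (+ 2 ∣_) (sym (trans (isolate form U) (trans (cong (λ z → z - U - + 1) reduced) (collect y U))))
    (∣m∣n⇒∣m-n (∣m⇒∣m*n y ∣-refl) (∣m∣n⇒∣m+n (∣m∣n⇒∣m+n (∣m∣n⇒∣m+n (u-even (+ 0)) (u-even s₂)) (u-even s₃)) (u-even
        s₄)))
    where
    isolate : ∀ f U → f ≡ f + U + + 1 - U - + 1
    isolate = solve-∀
    collect : ∀ y U → + 2 * y + + 1 - U - + 1 ≡ + 2 * y - U
    collect = solve-∀
  parity : par form ≡ ((par x₅ ∧ par x₅) xor (par x₅ ∧ par e)) xor (par e ∧ par e)
  parity = trans (par-+ (x₅ * x₅ + x₅ * e) (e * e)) (cong₂ _xor_ (trans (par-+ (x₅ * x₅) (x₅ * e))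
    (cong₂ _xor_ (par-* x₅ x₅) (par-* x₅ e))) (par-* e e))
  decide : ∀ a b → ((a ∧ a) xor (a ∧ b)) xor (b ∧ b) ≡ false → a ≡ false × b ≡ false
  decide false false _ = refl , refl
  decide false true  ()
  decide true  false ()
  decide true  true  ()

-- Write xᵢ = 1 + 2uᵢ: then Σ uᵢ is even, so Σ xᵢzᵢ ≡ Σ zᵢ modulo 4.
transfer : ∀ x₁ s₂ s₃ s₄ z₁ s₂′ s₃′ s₄′ → par x₁ ≡ true →
  + 4 ∣ x₁ + (x₁ + + 2 * s₂) + (x₁ + + 2 * s₃) + (x₁ + + 2 * s₄) →
  + 4 ∣ x₁ * z₁ + ((x₁ + + 2 * s₂) * (z₁ + + 2 * s₂′) + ((x₁ + + 2 * s₃) * (z₁ + + 2 * s₃′) + (x₁ + + 2 * s₄) * (z₁ +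
      + 2 * s₄′))) →
  + 4 ∣ z₁ + (z₁ + + 2 * s₂′) + (z₁ + + 2 * s₃′) + (z₁ + + 2 * s₄′)
transfer x₁ s₂ s₃ s₄ z₁ s₂′ s₃′ s₄′ odd (divides k sum≡) 4∣xz with odd⇒ {x₁} odd
... | t , refl = subst (+ 4 ∣_) (trans (cong (λ S → pairing - z₁ * S + + 4 * corr) (sym sum≡)) (identity t s₂ s₃ s₄
    z₁ s₂′ s₃′ s₄′))
    (∣m∣n⇒∣m+n (∣m∣n⇒∣m-n 4∣xz (∣n⇒∣m*n z₁ (∣n⇒∣m*n k ∣-refl))) (∣m⇒∣m*n corr ∣-refl))
  where
  x = + 2 * t + + 1
  pairing = x * z₁ + ((x + + 2 * s₂) * (z₁ + + 2 * s₂′) + ((x + + 2 * s₃) * (z₁ + + 2 * s₃′) + (x + + 2 * s₄) * (z₁ +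
      + 2 * s₄′)))
  corr = z₁ - (t + s₂) * s₂′ - (t + s₃) * s₃′ - (t + s₄) * s₄′
  identity : ∀ t s₂ s₃ s₄ z₁ s₂′ s₃′ s₄′ →
    (+ 2 * t + + 1) * z₁ + ((+ 2 * t + + 1 + + 2 * s₂) * (z₁ + + 2 * s₂′) + ((+ 2 * t + + 1 + + 2 * s₃) * (z₁ + + 2 *
        s₃′) + (+ 2 * t + + 1 + + 2 * s₄) * (z₁ + + 2 * s₄′)))
      - z₁ * (+ 2 * t + + 1 + (+ 2 * t + + 1 + + 2 * s₂) + (+ 2 * t + + 1 + + 2 * s₃) + (+ 2 * t + + 1 + + 2 * s₄))
      + + 4 * (z₁ - (t + s₂) * s₂′ - (t + s₃) * s₃′ - (t + s₄) * s₄′) ≡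
    z₁ + (z₁ + + 2 * s₂′) + (z₁ + + 2 * s₃′) + (z₁ + + 2 * s₄′)
  identity = solve-∀

module Rotations (p : ℕ) (h : ℤ) (p-odd : + p ≡ + 2 * h + + 1) {k} (v : Fin k → Vect 3) (a : Vect 3) where

  open Frames J p h p-odd v a public
  open Similarities J public

  -- The norm of the image of p·eᵢ in doubled coordinates.
  S : ℤ
  S = + 4 * (+ p * + p)

  S≡ : S ≡ + 4 * (+ 2 * (+ 2 * (h * h + h)) + + 1)
  S≡ = trans (cong (λ P → + 4 * (P * P)) p-odd) (square h)
    where
    square : ∀ h → + 4 * ((+ 2 * h + + 1) * (+ 2 * h + + 1)) ≡ + 4 * (+ 2 * (+ 2 * (h * h + h)) + + 1)
    square = solve-∀

  4∣S* : ∀ {d} → + 4 ∣ S * d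
  4∣S* {d} = ∣m⇒∣m*n d (∣m⇒∣m*n (+ p * + p) ∣-refl)

  Data : ℤ → (Fin 3 → Vect 6) → Set
  Data s f = Frame s f × Dual f

  private
    pairing : Vect 6 → Vect 6 → ℤ
    pairing x z = x 1F * z 1F + (x 2F * z 2F + (x 3F * z 3F + x 4F * z 4F))

    J-split : ∀ x z → B J x z ≡ pairing x z + (x 0F * z 0F + + 3 * (x 5F * z 5F))
    J-split x z = trans (J-form x z) (regroup (x 0F * z 0F) (x 1F * z 1F) (x 2F * z 2F) (x 3F * z 3F) (x 4F * z 4F)
        (x 5F * z 5F))
      where
      regroup : ∀ a b c d e f → a + (b + (c + (d + (e + + 3 * f)))) ≡ b + (c + (d + e)) + (a + + 3 * f)
      regroup = solve-∀

  -- By `odd-hurwitz`, `x 5F` and `e` are even for the vector x = `f c`, so the Eisenstein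
  -- components contribute a multiple of 4 to its product with any `f d`. The whole product is a
  -- multiple of `S`, so the Hurwitz components pair to 0 modulo 4, and `transfer` carries the
  -- divisibility of the total from c to d. One rotation then makes all Hurwitz components integral.
  hadamard-even : ∀ {f} → Data S f → (∀ c → InHE (f c)) → ∀ c → par (f c 1F) ≡ true → + 4 ∣ total (f c) →
    ∃[ f′ ] Data S f′ × (∀ c → HalfEven (f′ c))
  hadamard-even {f} (F , D) he c odd 4∣total =
    f′ , (move {hadamard} {S} {f} {f′} hadamard-similarity moved F , move-dual {hadamard} {f} {f′}
        hadamard-similarity moved D) , halfEven
    where
    open InHE
    x = f c
    hx = he c
    norm : (x 5F + + 2 * e hx) * (x 5F + + 2 * e hx) + (x 1F * x 1F + ((x 1F + + 2 * s₂ hx) * (x 1F + + 2 * s₂ hx) +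
      ((x 1F + + 2 * s₃ hx) * (x 1F + + 2 * s₃ hx) + ((x 1F + + 2 * s₄ hx) * (x 1F + + 2 * s₄ hx) + + 3 * (x 5F * x
          5F))))) ≡
      + 4 * (+ 2 * (+ 2 * (h * h + h)) + + 1)
    norm = trans (sym (cong₂ _+_ (square (x₀≡ hx)) (+-congʳ (x 1F * x 1F) (cong₂ _+_ (square (x₂≡ hx))
        (cong₂ _+_ (square (x₃≡ hx)) (cong (λ z → z + + 3 * (x 5F * x 5F)) (square (x₄≡ hx))))))))
      (trans (sym (J-form x x)) (trans (orth F c c) (trans (cong (S *_) (δ-refl c)) (trans (ℤ.*-identityʳ S) S≡))))
      where
      square : ∀ {a b} → a ≡ b → a * a ≡ b * b
      square refl = refl
      δ-refl : ∀ (c : Fin 3) → δ c c ≡ + 1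
      δ-refl 0F = refl
      δ-refl 1F = refl
      δ-refl 2F = refl
    evens = odd-hurwitz (x 1F) (s₂ hx) (s₃ hx) (s₄ hx) (x 5F) (e hx) (+ 2 * (h * h + h)) odd norm
    4∣total′ : ∀ d → + 4 ∣ total (f d)
    4∣total′ d = subst (+ 4 ∣_) (sum≡ z hz)
      (transfer (x 1F) (s₂ hx) (s₃ hx) (s₄ hx) (z 1F) (s₂ hz) (s₃ hz) (s₄ hz) odd (subst (+ 4 ∣_) (sym (sum≡ x hx))
          4∣total) 4∣xz)
      where
      z = f d
      hz = he d
      sum≡ : ∀ x (hx : InHE x) → x 1F + (x 1F + + 2 * s₂ hx) + (x 1F + + 2 * s₃ hx) + (x 1F + + 2 * s₄ hx) ≡ total x
      sum≡ x hx = sym (cong₂ _+_ (cong₂ _+_ (+-congʳ (x 1F) (x₂≡ hx)) (x₃≡ hx)) (x₄≡ hx))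
      eisenstein : + 4 ∣ x 0F * z 0F + + 3 * (x 5F * z 5F)
      eisenstein = combine (par⇒even {x 5F} (proj₁ evens)) (par⇒even {e hx} (proj₂ evens))
        where
        combine : + 2 ∣ x 5F → + 2 ∣ e hx → + 4 ∣ x 0F * z 0F + + 3 * (x 5F * z 5F)
        combine (divides κ x₅≡) (divides ε e≡) = divides (+ 2 * (κ * z 5F) + κ * e hz + ε * (z 5F + + 2 * e hz))
            (trans (cong₂ (λ a b → a + + 3 * b) (cong₂ _*_ (trans (x₀≡ hx) (cong₂ (λ a b → a + + 2 * b) x₅≡ e≡)) (x₀≡
                hz)) (cong (_* z 5F) x₅≡))
              (identity κ ε (z 5F) (e hz)))
          where
          identity : ∀ κ ε z₅ e → (κ * + 2 + + 2 * (ε * + 2)) * (z₅ + + 2 * e) + + 3 * (κ * + 2 * z₅) ≡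
            (+ 2 * (κ * z₅) + κ * e + ε * (z₅ + + 2 * e)) * + 4
          identity = solve-∀
      4∣xz : + 4 ∣ x 1F * z 1F + ((x 1F + + 2 * s₂ hx) * (z 1F + + 2 * s₂ hz) + ((x 1F + + 2 * s₃ hx) * (z 1F + + 2 *
          s₃ hz) + (x 1F + + 2 * s₄ hx) * (z 1F + + 2 * s₄ hz)))
      4∣xz = subst (+ 4 ∣_) (+-congʳ (x 1F * z 1F) (cong₂ _+_ (cong₂ _*_ (x₂≡ hx) (x₂≡ hz)) (cong₂ _+_ (cong₂ _*_
          (x₃≡ hx) (x₃≡ hz)) (cong₂ _*_ (x₄≡ hx) (x₄≡ hz)))))
        (∣m+n∣n⇒∣m {+ 4} {pairing x z} {x 0F * z 0F + + 3 * (x 5F * z 5F)} (subst (+ 4 ∣_) (trans (sym (orth F c d))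
            (J-split x z)) (4∣S* {δ c d})) eisenstein)
    κ : Fin 3 → ℤ
    κ d = quotient (4∣total′ d)
    f′ : Fin 3 → Vect 6
    f′ d = halved (f d) (κ d)
    moved : Moved hadamard f f′
    moved d = hadamard-halved (f d) (κ d) (_∣_.equality (4∣total′ d))
    halfEven : ∀ d → HalfEven (f′ d)
    halfEven d = record { e = e (he d) ; k₁ = κ d ; k₂ = _ ; k₃ = _ ; k₄ = _ ; x₀≡ = x₀≡ (he d) ; x₁≡ = refl
      ; x₂≡ = even (x₃≡ (he d)) (x₄≡ (he d)) ; x₃≡ = even (x₂≡ (he d)) (x₄≡ (he d)) ; x₄≡ = even (x₂≡ (he d)) (x₃≡
          (he d)) }
      where
      even : ∀ {y z s t} → y ≡ f d 1F + + 2 * s → z ≡ f d 1F + + 2 * t → + 2 * κ d - y - z ≡ + 2 * (κ d - f d 1F - s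
          - t)
      even {s = s} {t} refl refl = factor (κ d) (f d 1F) s t
        where
        factor : ∀ k x s t → + 2 * k - (x + + 2 * s) - (x + + 2 * t) ≡ + 2 * (k - x - s - t)
        factor = solve-∀

module Normalise (p : ℕ) (h : ℤ) (p-odd : + p ≡ + 2 * h + + 1) {k} (v : Fin k → Vect 3) (a : Vect 3) where

  open Rotations p h p-odd v a public

  signs : Vec ℤ 6 → (Fin 3 → Vect 6) → Fin 3 → Vect 6
  signs σ f c r = lookup σ r * f c r

  resign-data : ∀ {s f} (σ : Vec ℤ 6) → (∀ r → lookup σ r * lookup σ r ≡ + 1) → Data s f → Data s (signs σ f)
  resign-data {s} {f} σ σ² (F , D) =
    resign {s} {f} (lookup σ) (B-resign (lookup σ) σ²) F , resign-dual {f} (lookup σ) (B-resign (lookup σ) σ²) D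

  -- If all Hurwitz entries are even, nothing has to be done. Otherwise the total of an odd vector
  -- is even, and reversing the sign of its odd entry 4F changes it by 2 modulo 4.
  hadamard-stage : ∀ {f} → Data S f → (∀ c → InHE (f c)) → ∃[ f′ ] Data S f′ × (∀ c → HalfEven (f′ c))
  hadamard-stage {f} data₀ he = choose (Fin.any? (λ c → par (f c 1F) Bool.≟ true))
    where
    open InHE
    σ : Vec ℤ 6
    σ = + 1 ∷ + 1 ∷ + 1 ∷ + 1 ∷ ℤ.-1ℤ ∷ + 1 ∷ []
    flipped : ∀ c → InHE (signs σ f c)
    flipped c = record { e = e (he c) ; s₂ = s₂ (he c) ; s₃ = s₃ (he c) ; s₄ = - f c 1F - s₄ (he c)
      ; x₀≡ = same (f c 0F) (f c 5F) (e (he c)) (x₀≡ (he c)) ; x₂≡ = same (f c 2F) (f c 1F) (s₂ (he c)) (x₂≡ (he c))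
      ; x₃≡ = same (f c 3F) (f c 1F) (s₃ (he c)) (x₃≡ (he c)) ; x₄≡ = trans (cong (ℤ.-1ℤ *_) (x₄≡ (he c))) (negate (f
          c 1F) (s₄ (he c))) }
      where
      same : ∀ x y e → x ≡ y + + 2 * e → + 1 * x ≡ + 1 * y + + 2 * e
      same x y e eq = trans (ℤ.*-identityˡ x) (trans eq (cong (λ z → z + + 2 * e) (sym (ℤ.*-identityˡ y))))
      negate : ∀ x s → ℤ.-1ℤ * (x + + 2 * s) ≡ + 1 * x + + 2 * (- x - s)
      negate = solve-∀
    total≡ : ∀ x (hx : InHE x) → total x ≡ + 4 * x 1F + + 2 * (s₂ hx + s₃ hx + s₄ hx)
    total≡ x hx = trans (cong₂ _+_ (cong₂ _+_ (+-congʳ (x 1F) (x₂≡ hx)) (x₃≡ hx)) (x₄≡ hx)) (collect (x 1F) (s₂ hx)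
        (s₃ hx) (s₄ hx))
      where
      collect : ∀ x s t u → x + (x + + 2 * s) + (x + + 2 * t) + (x + + 2 * u) ≡ + 4 * x + + 2 * (s + t + u)
      collect = solve-∀
    4∣ : ∀ x (hx : InHE x) → par (s₂ hx + s₃ hx + s₄ hx) ≡ false → + 4 ∣ total x
    4∣ x hx ev = divide (par⇒even {s₂ hx + s₃ hx + s₄ hx} ev)
      where
      divide : + 2 ∣ s₂ hx + s₃ hx + s₄ hx → + 4 ∣ total x
      divide (divides q eq) = divides (x 1F + q) (trans (total≡ x hx) (trans (cong (λ t → + 4 * x 1F + + 2 * t) eq)
          (collect (x 1F) q)))
        where
        collect : ∀ x q → + 4 * x + + 2 * (q * + 2) ≡ (x + q) * + 4
        collect = solve-∀
    choose : Dec (∃ λ c → par (f c 1F) ≡ true) → ∃[ f′ ] Data S f′ × (∀ c → HalfEven (f′ c))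
    choose (no none) = f , data₀ , λ c → halfEven c (par⇒even {f c 1F} (Bool-≢ (λ t → none (c , t))))
      where
      halfEven : ∀ c → + 2 ∣ f c 1F → HalfEven (f c)
      halfEven c (divides q eq) = record { e = e (he c) ; k₁ = q ; k₂ = q + s₂ (he c) ; k₃ = q + s₃ (he c) ; k₄ = q +
          s₄ (he c)
        ; x₀≡ = x₀≡ (he c) ; x₁≡ = trans eq (ℤ.*-comm q (+ 2)) ; x₂≡ = shift (s₂ (he c)) (x₂≡ (he c))
        ; x₃≡ = shift (s₃ (he c)) (x₃≡ (he c)) ; x₄≡ = shift (s₄ (he c)) (x₄≡ (he c)) }
        where
        shift : ∀ {x} s → x ≡ f c 1F + + 2 * s → x ≡ + 2 * (q + s)
        shift s e = trans e (trans (cong (λ t → t + + 2 * s) eq) (collect q s))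
          where
          collect : ∀ q s → q * + 2 + + 2 * s ≡ + 2 * (q + s)
          collect = solve-∀
    choose (yes (c , odd)) = sign (par (s₂ (he c) + s₃ (he c) + s₄ (he c))) refl
      where
      sign : ∀ b → par (s₂ (he c) + s₃ (he c) + s₄ (he c)) ≡ b → ∃[ f′ ] Data S f′ × (∀ c → HalfEven (f′ c))
      sign false ev = hadamard-even {f} data₀ he c odd (4∣ (f c) (he c) ev)
      sign true  od = hadamard-even {signs σ f} (resign-data {S} {f} σ σ² data₀) flipped c
          (trans (cong par (ℤ.*-identityˡ (f c 1F))) odd)
          (4∣ (signs σ f c) (flipped c) (trans (cong par (regroup (s₂ (he c)) (s₃ (he c)) (f c 1F) (s₄ (he c))))
            (trans (par-+ (s₂ (he c) + s₃ (he c) + s₄ (he c)) (- (f c 1F + + 2 * s₄ (he c))))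
              (cong₂ _xor_ od (trans (par-neg (f c 1F + + 2 * s₄ (he c))) (trans (par-+ (f c 1F) (+ 2 * s₄ (he c)))
                (cong₂ _xor_ odd (par-* (+ 2) (s₄ (he c))))))))))
        where
        σ² : ∀ r → lookup σ r * lookup σ r ≡ + 1
        σ² = from-yes (Fin.all? λ r → lookup σ r * lookup σ r ℤ.≟ + 1)
        regroup : ∀ s t x u → s + t + (- x - u) ≡ s + t + u + - (x + + 2 * u)
        regroup = solve-∀

  AllEven : (Fin 3 → Vect 6) → Set
  AllEven f = ∀ c r → ∃[ k ] f c r ≡ + 2 * k

  -- Modulo 4, x₀z₀ + 3x₅z₅ ≡ x₅(z₀ - z₅): all z are evened by the same rotation.
  hexagonal-even : ∀ {f} → Data S f → (∀ c → HalfEven (f c)) → ∀ c → par (f c 5F) ≡ true → + 4 ∣ f c 0F - f c 5F →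
    ∃[ f′ ] Data S f′ × AllEven f′
  hexagonal-even {f} (F , D) he c odd 4∣ =
    f′ , (move {hexagonal} {S} {f} {f′} hexagonal-similarity moved F , move-dual {hexagonal} {f} {f′}
        hexagonal-similarity moved D) , allEven
    where
    open HalfEven
    x = f c
    hx = he c
    4∣′ : ∀ d → + 4 ∣ f d 0F - f d 5F
    4∣′ d = oddCancel (odd⇒ {x 5F} odd) (reduce 4∣ eisenstein)
      where
      z = f d
      hz = he d
      paired : ℤ
      paired = k₁ hx * k₁ hz + (k₂ hx * k₂ hz + (k₃ hx * k₃ hz + k₄ hx * k₄ hz))
      eisenstein : + 4 ∣ x 0F * z 0F + + 3 * (x 5F * z 5F)
      eisenstein = subst (+ 4 ∣_) (isolate (x 0F * z 0F) paired (x 5F * z 5F))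
        (∣m∣n⇒∣m-n (subst (+ 4 ∣_) (trans (sym (orth F c d)) (trans (J-form x z) substituted)) (4∣S* {δ c d}))
            (∣m⇒∣m*n paired ∣-refl))
        where
        substituted : x 0F * z 0F + (x 1F * z 1F + (x 2F * z 2F + (x 3F * z 3F + (x 4F * z 4F + + 3 * (x 5F * z
            5F))))) ≡
          x 0F * z 0F + (+ 2 * k₁ hx * (+ 2 * k₁ hz) + (+ 2 * k₂ hx * (+ 2 * k₂ hz) + (+ 2 * k₃ hx * (+ 2 * k₃ hz) +
              (+ 2 * k₄ hx * (+ 2 * k₄ hz) + + 3 * (x 5F * z 5F)))))
        substituted = +-congʳ (x 0F * z 0F) (cong₂ _+_ (cong₂ _*_ (x₁≡ hx) (x₁≡ hz)) (cong₂ _+_ (cong₂ _*_ (x₂≡ hx)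
            (x₂≡ hz))
          (cong₂ _+_ (cong₂ _*_ (x₃≡ hx) (x₃≡ hz)) (cong (λ t → t + + 3 * (x 5F * z 5F)) (cong₂ _*_ (x₄≡ hx) (x₄≡
              hz))))))
        isolate′ : ∀ A a a′ b b′ c c′ d d′ E → A + (+ 2 * a * (+ 2 * a′) + (+ 2 * b * (+ 2 * b′) + (+ 2 * c * (+ 2 *
            c′) + (+ 2 * d * (+ 2 * d′) + + 3 * E)))) - + 4 * (a * a′ + (b * b′ + (c * c′ + d * d′))) ≡ A + + 3 * E
        isolate′ = solve-∀
        isolate : ∀ A P E → A + (+ 2 * k₁ hx * (+ 2 * k₁ hz) + (+ 2 * k₂ hx * (+ 2 * k₂ hz) + (+ 2 * k₃ hx * (+ 2 *
            k₃ hz) + (+ 2 * k₄ hx * (+ 2 * k₄ hz) + + 3 * E)))) - + 4 * paired ≡ A + + 3 * E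
        isolate A P E = isolate′ A (k₁ hx) (k₁ hz) (k₂ hx) (k₂ hz) (k₃ hx) (k₃ hz) (k₄ hx) (k₄ hz) E
      reduce : + 4 ∣ x 0F - x 5F → + 4 ∣ x 0F * z 0F + + 3 * (x 5F * z 5F) → + 4 ∣ x 5F * (z 0F - z 5F)
      reduce (divides q e) (divides r e′) = divides (r - q * z 0F - x 5F * z 5F)
        (trans (expand (x 0F) (x 5F) (z 0F) (z 5F)) (trans (cong₂ (λ s t → s - t * z 0F - + 4 * (x 5F * z 5F)) e′ e)
            (collect r q (z 0F) (x 5F) (z 5F))))
        where
        expand : ∀ x₀ x₅ z₀ z₅ → x₅ * (z₀ - z₅) ≡ x₀ * z₀ + + 3 * (x₅ * z₅) - (x₀ - x₅) * z₀ - + 4 * (x₅ * z₅)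
        expand = solve-∀
        collect : ∀ r q z₀ x₅ z₅ → r * + 4 - q * + 4 * z₀ - + 4 * (x₅ * z₅) ≡ (r - q * z₀ - x₅ * z₅) * + 4
        collect = solve-∀
      -- x₅² ≡ 1 modulo 4
      oddCancel : (∃[ t ] x 5F ≡ + 2 * t + + 1) → + 4 ∣ x 5F * (z 0F - z 5F) → + 4 ∣ z 0F - z 5F
      oddCancel (t , e) (divides q e′) = divides (x 5F * q - (t * t + t) * (z 0F - z 5F))
        (trans (expand t (z 0F - z 5F)) (trans (cong (λ X → X * (X * (z 0F - z 5F)) - + 4 * ((t * t + t) * (z 0F - z
            5F))) (sym e))
          (trans (cong (λ w → x 5F * w - + 4 * ((t * t + t) * (z 0F - z 5F))) e′) (collect (x 5F) q ((t * t + t) * (z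
              0F - z 5F))))))
        where
        expand : ∀ t w → w ≡ (+ 2 * t + + 1) * ((+ 2 * t + + 1) * w) - + 4 * ((t * t + t) * w)
        expand = solve-∀
        collect : ∀ x q w → x * (q * + 4) - + 4 * w ≡ (x * q - w) * + 4
        collect = solve-∀
    κ : Fin 3 → ℤ
    κ d = quotient (4∣′ d)
    f′ : Fin 3 → Vect 6
    f′ d = lookup (+ 2 * (κ d + f d 5F) ∷ f d 1F ∷ f d 2F ∷ f d 3F ∷ f d 4F ∷ + 2 * κ d ∷ [])
    moved : Moved hexagonal f f′
    moved d 1F = apply-hexagonal (f d) 1F
    moved d 2F = apply-hexagonal (f d) 2F
    moved d 3F = apply-hexagonal (f d) 3F
    moved d 4F = apply-hexagonal (f d) 4F
    moved d 0F = trans (apply-hexagonal (f d) 0F) (trans (isolate (f d 0F) (f d 5F)) (trans (cong (λ t → t + + 4 * f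
        d 5F) (_∣_.equality (4∣′ d))) (collect (κ d) (f d 5F))))
      where
      isolate : ∀ a b → a + + 3 * b ≡ a - b + + 4 * b
      isolate = solve-∀
      collect : ∀ k b → k * + 4 + + 4 * b ≡ + 2 * (+ 2 * (k + b))
      collect = solve-∀
    moved d 5F = trans (apply-hexagonal (f d) 5F) (trans (_∣_.equality (4∣′ d)) (double (κ d)))
      where
      double : ∀ k → k * + 4 ≡ + 2 * (+ 2 * k)
      double = solve-∀
    allEven : AllEven f′
    allEven d 0F = _ , refl
    allEven d 1F = k₁ (he d) , x₁≡ (he d)
    allEven d 2F = k₂ (he d) , x₂≡ (he d)
    allEven d 3F = k₃ (he d) , x₃≡ (he d)
    allEven d 4F = k₄ (he d) , x₄≡ (he d)
    allEven d 5F = _ , refl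

  -- The difference of the entries 0F and 5F is 2e. Reversing the sign of an odd entry 5F adds this
  -- entry to e and so changes the parity of e.
  hexagonal-stage : ∀ {f} → Data S f → (∀ c → HalfEven (f c)) → ∃[ f′ ] Data S f′ × AllEven f′
  hexagonal-stage {f} data₀ he = choose (Fin.any? (λ c → par (f c 5F) Bool.≟ true))
    where
    open HalfEven
    σ : Vec ℤ 6
    σ = + 1 ∷ + 1 ∷ + 1 ∷ + 1 ∷ + 1 ∷ ℤ.-1ℤ ∷ []
    flipped : ∀ c → HalfEven (signs σ f c)
    flipped c = record { e = e (he c) + f c 5F ; k₁ = k₁ (he c) ; k₂ = k₂ (he c) ; k₃ = k₃ (he c) ; k₄ = k₄ (he c)
      ; x₀≡ = trans (ℤ.*-identityˡ (f c 0F)) (trans (x₀≡ (he c)) (negate (f c 5F) (e (he c))))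
      ; x₁≡ = trans (ℤ.*-identityˡ (f c 1F)) (x₁≡ (he c)) ; x₂≡ = trans (ℤ.*-identityˡ (f c 2F)) (x₂≡ (he c))
      ; x₃≡ = trans (ℤ.*-identityˡ (f c 3F)) (x₃≡ (he c)) ; x₄≡ = trans (ℤ.*-identityˡ (f c 4F)) (x₄≡ (he c)) }
      where
      negate : ∀ x e → x + + 2 * e ≡ ℤ.-1ℤ * x + + 2 * (e + x)
      negate = solve-∀
    4∣ : ∀ x (hx : HalfEven x) → par (e hx) ≡ false → + 4 ∣ x 0F - x 5F
    4∣ x hx ev = divide (par⇒even {e hx} ev)
      where
      divide : + 2 ∣ e hx → + 4 ∣ x 0F - x 5F
      divide (divides q eq) = divides q (trans (cong (λ t → t - x 5F) (trans (x₀≡ hx) (cong (λ t → x 5F + + 2 * t)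
          eq))) (collect (x 5F) q))
        where
        collect : ∀ x q → x + + 2 * (q * + 2) - x ≡ q * + 4
        collect = solve-∀
    choose : Dec (∃ λ c → par (f c 5F) ≡ true) → ∃[ f′ ] Data S f′ × AllEven f′
    choose (no none) = f , data₀ , λ c → allEven c (par⇒even {f c 5F} (Bool-≢ (λ t → none (c , t))))
      where
      allEven : ∀ c → + 2 ∣ f c 5F → ∀ r → ∃[ k ] f c r ≡ + 2 * k
      allEven c (divides q eq) 0F = q + e (he c) , trans (x₀≡ (he c)) (trans (cong (λ t → t + + 2 * e (he c)) eq)
          (collect q (e (he c))))
        where
        collect : ∀ q s → q * + 2 + + 2 * s ≡ + 2 * (q + s)
        collect = solve-∀
      allEven c _ 1F = k₁ (he c) , x₁≡ (he c)
      allEven c _ 2F = k₂ (he c) , x₂≡ (he c)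
      allEven c _ 3F = k₃ (he c) , x₃≡ (he c)
      allEven c _ 4F = k₄ (he c) , x₄≡ (he c)
      allEven c (divides q eq) 5F = q , trans eq (ℤ.*-comm q (+ 2))
    choose (yes (c , odd)) = sign (par (e (he c))) refl
      where
      σ² : ∀ r → lookup σ r * lookup σ r ≡ + 1
      σ² = from-yes (Fin.all? λ r → lookup σ r * lookup σ r ℤ.≟ + 1)
      sign : ∀ b → par (e (he c)) ≡ b → ∃[ f′ ] Data S f′ × AllEven f′
      sign false ev = hexagonal-even {f} data₀ he c odd (4∣ (f c) (he c) ev)
      sign true  od = hexagonal-even {signs σ f} (resign-data {S} {f} σ σ² data₀) flipped c
        (trans (cong par (ℤ.-1*i≡-i (f c 5F))) (trans (par-neg (f c 5F)) odd))
        (4∣ (signs σ f c) (flipped c) (trans (par-+ (e (he c)) (f c 5F)) (cong₂ _xor_ od odd)))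

  normalise : ∀ {f} → Data S f → (∀ c → InHE (f c)) → ∃ (Data (+ p * + p))
  normalise {f} data₀ he = finish (hadamard-stage {f} data₀ he)
    where
    finish : (∃[ f₁ ] Data S f₁ × (∀ c → HalfEven (f₁ c))) → ∃ (Data (+ p * + p))
    finish (f₁ , data₁ , halfEven) = halve (hexagonal-stage {f₁} data₁ halfEven)
      where
      halve : (∃[ f₂ ] Data S f₂ × AllEven f₂) → ∃ (Data (+ p * + p))
      halve (f₂ , (F , D) , allEven) = (λ c r → proj₁ (allEven c r)) ,
        scale {+ p * + p} {f₂} (λ c r → proj₂ (allEven c r)) F , scale-dual {f₂} (λ c r → proj₂ (allEven c r)) D

-- Reduction modulo 2

allBits : ∀ n → (Vec Bool n → Bool) → Bool
allBits zero    P = P []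
allBits (suc n) P = allBits n (P ∘ (false ∷_)) ∧ allBits n (P ∘ (true ∷_))

someBits : ∀ n → (Vec Bool n → Bool) → Bool
someBits zero    P = P []
someBits (suc n) P = someBits n (P ∘ (false ∷_)) ∨ someBits n (P ∘ (true ∷_))

∧-true : ∀ a {b} → a ∧ b ≡ true → a ≡ true × b ≡ true
∧-true true e = refl , e

∨-true : ∀ a {b} → a ∨ b ≡ true → a ≡ true ⊎ b ≡ true
∨-true true  e = inj₁ refl
∨-true false e = inj₂ e

not-true : ∀ {a} → not a ≡ true → a ≡ false
not-true {false} e = refl

allBits-sound : ∀ n P → allBits n P ≡ true → ∀ β → P β ≡ true
allBits-sound zero    P e []          = e
allBits-sound (suc n) P e (false ∷ β) = allBits-sound n _ (proj₁ (∧-true (allBits n (P ∘ (false ∷_))) e)) β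
allBits-sound (suc n) P e (true ∷ β)  = allBits-sound n _ (proj₂ (∧-true (allBits n (P ∘ (false ∷_))) e)) β

someBits-sound : ∀ n P → someBits n P ≡ true → ∃[ β ] P β ≡ true
someBits-sound zero    P e = [] , e
someBits-sound (suc n) P e with ∨-true (someBits n (P ∘ (false ∷_))) e
... | inj₁ e₀ = let β , Pβ = someBits-sound n _ e₀ in false ∷ β , Pβ
... | inj₂ e₁ = let β , Pβ = someBits-sound n _ e₁ in true ∷ β , Pβ

some : ∀ {a} {A : Set a} {n} → (A → Bool) → Vec A n → Bool
some P []       = false
some P (x ∷ xs) = P x ∨ some P xs

some-sound : ∀ {a} {A : Set a} {n} (P : A → Bool) (xs : Vec A n) → some P xs ≡ true → ∃[ i ] P (lookup xs i) ≡ true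
some-sound P (x ∷ xs) e with ∨-true (P x) e
... | inj₁ e₀ = zero , e₀
... | inj₂ e₁ = let i , Pi = some-sound P xs e₁ in suc i , Pi

every : (Fin 3 → Bool) → Bool
every b = b 0F ∧ (b 1F ∧ b 2F)

every-sound : ∀ b → every b ≡ true → ∀ c → b c ≡ true
every-sound b e 0F = proj₁ (∧-true (b 0F) e)
every-sound b e 1F = proj₁ (∧-true (b 1F) (proj₂ (∧-true (b 0F) e)))
every-sound b e 2F = proj₂ (∧-true (b 1F) (proj₂ (∧-true (b 0F) e)))

Bits : Set
Bits = Vec Bool 6

weight : Bits → ℤ
weight (b₀ ∷ b₁ ∷ b₂ ∷ b₃ ∷ b₄ ∷ b₅ ∷ []) = bit b₀ + (bit b₁ + (bit b₂ + (bit b₃ + (bit b₄ + + 3 * bit b₅))))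

-- A square modulo 4 depends only on the parity of its root, so the norm modulo 4 can be read off
-- from the bits, and p² is 1 modulo 4.
unitNorm : Bits → Bool
unitNorm β = does (+ 4 ∣? weight β - + 1)

orthogonal : Bits → Bits → Bool
orthogonal (b₀ ∷ b₁ ∷ b₂ ∷ b₃ ∷ b₄ ∷ b₅ ∷ []) (c₀ ∷ c₁ ∷ c₂ ∷ c₃ ∷ c₄ ∷ c₅ ∷ []) =
  not ((b₀ ∧ c₀) xor ((b₁ ∧ c₁) xor ((b₂ ∧ c₂) xor ((b₃ ∧ c₃) xor ((b₄ ∧ c₄) xor (b₅ ∧ c₅))))))

Permutation : Set
Permutation = Vec (Fin 6) 6

-- The entries 0F and 1F are the coordinates left to I₂, the entries 2F, 3F, 4F those of D₃; every pair
-- occurs, each of the five coordinates comes first at least once, and the last permutation swaps 0F and 1F.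
permutations : Vec Permutation 12
permutations =
    (0F ∷ 1F ∷ 2F ∷ 3F ∷ 4F ∷ 5F ∷ [])
  ∷ (0F ∷ 2F ∷ 1F ∷ 3F ∷ 4F ∷ 5F ∷ [])
  ∷ (0F ∷ 3F ∷ 1F ∷ 2F ∷ 4F ∷ 5F ∷ [])
  ∷ (0F ∷ 4F ∷ 1F ∷ 2F ∷ 3F ∷ 5F ∷ [])
  ∷ (1F ∷ 2F ∷ 0F ∷ 3F ∷ 4F ∷ 5F ∷ [])
  ∷ (1F ∷ 3F ∷ 0F ∷ 2F ∷ 4F ∷ 5F ∷ [])
  ∷ (1F ∷ 4F ∷ 0F ∷ 2F ∷ 3F ∷ 5F ∷ [])
  ∷ (2F ∷ 3F ∷ 0F ∷ 1F ∷ 4F ∷ 5F ∷ [])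
  ∷ (2F ∷ 4F ∷ 0F ∷ 1F ∷ 3F ∷ 5F ∷ [])
  ∷ (3F ∷ 4F ∷ 0F ∷ 1F ∷ 2F ∷ 5F ∷ [])
  ∷ (4F ∷ 0F ∷ 1F ∷ 2F ∷ 3F ∷ 5F ∷ [])
  ∷ (1F ∷ 0F ∷ 2F ∷ 3F ∷ 4F ∷ 5F ∷ []) ∷ []

module _ (β : Fin 3 → Bits) (π : Permutation) where

  private
    at : Fin 3 → Fin 6 → Bool
    at c r = lookup (β c) (lookup π r)

  evenTriple : Bool
  evenTriple = every λ c → not ((at c 2F xor at c 3F) xor at c 4F)

  -- Reversing the signs selected by ε subtracts twice the sum of the selected coordinates from the
  -- total. The parity of this sum decides whether half the total changes its parity.
  flipParity : Vec Bool 4 → Fin 3 → Bool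
  flipParity (ε₁ ∷ ε₂ ∷ ε₃ ∷ ε₄ ∷ []) c = (((ε₁ ∧ at c 1F) xor (ε₂ ∧ at c 2F)) xor (ε₃ ∧ at c 3F)) xor (ε₄ ∧ at c 4F)

  same : Vec Bool 3 → Vec Bool 4 → Bool
  same μ ε = every λ c → not (lookup μ c xor flipParity ε c)

  -- Four coordinates with even sum such that sign changes make the sum divisible by 4, whatever it
  -- was: a Hadamard rotation of them then leaves an even triple.
  quadruple : Bool
  quadruple = (every λ c → not (((at c 1F xor at c 2F) xor at c 3F) xor at c 4F)) ∧ allBits 3 λ μ → someBits 4 (same μ)

  evenTail : Bool
  evenTail = every λ c → not (at c 0F) ∧ (not (at c 1F) ∧ not (at c 5F))

  -- This concerns only the coordinates that the rotations of the tail leave fixed, so it survives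
  -- to the end of the loop, where `oddTail` needs it.
  nonzeroColumns : Bool
  nonzeroColumns = column 2F ∧ (column 3F ∧ column 4F)
    where
    column : Fin 6 → Bool
    column r = at 0F r ∨ (at 1F r ∨ at 2F r)

solvable : (Fin 3 → Bits) → Bool
solvable β = some (λ π → evenTriple β π ∨ quadruple β π) permutations

triples : Bits → Bits → Bits → Fin 3 → Bits
triples β₀ β₁ β₂ = lookup (β₀ ∷ β₁ ∷ β₂ ∷ [])

if-true : ∀ a b → (if a then b else true) ≡ true → a ≡ true → b ≡ true
if-true true b e refl = e

-- Each condition is tested as soon as its vectors are chosen, so only a small part of the 2¹⁸
-- triples is ever visited.
module Exhaustive (P : (Fin 3 → Bits) → Bool) where

  check₂ : Bits → Bits → Bits → Bool
  check₂ β₀ β₁ β₂ = if unitNorm β₂ ∧ (orthogonal β₀ β₂ ∧ orthogonal β₁ β₂) then P (triples β₀ β₁ β₂) else true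

  check₁ : Bits → Bits → Bool
  check₁ β₀ β₁ = if unitNorm β₁ ∧ orthogonal β₀ β₁ then allBits 6 (check₂ β₀ β₁) else true

  check₀ : Bits → Bool
  check₀ β₀ = if unitNorm β₀ then allBits 6 (check₁ β₀) else true

  exhaustive : Bool
  exhaustive = allBits 6 check₀

  exhaustive-sound : exhaustive ≡ true → ∀ β₀ β₁ β₂ → unitNorm β₀ ≡ true → unitNorm β₁ ≡ true → unitNorm β₂ ≡ true →
    orthogonal β₀ β₁ ≡ true → orthogonal β₀ β₂ ≡ true → orthogonal β₁ β₂ ≡ true → P (triples β₀ β₁ β₂) ≡ true
  exhaustive-sound e β₀ β₁ β₂ u₀ u₁ u₂ o₀₁ o₀₂ o₁₂ = if-true (unitNorm β₂ ∧ (orthogonal β₀ β₂ ∧ orthogonal β₁ β₂)) _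
      e₂ (cong₂ _∧_ u₂ (cong₂ _∧_ o₀₂ o₁₂))
    where
    e₀ : check₀ β₀ ≡ true
    e₀ = allBits-sound 6 check₀ e β₀
    e₁ : check₁ β₀ β₁ ≡ true
    e₁ = allBits-sound 6 (check₁ β₀) (if-true (unitNorm β₀) _ e₀ u₀) β₁
    e₂ : check₂ β₀ β₁ β₂ ≡ true
    e₂ = allBits-sound 6 (check₂ β₀ β₁) (if-true (unitNorm β₁ ∧ orthogonal β₀ β₁) _ e₁ (cong₂ _∧_ u₁ o₀₁)) β₂

open Exhaustive

trichotomy : exhaustive (λ β → solvable β ∨ some (λ π → evenTail β π ∧ nonzeroColumns β π) permutations) ≡ true
trichotomy = refl

-- Meant for the end of the loop: an odd entry of the tail excludes `evenTail`, and `solvable`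
-- remains.
oddTail : exhaustive (λ β → not (nonzeroColumns β (lookup permutations 0F)) ∨ (evenTail β (lookup permutations 0F) ∨
    solvable β)) ≡ true
oddTail = refl

-- D₃ = A₃ inside ℤ³

-- On the coordinates 2F, 3F, 4F these are the simple roots of D₃, ordered so that (1, -1, 0) is the
-- middle node of the diagram A₃.
rootsInJ : Fin 6 → Vect 6
rootsInJ = rows
  ( (+ 1 ∷ + 0 ∷ + 0 ∷ + 0 ∷ + 0 ∷ + 0 ∷ [])
  ∷ (+ 0 ∷ + 1 ∷ + 0 ∷ + 0 ∷ + 0 ∷ + 0 ∷ [])
  ∷ (+ 0 ∷ + 0 ∷ + 0 ∷ + 1 ∷ -[1+ 0 ] ∷ + 0 ∷ [])
  ∷ (+ 0 ∷ + 0 ∷ + 1 ∷ -[1+ 0 ] ∷ + 0 ∷ + 0 ∷ [])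
  ∷ (+ 0 ∷ + 0 ∷ + 0 ∷ + 1 ∷ + 1 ∷ + 0 ∷ [])
  ∷ (+ 0 ∷ + 0 ∷ + 0 ∷ + 0 ∷ + 0 ∷ + 1 ∷ []) ∷ [])

L6-in-J : ∀ x y → B L6 x y ≡ B J (lincomb rootsInJ x) (lincomb rootsInJ y)
L6-in-J x y = trans (B-congᴳ L6 x y (from-yes (≡Mat? L6 (subGram J rootsInJ)))) (sym (B-lincomb₂ J rootsInJ x y))

lincomb-roots : ∀ x i → lincomb rootsInJ x i ≡ lookup
  (x 0F ∷ x 1F ∷ x 3F ∷ x 2F - x 3F + x 4F ∷ x 4F - x 2F ∷ x 5F ∷ []) i
lincomb-roots x = λ where
    0F → e₀ (x 0F) (x 1F) (x 2F) (x 3F) (x 4F) (x 5F)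
    1F → e₁ (x 0F) (x 1F) (x 2F) (x 3F) (x 4F) (x 5F)
    2F → e₂ (x 0F) (x 1F) (x 2F) (x 3F) (x 4F) (x 5F)
    3F → e₃ (x 0F) (x 1F) (x 2F) (x 3F) (x 4F) (x 5F)
    4F → e₄ (x 0F) (x 1F) (x 2F) (x 3F) (x 4F) (x 5F)
    5F → e₅ (x 0F) (x 1F) (x 2F) (x 3F) (x 4F) (x 5F)
  where
  e₀ : ∀ a b c d e f → a * + 1 + (b * + 0 + (c * + 0 + (d * + 0 + (e * + 0 + (f * + 0 + + 0))))) ≡ a
  e₀ = solve-∀
  e₁ : ∀ a b c d e f → a * + 0 + (b * + 1 + (c * + 0 + (d * + 0 + (e * + 0 + (f * + 0 + + 0))))) ≡ b
  e₁ = solve-∀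
  e₂ : ∀ a b c d e f → a * + 0 + (b * + 0 + (c * + 0 + (d * + 1 + (e * + 0 + (f * + 0 + + 0))))) ≡ d
  e₂ = solve-∀
  e₃ : ∀ a b c d e f → a * + 0 + (b * + 0 + (c * + 1 + (d * -[1+ 0 ] + (e * + 1 + (f * + 0 + + 0))))) ≡ c - d + e
  e₃ = solve-∀
  e₄ : ∀ a b c d e f → a * + 0 + (b * + 0 + (c * -[1+ 0 ] + (d * + 0 + (e * + 1 + (f * + 0 + + 0))))) ≡ e - c
  e₄ = solve-∀
  e₅ : ∀ a b c d e f → a * + 0 + (b * + 0 + (c * + 0 + (d * + 0 + (e * + 0 + (f * + 1 + + 0))))) ≡ f
  e₅ = solve-∀

L6-represents : ∀ {k} (γ : Mat k) (y : Fin k → Vect 6) → (∀ i j → B J (y i) (y j) ≡ γ i j) →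
  (∀ i → + 2 ∣ y i 2F + y i 3F + y i 4F) → Represents L6 γ
L6-represents γ y gram even = T , λ i j → trans (L6-in-J (T i) (T j)) (trans (B-cong J (T≡ i) (T≡ j)) (gram i j))
  where
  q : ∀ i → ℤ
  q i = quotient (even i)
  -- The inverse of `lincomb-roots`: the coordinates 2F, 3F, 4F add up to twice the coefficient of
  -- the root (0, 1, 1).
  T : ∀ i → Vect 6
  T i = lookup (y i 0F ∷ y i 1F ∷ q i - y i 4F ∷ y i 2F ∷ q i ∷ y i 5F ∷ [])
  T≡ : ∀ i r → lincomb rootsInJ (T i) r ≡ y i r
  T≡ i 0F = lincomb-roots (T i) 0F
  T≡ i 1F = lincomb-roots (T i) 1F
  T≡ i 2F = lincomb-roots (T i) 2F
  T≡ i 3F = trans (lincomb-roots (T i) 3F) (trans (regroup (q i) (y i 4F) (y i 2F))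
    (trans (cong (λ t → t - y i 2F - y i 4F) (sym (_∣_.equality (even i)))) (cancel (y i 2F) (y i 3F) (y i 4F))))
    where
    regroup : ∀ q c a → q - c - a + q ≡ q * + 2 - a - c
    regroup = solve-∀
    cancel : ∀ a b c → a + b + c - a - c ≡ b
    cancel = solve-∀
  T≡ i 4F = trans (lincomb-roots (T i) 4F) (cancel (q i) (y i 4F))
    where
    cancel : ∀ q c → q - (q - c) ≡ c
    cancel = solve-∀
  T≡ i 5F = lincomb-roots (T i) 5F

-- From parity patterns of frames to representations by `L6`

J-permutation : ∀ i → Similarities.Similarity J (permute (lookup (lookup permutations i)))
J-permutation n i j = trans (J-form (A i) (A j))
  (from-yes (Fin.all? λ n → Fin.all? λ i → Fin.all? λ j → form n i j ℤ.≟ + 4 * J i j) n i j)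
  where
  A = permute (lookup (lookup permutations n))
  form : Fin 12 → Fin 6 → Fin 6 → ℤ
  form n i j = x 0F * y 0F + (x 1F * y 1F + (x 2F * y 2F + (x 3F * y 3F + (x 4F * y 4F + + 3 * (x 5F * y 5F)))))
    where
    x = permute (lookup (lookup permutations n)) i
    y = permute (lookup (lookup permutations n)) j

I≡δ : ∀ i j → I 3 i j ≡ δ i j
I≡δ = from-yes (≡Mat? (I 3) δ)

bits : Vect 6 → Bits
bits x = tabulate (λ r → par (x r))

unitNorm-bits : ∀ x y → B J x x ≡ + 4 * y + + 1 → unitNorm (bits x) ≡ true
unitNorm-bits x y e = dec-true (+ 4 ∣? weight (bits x) - + 1) (divides (y - (u 0F + (u 1F + (u 2F + (u 3F + (u 4F + +
    3 * u 5F)))))) (begin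
    weight (bits x) - + 1                                                        ≡⟨ isolate (b 0F) (b 1F) (b 2F) (b
        3F) (b 4F) (b 5F) (u 0F) (u 1F) (u 2F) (u 3F) (u 4F) (u 5F) ⟩
    s 0F + (s 1F + (s 2F + (s 3F + (s 4F + + 3 * s 5F)))) - + 1 - + 4 * U        ≡⟨ cong (λ t → t - + 1 - + 4 * U)
        squares ⟨
    x 0F * x 0F + (x 1F * x 1F + (x 2F * x 2F + (x 3F * x 3F + (x 4F * x 4F + + 3 * (x 5F * x 5F))))) - + 1 - + 4 * U
                                                                                 ≡⟨ cong (λ t → t - + 1 - + 4 * U)
                                                                                     (trans (sym (J-form x x)) e) ⟩
    + 4 * y + + 1 - + 1 - + 4 * U                                                ≡⟨ collect y U ⟩
    (y - U) * + 4                                                                ∎))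
  where
  open ≡-Reasoning
  q : Vect 6
  q r = proj₁ (par-spec (x r))
  b : Vect 6
  b r = bit (par (x r))
  u : Vect 6
  u r = q r * q r + q r * b r
  s : Vect 6
  s r = + 4 * u r + b r
  U : ℤ
  U = u 0F + (u 1F + (u 2F + (u 3F + (u 4F + + 3 * u 5F))))
  square : ∀ r → x r * x r ≡ s r
  square r = trans (cong₂ _*_ (proj₂ (par-spec (x r))) (proj₂ (par-spec (x r)))) (trans (expand (q r) (b r))
      (+-congʳ (+ 4 * u r) (idempotent (par (x r)))))
    where
    idempotent : ∀ b → bit b * bit b ≡ bit b
    idempotent false = refl
    idempotent true  = refl
    expand : ∀ q b → (+ 2 * q + b) * (+ 2 * q + b) ≡ + 4 * (q * q + q * b) + b * b
    expand = solve-∀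
  squares : x 0F * x 0F + (x 1F * x 1F + (x 2F * x 2F + (x 3F * x 3F + (x 4F * x 4F + + 3 * (x 5F * x 5F))))) ≡
    s 0F + (s 1F + (s 2F + (s 3F + (s 4F + + 3 * s 5F))))
  squares = cong₂ _+_ (square 0F) (cong₂ _+_ (square 1F) (cong₂ _+_ (square 2F) (cong₂ _+_ (square 3F) (cong₂ _+_
      (square 4F) (cong (+ 3 *_) (square 5F))))))
  isolate : ∀ a b c d e f t u v w x y → a + (b + (c + (d + (e + + 3 * f)))) - + 1 ≡
    (+ 4 * t + a) + ((+ 4 * u + b) + ((+ 4 * v + c) + ((+ 4 * w + d) + ((+ 4 * x + e) + + 3 * (+ 4 * y + f))))) - + 1
        - + 4 * (t + (u + (v + (w + (x + + 3 * y)))))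
  isolate = solve-∀
  collect : ∀ y U → + 4 * y + + 1 - + 1 - + 4 * U ≡ (y - U) * + 4
  collect = solve-∀

orthogonal-bits : ∀ x z → B J x z ≡ + 0 → orthogonal (bits x) (bits z) ≡ true
orthogonal-bits x z e = cong not (trans (sym expand) (cong par (trans (sym (J-form x z)) e)))
  where
  m : ∀ r → par (x r * z r) ≡ par (x r) ∧ par (z r)
  m r = par-* (x r) (z r)
  expand : par (x 0F * z 0F + (x 1F * z 1F + (x 2F * z 2F + (x 3F * z 3F + (x 4F * z 4F + + 3 * (x 5F * z 5F)))))) ≡
    (par (x 0F) ∧ par (z 0F)) xor ((par (x 1F) ∧ par (z 1F)) xor ((par (x 2F) ∧ par (z 2F)) xor ((par (x 3F) ∧ par (z
        3F)) xor
      ((par (x 4F) ∧ par (z 4F)) xor (par (x 5F) ∧ par (z 5F))))))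
  expand = trans (par-+ (x 0F * z 0F) _) (cong₂ _xor_ (m 0F) (trans (par-+ (x 1F * z 1F) _) (cong₂ _xor_ (m 1F)
      (trans (par-+ (x 2F * z 2F) _)
    (cong₂ _xor_ (m 2F) (trans (par-+ (x 3F * z 3F) _) (cong₂ _xor_ (m 3F) (trans (par-+ (x 4F * z 4F) (+ 3 * (x 5F *
        z 5F)))
      (cong₂ _xor_ (m 4F) (trans (par-* (+ 3) (x 5F * z 5F)) (m 5F)))))))))))

module Solve (p : ℕ) (h : ℤ) (p-odd : + p ≡ + 2 * h + + 1) (p≢0 : + p ≢ + 0) {k} (v : Fin k → Vect 3) (a : Vect 3) where

  open Normalise p h p-odd v a public

  N : ℤ
  N = + p * + p

  Goal : Set
  Goal = Represents L6 (subGram (I 3) v)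

  -- The image of `v i` is 1/p times a combination of the f c, and the even coordinate sum survives
  -- the division because p is odd.
  solve-even : ∀ {f} → Frame N f → (∀ c → + 2 ∣ f c 2F + f c 3F + f c 4F) → Goal
  solve-even {f} F even = L6-represents (subGram (I 3) v) y gram evenSum
    where
    y : Fin k → Vect 6
    y i r = quotient (div F i r)
    y≡ : ∀ i r → lincomb f (v i) r ≡ + p * y i r
    y≡ i r = trans (_∣_.equality (div F i r)) (ℤ.*-comm (y i r) (+ p))
    gram : ∀ i j → B J (y i) (y j) ≡ subGram (I 3) v i j
    gram i j = *-cancelˡ N (B J (y i) (y j)) (B (I 3) (v i) (v j)) (*-nonZero p≢0 p≢0) (begin
      N * B J (y i) (y j)                                ≡⟨ ℤ.*-assoc (+ p) (+ p) (B J (y i) (y j)) ⟩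
      + p * (+ p * B J (y i) (y j))                      ≡⟨ cong (+ p *_) (B-*ʳ J (+ p) (y j) (y i)) ⟨
      + p * B J (y i) (λ r → + p * y j r)                ≡⟨ B-*ˡ J (+ p) (y i) (λ r → + p * y j r) ⟨
      B J (λ r → + p * y i r) (λ r → + p * y j r)        ≡⟨ B-cong J (y≡ i) (y≡ j) ⟨
      B J (lincomb f (v i)) (lincomb f (v j))            ≡⟨ B-lincomb₂ J f (v i) (v j) ⟩
      B (subGram J f) (v i) (v j)                        ≡⟨ B-congᴳ (subGram J f) (v i) (v j) (orth F) ⟩
      B (λ c d → N * δ c d) (v i) (v j)                  ≡⟨ B-*ᴳ δ N (v i) (v j) ⟩
      N * B δ (v i) (v j)                                ≡⟨ cong (N *_) (B-congᴳ (I 3) (v i) (v j) I≡δ) ⟨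
      N * B (I 3) (v i) (v j)                            ∎)
      where open ≡-Reasoning
    evenSum : ∀ i → + 2 ∣ y i 2F + y i 3F + y i 4F
    evenSum i = oddCancel (subst (+ 2 ∣_) (trans (gather (v i 0F) (v i 1F) (v i 2F) (f 0F 2F) (f 0F 3F) (f 0F 4F) (f
        1F 2F) (f 1F 3F) (f 1F 4F) (f 2F 2F) (f 2F 3F) (f 2F 4F))
        (trans (cong₂ _+_ (cong₂ _+_ (y≡ i 2F) (y≡ i 3F)) (y≡ i 4F)) (factor (+ p) (y i 2F) (y i 3F) (y i 4F))))
        (∣-sumF 3 (λ c → ∣n⇒∣m*n (v i c) (even c))))
      where
      gather : ∀ a b c f₀ g₀ h₀ f₁ g₁ h₁ f₂ g₂ h₂ →
        a * (f₀ + g₀ + h₀) + (b * (f₁ + g₁ + h₁) + (c * (f₂ + g₂ + h₂) + + 0)) ≡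
        (a * f₀ + (b * f₁ + (c * f₂ + + 0))) + (a * g₀ + (b * g₁ + (c * g₂ + + 0))) + (a * h₀ + (b * h₁ + (c * h₂ + +
            0)))
      gather = solve-∀
      factor : ∀ p a b c → p * a + p * b + p * c ≡ p * (a + b + c)
      factor = solve-∀
      oddCancel : ∀ {x} → + 2 ∣ + p * x → + 2 ∣ x
      oddCancel {x} (divides q e) = divides (q - h * x) (trans (expand h x) (trans (cong (λ P → P * x - + 2 * (h *
          x)) (sym p-odd))
        (trans (cong (λ t → t - + 2 * (h * x)) e) (collect q (h * x)))))
        where
        expand : ∀ h x → x ≡ (+ 2 * h + + 1) * x - + 2 * (h * x)
        expand = solve-∀
        collect : ∀ q t → q * + 2 - + 2 * t ≡ (q - t) * + 2
        collect = solve-∀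

  permuted : Fin 12 → (Fin 3 → Vect 6) → Fin 3 → Vect 6
  permuted n f c r = f c (lookup (lookup permutations n) r)

  permute-moved : ∀ n f → Moved (permute (lookup (lookup permutations n))) f (permuted n f)
  permute-moved n f c r = apply-permute (lookup (lookup permutations n)) (f c) r

  permute-frame : ∀ n {f} → Frame N f → Frame N (permuted n f)
  permute-frame n {f} F = move {permute (lookup (lookup permutations n))} {N} {f} {permuted n f} (J-permutation n)
      (permute-moved n f) F

  permute-dual : ∀ n {f} → Dual f → Dual (permuted n f)
  permute-dual n {f} D = move-dual {permute (lookup (lookup permutations n))} {f} {permuted n f} (J-permutation n)
      (permute-moved n f) D

  -- For the total 4k the rotated coordinates 2F, 3F, 4F add up to 6k minus twice the sum of the old
  -- ones, which is always even.
  solve-hadamard : ∀ {f} → Frame N f → (∀ c → + 4 ∣ total (f c)) → Goal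
  solve-hadamard {f} F 4∣total = solve-even {f′} (move {hadamard} {N} {f} {f′} hadamard-similarity moved F) λ c →
      divides (f c 1F - κ c) (sum (κ c) (f c 1F) (f c 2F) (f c 3F) (f c 4F) (_∣_.equality (4∣total c)))
    where
    κ : Fin 3 → ℤ
    κ c = quotient (4∣total c)
    f′ : Fin 3 → Vect 6
    f′ c = halved (f c) (κ c)
    moved : Moved hadamard f f′
    moved c = hadamard-halved (f c) (κ c) (_∣_.equality (4∣total c))
    sum : ∀ k a b c d → a + b + c + d ≡ k * + 4 →
      (+ 2 * k - c - d) + (+ 2 * k - b - d) + (+ 2 * k - b - c) ≡ (a - k) * + 2
    sum k a b c d e = trans (expand k a b c d) (trans (cong (λ t → + 6 * k + + 2 * a - + 2 * t) e) (collect k a))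
      where
      expand : ∀ k a b c d → (+ 2 * k - c - d) + (+ 2 * k - b - d) + (+ 2 * k - b - c) ≡ + 6 * k + + 2 * a - + 2 * (a
          + b + c + d)
      expand = solve-∀
      collect : ∀ k a → + 6 * k + + 2 * a - + 2 * (k * + 4) ≡ (a - k) * + 2
      collect = solve-∀

-- Orthogonal triples in ℤ³

dot : Vect 3 → Vect 3 → ℤ
dot x y = x 0F * y 0F + (x 1F * y 1F + x 2F * y 2F)

dot-comm : ∀ x y → dot x y ≡ dot y x
dot-comm x y = identity (x 0F) (x 1F) (x 2F) (y 0F) (y 1F) (y 2F)
  where
  identity : ∀ a b c x y z → a * x + (b * y + c * z) ≡ x * a + (y * b + z * c)
  identity = solve-∀

det : (Fin 3 → Vect 3) → ℤ
det x = x 0F 0F * (x 1F 1F * x 2F 2F - x 1F 2F * x 2F 1F) - x 0F 1F * (x 1F 0F * x 2F 2F - x 1F 2F * x 2F 0F)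
  + x 0F 2F * (x 1F 0F * x 2F 1F - x 1F 1F * x 2F 0F)

gramDet : ℤ → ℤ → ℤ → ℤ → ℤ → ℤ → ℤ
gramDet p q r s t u = p * (s * u - t * t) - q * (q * u - t * r) + r * (q * t - s * r)

det² : ∀ x → det x * det x ≡
  gramDet (dot (x 0F) (x 0F)) (dot (x 0F) (x 1F)) (dot (x 0F) (x 2F)) (dot (x 1F) (x 1F)) (dot (x 1F) (x 2F)) (dot (x
      2F) (x 2F))
det² x = identity (x 0F 0F) (x 0F 1F) (x 0F 2F) (x 1F 0F) (x 1F 1F) (x 1F 2F) (x 2F 0F) (x 2F 1F) (x 2F 2F)
  where
  identity : ∀ a b c d e f g h i →
    (a * (e * i - f * h) - b * (d * i - f * g) + c * (d * h - e * g)) * (a * (e * i - f * h) - b * (d * i - f * g) +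
        c * (d * h - e * g)) ≡
    (a * a + (b * b + c * c)) * ((d * d + (e * e + f * f)) * (g * g + (h * h + i * i)) - (d * g + (e * h + f * i)) *
        (d * g + (e * h + f * i)))
    - (a * d + (b * e + c * f)) * ((a * d + (b * e + c * f)) * (g * g + (h * h + i * i)) - (d * g + (e * h + f * i))
        * (a * g + (b * h + c * i)))
    + (a * g + (b * h + c * i)) * ((a * d + (b * e + c * f)) * (d * g + (e * h + f * i)) - (d * d + (e * e + f * f))
        * (a * g + (b * h + c * i)))
  identity = solve-∀

vanishing : ∀ {x y z} a b c → x ≡ + 0 → y ≡ + 0 → z ≡ + 0 → a * x - b * y + c * z ≡ + 0
vanishing a b c refl refl refl = zeros a b c
  where
  zeros : ∀ a b c → a * + 0 - b * + 0 + c * + 0 ≡ + 0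
  zeros = solve-∀

cramer : ∀ x w → (∀ c → dot (x c) w ≡ + 0) → ∀ r → det x * w r ≡ + 0
cramer x w e 0F = trans (identity (x 0F 0F) (x 0F 1F) (x 0F 2F) (x 1F 0F) (x 1F 1F) (x 1F 2F) (x 2F 0F) (x 2F 1F) (x
    2F 2F) (w 0F) (w 1F) (w 2F))
    (vanishing (x 1F 1F * x 2F 2F - x 1F 2F * x 2F 1F) (x 0F 1F * x 2F 2F - x 0F 2F * x 2F 1F) (x 0F 1F * x 1F 2F - x
        0F 2F * x 1F 1F) (e 0F) (e 1F) (e 2F))
  where
  identity : ∀ a b c d e f g h i u v w →
    (a * (e * i - f * h) - b * (d * i - f * g) + c * (d * h - e * g)) * u ≡
    (e * i - f * h) * (a * u + (b * v + c * w)) - (b * i - c * h) * (d * u + (e * v + f * w)) + (b * f - c * e) * (g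
        * u + (h * v + i * w))
  identity = solve-∀
cramer x w e 1F = trans (identity (x 0F 0F) (x 0F 1F) (x 0F 2F) (x 1F 0F) (x 1F 1F) (x 1F 2F) (x 2F 0F) (x 2F 1F) (x
    2F 2F) (w 0F) (w 1F) (w 2F))
    (vanishing (x 1F 2F * x 2F 0F - x 1F 0F * x 2F 2F) (x 0F 2F * x 2F 0F - x 0F 0F * x 2F 2F) (x 0F 2F * x 1F 0F - x
        0F 0F * x 1F 2F) (e 0F) (e 1F) (e 2F))
  where
  identity : ∀ a b c d e f g h i u v w →
    (a * (e * i - f * h) - b * (d * i - f * g) + c * (d * h - e * g)) * v ≡
    (f * g - d * i) * (a * u + (b * v + c * w)) - (c * g - a * i) * (d * u + (e * v + f * w)) + (c * d - a * f) * (g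
        * u + (h * v + i * w))
  identity = solve-∀
cramer x w e 2F = trans (identity (x 0F 0F) (x 0F 1F) (x 0F 2F) (x 1F 0F) (x 1F 1F) (x 1F 2F) (x 2F 0F) (x 2F 1F) (x
    2F 2F) (w 0F) (w 1F) (w 2F))
    (vanishing (x 1F 0F * x 2F 1F - x 1F 1F * x 2F 0F) (x 0F 0F * x 2F 1F - x 0F 1F * x 2F 0F) (x 0F 0F * x 1F 1F - x
        0F 1F * x 1F 0F) (e 0F) (e 1F) (e 2F))
  where
  identity : ∀ a b c d e f g h i u v w →
    (a * (e * i - f * h) - b * (d * i - f * g) + c * (d * h - e * g)) * w ≡
    (d * h - e * g) * (a * u + (b * v + c * w)) - (a * h - b * g) * (d * u + (e * v + f * w)) + (a * e - b * d) * (g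
        * u + (h * v + i * w))
  identity = solve-∀

-- The vector w = ng - Σ (x_c·g)x_c is orthogonal to the three x_c. Their determinant has square n³,
-- so w = 0, and pairing w with g gives the identity.
parseval : ∀ n → n ≢ + 0 → ∀ x → (∀ c d → dot (x c) (x d) ≡ n * δ c d) → ∀ g →
  n * dot g g ≡ dot (x 0F) g * dot (x 0F) g + (dot (x 1F) g * dot (x 1F) g + dot (x 2F) g * dot (x 2F) g)
parseval n n≢0 x orth g = trans (split n (dot g g) (b 0F) (b 1F) (b 2F)) (trans (cong (λ t → t + (b 0F * b 0F + (b 1F
    * b 1F + b 2F * b 2F))) g·w≡0) (ℤ.+-identityˡ _))
  where
  b : Fin 3 → ℤ
  b c = dot (x c) g
  w : Vect 3
  w r = n * g r - (b 0F * x 0F r + (b 1F * x 1F r + b 2F * x 2F r))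
  y·w : ∀ y → dot y w ≡ n * dot y g - (b 0F * dot y (x 0F) + (b 1F * dot y (x 1F) + b 2F * dot y (x 2F)))
  y·w y = identity n (y 0F) (y 1F) (y 2F) (g 0F) (g 1F) (g 2F) (b 0F) (b 1F) (b 2F) (x 0F 0F) (x 0F 1F) (x 0F 2F) (x
      1F 0F) (x 1F 1F) (x 1F 2F) (x 2F 0F) (x 2F 1F) (x 2F 2F)
    where
    identity : ∀ n y₀ y₁ y₂ g₀ g₁ g₂ b₀ b₁ b₂ p q r s t u v k l →
      y₀ * (n * g₀ - (b₀ * p + (b₁ * s + b₂ * v))) + (y₁ * (n * g₁ - (b₀ * q + (b₁ * t + b₂ * k))) + y₂ * (n * g₂ -
          (b₀ * r + (b₁ * u + b₂ * l)))) ≡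
      n * (y₀ * g₀ + (y₁ * g₁ + y₂ * g₂)) - (b₀ * (y₀ * p + (y₁ * q + y₂ * r)) + (b₁ * (y₀ * s + (y₁ * t + y₂ * u)) +
          b₂ * (y₀ * v + (y₁ * k + y₂ * l))))
    identity = solve-∀
  x·w≡0 : ∀ c → dot (x c) w ≡ + 0
  x·w≡0 c = trans (y·w (x c)) (trans (cong₂ (λ s t → n * b c - (b 0F * s + t)) (orth c 0F)
      (cong₂ (λ s t → b 1F * s + b 2F * t) (orth c 1F) (orth c 2F))) (cancel c))
    where
    cancel : ∀ c → n * b c - (b 0F * (n * δ c 0F) + (b 1F * (n * δ c 1F) + b 2F * (n * δ c 2F))) ≡ + 0
    cancel 0F = identity n (b 0F) (b 1F) (b 2F)
      where
      identity : ∀ n a b c → n * a - (a * (n * + 1) + (b * (n * + 0) + c * (n * + 0))) ≡ + 0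
      identity = solve-∀
    cancel 1F = identity n (b 0F) (b 1F) (b 2F)
      where
      identity : ∀ n a b c → n * b - (a * (n * + 0) + (b * (n * + 1) + c * (n * + 0))) ≡ + 0
      identity = solve-∀
    cancel 2F = identity n (b 0F) (b 1F) (b 2F)
      where
      identity : ∀ n a b c → n * c - (a * (n * + 0) + (b * (n * + 0) + c * (n * + 1))) ≡ + 0
      identity = solve-∀
  det≢0 : det x ≢ + 0
  det≢0 e = *-nonZero n≢0 (*-nonZero n≢0 n≢0) (trans (sym gram≡) (trans (sym (det² x)) (cong (λ d → d * d) e)))
    where
    gram≡ : gramDet (dot (x 0F) (x 0F)) (dot (x 0F) (x 1F)) (dot (x 0F) (x 2F)) (dot (x 1F) (x 1F)) (dot (x 1F) (x
        2F)) (dot (x 2F) (x 2F)) ≡ n * (n * n)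
    gram≡ = subst-all (orth 0F 0F) (orth 0F 1F) (orth 0F 2F) (orth 1F 1F) (orth 1F 2F) (orth 2F 2F)
      where
      identity : ∀ n → gramDet (n * + 1) (n * + 0) (n * + 0) (n * + 1) (n * + 0) (n * + 1) ≡ n * (n * n)
      identity n = cube n
        where
        cube : ∀ n → n * + 1 * (n * + 1 * (n * + 1) - n * + 0 * (n * + 0)) - n * + 0 * (n * + 0 * (n * + 1) - n * + 0
            * (n * + 0)) + n * + 0 * (n * + 0 * (n * + 0) - n * + 1 * (n * + 0)) ≡ n * (n * n)
        cube = solve-∀
      subst-all : ∀ {p q r s t u} → p ≡ n * + 1 → q ≡ n * + 0 → r ≡ n * + 0 → s ≡ n * + 1 → t ≡ n * + 0 → u ≡ n * + 1
          → gramDet p q r s t u ≡ n * (n * n)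
      subst-all refl refl refl refl refl refl = identity n
  w≡0 : ∀ r → w r ≡ + 0
  w≡0 r = [ (λ e → ⊥-elim (det≢0 e)) , (λ e → e) ]′ (ℤ.i*j≡0⇒i≡0∨j≡0 (det x) (cramer x w x·w≡0 r))
  g·w≡0 : n * dot g g - (b 0F * b 0F + (b 1F * b 1F + b 2F * b 2F)) ≡ + 0
  g·w≡0 = trans (cong₂ (λ s t → n * dot g g - (b 0F * s + t)) (dot-comm (x 0F) g) (cong₂ (λ s t → b 1F * s + b 2F *
      t) (dot-comm (x 1F) g) (dot-comm (x 2F) g)))
    (trans (sym (y·w g)) (zeros (w≡0 0F) (w≡0 1F) (w≡0 2F)))
    where
    zeros : ∀ {p q r} → p ≡ + 0 → q ≡ + 0 → r ≡ + 0 → g 0F * p + (g 1F * q + g 2F * r) ≡ + 0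
    zeros refl refl refl = identity (g 0F) (g 1F) (g 2F)
      where
      identity : ∀ a b c → a * + 0 + (b * + 0 + c * + 0) ≡ + 0
      identity = solve-∀
  split : ∀ n G a b c → n * G ≡ n * G - (a * a + (b * b + c * c)) + (a * a + (b * b + c * c))
  split = solve-∀

-- Valuation of a family of integers at 2

≢0⇒halved : ∀ {x} q → x ≡ + 2 * q → x ≢ + 0 → q ≢ + 0
≢0⇒halved q e x≢0 refl = x≢0 e

∣half∣<∣∣ : ∀ {x} q → x ≡ + 2 * q → x ≢ + 0 → ∣ q ∣ < ∣ x ∣
∣half∣<∣∣ {x} q e x≢0 = subst (∣ q ∣ <_) (sym (trans (cong ∣_∣ e) (ℤ.abs-* (+ 2) q)))
  (ℕ.m<m+n ∣ q ∣ (subst (0 <_) (sym (ℕ.+-identityʳ ∣ q ∣)) (ℕ.n≢0⇒n>0 (λ z → ≢0⇒halved q e x≢0 (ℤ.∣i∣≡0⇒i≡0 z)))))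

-- As long as all entries are even, halving them decreases the absolute value of the given nonzero
-- entry, so the recursion ends.
valuation : ∀ {m n} (z : Fin m → Fin n → ℤ) i j → z i j ≢ + 0 → Acc _<_ ∣ z i j ∣ →
  ∃[ e ] Σ (Fin m → Fin n → ℤ) λ w → (∀ i j → z i j ≡ + (2 ℕ.^ e) * w i j) × ∃ λ i → ∃ λ j → par (w i j) ≡ true
valuation {m} {n} z i j z≢0 (acc rec) = decide (Fin.any? λ i → Fin.any? λ j → par (z i j) Bool.≟ true)
  where
  decide : Dec (∃ λ i → ∃ λ j → par (z i j) ≡ true) →
    ∃[ e ] Σ (Fin m → Fin n → ℤ) λ w → (∀ i j → z i j ≡ + (2 ℕ.^ e) * w i j) × ∃ λ i → ∃ λ j → par (w i j) ≡ true
  decide (yes odd) = 0 , z , (λ i j → sym (ℤ.*-identityˡ (z i j))) , odd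
  decide (no even) = double (valuation q i j (≢0⇒halved (q i j) (z≡ i j) z≢0) (rec (∣half∣<∣∣ (q i j) (z≡ i j) z≢0)))
    where
    2∣z : ∀ i j → + 2 ∣ z i j
    2∣z i j = par⇒even {z i j} (Bool-≢ (λ o → even (i , j , o)))
    q : Fin m → Fin n → ℤ
    q i j = quotient (2∣z i j)
    z≡ : ∀ i j → z i j ≡ + 2 * q i j
    z≡ i j = trans (_∣_.equality (2∣z i j)) (ℤ.*-comm (q i j) (+ 2))
    double : (∃[ e ] Σ (Fin m → Fin n → ℤ) λ w → (∀ i j → q i j ≡ + (2 ℕ.^ e) * w i j) × ∃ λ i → ∃ λ j → par (w i j)
        ≡ true) →
      ∃[ e ] Σ (Fin m → Fin n → ℤ) λ w → (∀ i j → z i j ≡ + (2 ℕ.^ e) * w i j) × ∃ λ i → ∃ λ j → par (w i j) ≡ true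
    double (e , w , q≡ , odd) = suc e , w , (λ i j → trans (z≡ i j) (trans (cong (+ 2 *_) (q≡ i j))
      (trans (sym (ℤ.*-assoc (+ 2) (+ (2 ℕ.^ e)) (w i j))) (cong (_* w i j) (sym (ℤ.pos-* 2 (2 ℕ.^ e))))))) , odd

-- Classification of frames modulo 2

xor-false : ∀ a b → not (a xor b) ≡ true → a ≡ b
xor-false false false _ = refl
xor-false true  true  _ = refl

par-bit : ∀ b x → par (bit b * x) ≡ b ∧ par x
par-bit false x = par-* (+ 0) x
par-bit true  x = par-* (+ 1) x

module Classify (p : ℕ) (h : ℤ) (p-odd : + p ≡ + 2 * h + + 1) (p≢0 : + p ≢ + 0) {k} (v : Fin k → Vect 3) (a : Vect 3)
    where

  open Solve p h p-odd p≢0 v a public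

  bitsOf : (Fin 3 → Vect 6) → Fin 3 → Bits
  bitsOf f = triples (bits (f 0F)) (bits (f 1F)) (bits (f 2F))

  lookup-bits : ∀ f c r → lookup (bitsOf f c) r ≡ par (f c r)
  lookup-bits f 0F r = lookup∘tabulate (λ r → par (f 0F r)) r
  lookup-bits f 1F r = lookup∘tabulate (λ r → par (f 1F r)) r
  lookup-bits f 2F r = lookup∘tabulate (λ r → par (f 2F r)) r

  classify : ∀ {f} → Frame N f → ∀ P → Exhaustive.exhaustive P ≡ true → P (bitsOf f) ≡ true
  classify {f} F P e = Exhaustive.exhaustive-sound P e (bits (f 0F)) (bits (f 1F)) (bits (f 2F))
      (unit 0F refl) (unit 1F refl) (unit 2F refl) (ortho 0F 1F refl) (ortho 0F 2F refl) (ortho 1F 2F refl)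
    where
    square : ∀ h → (+ 2 * h + + 1) * (+ 2 * h + + 1) * + 1 ≡ + 4 * (h * h + h) + + 1
    square = solve-∀
    unit : ∀ c → δ c c ≡ + 1 → unitNorm (bits (f c)) ≡ true
    unit c e = unitNorm-bits (f c) (h * h + h) (trans (orth F c c) (trans (cong (N *_) e) (trans (cong (λ P → P * P *
        + 1) p-odd) (square h))))
    ortho : ∀ c d → δ c d ≡ + 0 → orthogonal (bits (f c)) (bits (f d)) ≡ true
    ortho c d e = orthogonal-bits (f c) (f d) (trans (orth F c d) (trans (cong (N *_) e) (ℤ.*-zeroʳ N)))

  solve-solvable : ∀ {f} → Frame N f → solvable (bitsOf f) ≡ true → Goal
  solve-solvable {f} F e = found (some-sound (λ π → evenTriple (bitsOf f) π ∨ quadruple (bitsOf f) π) permutations e)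
    where
    found : (∃[ n ] (evenTriple (bitsOf f) (lookup permutations n) ∨ quadruple (bitsOf f) (lookup permutations n)) ≡
        true) → Goal
    found (n , e) = [ triple , quad ]′ (∨-true (evenTriple (bitsOf f) π) e)
      where
      π = lookup permutations n
      f′ = permuted n f
      F′ : Frame N f′
      F′ = permute-frame n {f} F
      at≡ : ∀ c r → lookup (bitsOf f c) (lookup π r) ≡ par (f′ c r)
      at≡ c r = lookup-bits f c (lookup π r)
      triple : evenTriple (bitsOf f) π ≡ true → Goal
      triple t = solve-even {f′} F′ λ c → par⇒even {f′ c 2F + f′ c 3F + f′ c 4F}
        (trans (par-+ (f′ c 2F + f′ c 3F) (f′ c 4F)) (trans (cong (_xor par (f′ c 4F)) (par-+ (f′ c 2F) (f′ c 3F)))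
          (trans (sym (cong₂ _xor_ (cong₂ _xor_ (at≡ c 2F) (at≡ c 3F)) (at≡ c 4F)))
            (not-true (every-sound (λ c → not ((lookup (bitsOf f c) (lookup π 2F) xor lookup (bitsOf f c) (lookup π
                3F)) xor lookup (bitsOf f c) (lookup π 4F))) t c)))))
      quad : quadruple (bitsOf f) π ≡ true → Goal
      quad t = withFlips (someBits-sound 4 (same (bitsOf f) π μ) (allBits-sound 3 (λ μ → someBits 4 (same (bitsOf f)
          π μ)) (proj₂ both) μ))
        where
        fourSum : Fin 3 → Bool
        fourSum c = not (((lookup (bitsOf f c) (lookup π 1F) xor lookup (bitsOf f c) (lookup π 2F)) xor lookup
            (bitsOf f c) (lookup π 3F)) xor lookup (bitsOf f c) (lookup π 4F))
        both = ∧-true (every fourSum) t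
        2∣total : ∀ c → + 2 ∣ total (f′ c)
        2∣total c = par⇒even {total (f′ c)} (trans (par-+ (f′ c 1F + f′ c 2F + f′ c 3F) (f′ c 4F))
          (trans (cong (_xor par (f′ c 4F)) (trans (par-+ (f′ c 1F + f′ c 2F) (f′ c 3F)) (cong (_xor par (f′ c 3F))
              (par-+ (f′ c 1F) (f′ c 2F)))))
            (trans (sym (cong₂ _xor_ (cong₂ _xor_ (cong₂ _xor_ (at≡ c 1F) (at≡ c 2F)) (at≡ c 3F)) (at≡ c 4F)))
                (not-true (every-sound fourSum (proj₁ both) c)))))
        m : Fin 3 → ℤ
        m c = quotient (2∣total c)
        -- The parities of the half totals are not visible in the bits of f; `quadruple` supplies
        -- sign changes for whichever occur.
        μ : Vec Bool 3
        μ = tabulate (λ c → par (m c))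
        withFlips : (∃[ ε ] same (bitsOf f) π μ ε ≡ true) → Goal
        withFlips (ε@(ε₁ ∷ ε₂ ∷ ε₃ ∷ ε₄ ∷ []) , s) =
          solve-hadamard {signs σ f′} (resign {N} {f′} (lookup σ) (B-resign (lookup σ) σ²) F′) 4∣total
          where
          sgn : Bool → ℤ
          sgn b = if b then ℤ.-1ℤ else + 1
          sgn≡ : ∀ b → sgn b ≡ + 1 - + 2 * bit b
          sgn≡ false = refl
          sgn≡ true  = refl
          sgn² : ∀ b → sgn b * sgn b ≡ + 1
          sgn² false = refl
          sgn² true  = refl
          σ : Vec ℤ 6
          σ = + 1 ∷ sgn ε₁ ∷ sgn ε₂ ∷ sgn ε₃ ∷ sgn ε₄ ∷ + 1 ∷ []
          σ² : ∀ r → lookup σ r * lookup σ r ≡ + 1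
          σ² 0F = refl
          σ² 1F = sgn² ε₁
          σ² 2F = sgn² ε₂
          σ² 3F = sgn² ε₃
          σ² 4F = sgn² ε₄
          σ² 5F = refl
          flips : Fin 3 → ℤ
          flips c = bit ε₁ * f′ c 1F + bit ε₂ * f′ c 2F + bit ε₃ * f′ c 3F + bit ε₄ * f′ c 4F
          par-flips : ∀ c → par (flips c) ≡ flipParity (bitsOf f) π ε c
          par-flips c = trans (par-+ (bit ε₁ * f′ c 1F + bit ε₂ * f′ c 2F + bit ε₃ * f′ c 3F) (bit ε₄ * f′ c 4F))
            (cong₂ _xor_ (trans (par-+ (bit ε₁ * f′ c 1F + bit ε₂ * f′ c 2F) (bit ε₃ * f′ c 3F))
              (cong₂ _xor_ (trans (par-+ (bit ε₁ * f′ c 1F) (bit ε₂ * f′ c 2F)) (cong₂ _xor_ (each ε₁ 1F) (each ε₂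
                  2F))) (each ε₃ 3F))) (each ε₄ 4F))
            where
            each : ∀ b r → par (bit b * f′ c r) ≡ b ∧ lookup (bitsOf f c) (lookup π r)
            each b r = trans (par-bit b (f′ c r)) (cong (b ∧_) (sym (at≡ c r)))
          agree : ∀ c → par (m c) ≡ par (flips c)
          agree c = trans (sym (lookup∘tabulate (λ c → par (m c)) c)) (trans (xor-false (lookup μ c) (flipParity
              (bitsOf f) π ε c)
            (every-sound (λ c → not (lookup μ c xor flipParity (bitsOf f) π ε c)) s c)) (sym (par-flips c)))
          2∣m-flips : ∀ c → + 2 ∣ m c - flips c
          2∣m-flips c = par⇒even {m c - flips c} (trans (par-+ (m c) (- flips c)) (trans (cong (par (m c) xor_)
              (par-neg (flips c)))
            (trans (cong (_xor par (flips c)) (agree c)) (Bool.xor-same (par (flips c))))))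
          4∣total : ∀ c → + 4 ∣ total (signs σ f′ c)
          4∣total c = divide (2∣m-flips c)
            where
            expand : ∀ x y z w a b c d → (+ 1 - + 2 * a) * x + (+ 1 - + 2 * b) * y + (+ 1 - + 2 * c) * z + (+ 1 - + 2
                * d) * w ≡
              x + y + z + w - + 2 * (a * x + b * y + c * z + d * w)
            expand = solve-∀
            divide : + 2 ∣ m c - flips c → + 4 ∣ total (signs σ f′ c)
            divide (divides q e) = divides q (trans (cong₂ _+_ (cong₂ _+_ (cong₂ _+_ (cong (_* f′ c 1F) (sgn≡ ε₁))
                (cong (_* f′ c 2F) (sgn≡ ε₂)))
                (cong (_* f′ c 3F) (sgn≡ ε₃))) (cong (_* f′ c 4F) (sgn≡ ε₄)))
              (trans (expand (f′ c 1F) (f′ c 2F) (f′ c 3F) (f′ c 4F) (bit ε₁) (bit ε₂) (bit ε₃) (bit ε₄))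
              (trans (cong (λ t → t - + 2 * flips c) (_∣_.equality (2∣total c)))
              (trans (factor (m c) (flips c)) (trans (cong (+ 2 *_) e) (collect q))))))
              where
              factor : ∀ m x → m * + 2 - + 2 * x ≡ + 2 * (m - x)
              factor = solve-∀
              collect : ∀ q → + 2 * (q * + 2) ≡ q * + 4
              collect = solve-∀

  Columns : (Fin 3 → Vect 6) → Set
  Columns f = (par (f 0F 2F) ∨ (par (f 1F 2F) ∨ par (f 2F 2F))) ∧ ((par (f 0F 3F) ∨ (par (f 1F 3F) ∨ par (f 2F 3F))) ∧
    (par (f 0F 4F) ∨ (par (f 1F 4F) ∨ par (f 2F 4F)))) ≡ true

  -- The component in I₂ ⊥ ⟨3⟩. The Eisenstein rotations act on the coordinates 0F and 5F, and 0F
  -- and 1F may be exchanged.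
  record Tail (m : ℤ) (f : Fin 3 → Vect 6) (x y z : Fin 3 → ℤ) : Set where
    field
      f₀≡ : ∀ c → f c 0F ≡ m * x c
      f₁≡ : ∀ c → f c 1F ≡ m * y c
      f₅≡ : ∀ c → f c 5F ≡ m * z c
  open Tail

  Odd : (x y z : Fin 3 → ℤ) → Set
  Odd x y z = ∃ λ c → par (x c) ≡ true ⊎ par (y c) ≡ true ⊎ par (z c) ≡ true

  solve-odd-tail : ∀ {f x y z} → Frame N f → Columns f → Tail (+ 1) f x y z → Odd x y z → Goal
  solve-odd-tail {f} {x} {y} {z} F cols T (c , odd) = [ (λ e → ⊥-elim (true≢false (trans (sym cols′) (not-true e))))
      , tailOrSolve ]′
      (∨-true (not (nonzeroColumns (bitsOf f) ident)) (classify F (λ β → not (nonzeroColumns β ident) ∨ (evenTail β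
          ident ∨ solvable β)) oddTail))
    where
    ident = lookup permutations 0F
    column≡ : ∀ r → lookup (bitsOf f 0F) r ∨ (lookup (bitsOf f 1F) r ∨ lookup (bitsOf f 2F) r) ≡ par (f 0F r) ∨ (par
        (f 1F r) ∨ par (f 2F r))
    column≡ r = cong₂ _∨_ (lookup-bits f 0F r) (cong₂ _∨_ (lookup-bits f 1F r) (lookup-bits f 2F r))
    cols′ : nonzeroColumns (bitsOf f) ident ≡ true
    cols′ = trans (cong₂ _∧_ (column≡ 2F) (cong₂ _∧_ (column≡ 3F) (column≡ 4F))) cols
    tailOrSolve : evenTail (bitsOf f) ident ∨ solvable (bitsOf f) ≡ true → Goal
    tailOrSolve e = [ (λ t → ⊥-elim (true≢false (contradict t))) , solve-solvable F ]′ (∨-true (evenTail (bitsOf f)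
        ident) e)
      where
      contradict : evenTail (bitsOf f) ident ≡ true → true ≡ false
      contradict t = clash odd
        where
        bitFalse = every-sound (λ c → not (lookup (bitsOf f c) 0F) ∧ (not (lookup (bitsOf f c) 1F) ∧ not (lookup
            (bitsOf f c) 5F))) t c
        b₀ = ∧-true (not (lookup (bitsOf f c) 0F)) bitFalse
        b₁ = ∧-true (not (lookup (bitsOf f c) 1F)) (proj₂ b₀)
        absurd : ∀ {r w} → f c r ≡ + 1 * w → not (lookup (bitsOf f c) r) ≡ true → par w ≡ true → true ≡ false
        absurd {r} {w} e n o = trans (sym o) (trans (cong par (trans (sym (ℤ.*-identityˡ w)) (sym e))) (trans (sym
            (lookup-bits f c r)) (not-true n)))
        clash : par (x c) ≡ true ⊎ par (y c) ≡ true ⊎ par (z c) ≡ true → true ≡ false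
        clash (inj₁ o)        = absurd {0F} {x c} (f₀≡ T c) (proj₁ b₀) o
        clash (inj₂ (inj₁ o)) = absurd {1F} {y c} (f₁≡ T c) (proj₁ b₁) o
        clash (inj₂ (inj₂ o)) = absurd {5F} {z c} (f₅≡ T c) (proj₂ b₁) o

-- Lowering the power of 2 in the tail

module Loop (p : ℕ) (h : ℤ) (p-odd : + p ≡ + 2 * h + + 1) (p≢0 : + p ≢ + 0) {k} (v : Fin k → Vect 3) (a : Vect 3) where

  open Classify p h p-odd p≢0 v a public
  open Tail

  Step : ℤ → Set
  Step m = ∀ {f x y z} → Frame N f → Columns f → Tail m f x y z → Odd x y z → Goal

  swap : ∀ {m f x y z} → Tail m f x y z → Tail m (permuted (Fin.fromℕ 11) f) y x z
  swap T = record { f₀≡ = f₁≡ T ; f₁≡ = f₀≡ T ; f₅≡ = f₅≡ T }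

  rotated : ℤ → (Fin 3 → Vect 6) → (x z : Fin 3 → ℤ) → Fin 3 → Vect 6
  rotated m f x z c = lookup (m * (x c + + 3 * z c) ∷ f c 1F ∷ f c 2F ∷ f c 3F ∷ f c 4F ∷ m * (x c - z c) ∷ [])

  rotated-moved : ∀ {m f x y z} → Tail (+ 2 * m) f x y z → Moved hexagonal f (rotated m f x z)
  rotated-moved {m} {f} {x} {y} {z} T c 0F = trans (apply-hexagonal (f c) 0F) (trans (cong₂ (λ s t → s + + 3 * t)
      (f₀≡ T c) (f₅≡ T c)) (identity m (x c) (z c)))
    where
    identity : ∀ m x z → + 2 * m * x + + 3 * (+ 2 * m * z) ≡ + 2 * (m * (x + + 3 * z))
    identity = solve-∀
  rotated-moved {m} {f} T c 1F = apply-hexagonal (f c) 1F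
  rotated-moved {m} {f} T c 2F = apply-hexagonal (f c) 2F
  rotated-moved {m} {f} T c 3F = apply-hexagonal (f c) 3F
  rotated-moved {m} {f} T c 4F = apply-hexagonal (f c) 4F
  rotated-moved {m} {f} {x} {y} {z} T c 5F = trans (apply-hexagonal (f c) 5F) (trans (cong₂ _-_ (f₀≡ T c) (f₅≡ T c))
      (identity m (x c) (z c)))
    where
    identity : ∀ m x z → + 2 * m * x - + 2 * m * z ≡ + 2 * (m * (x - z))
    identity = solve-∀

  rotate-frame : ∀ {m f x y z} → Tail (+ 2 * m) f x y z → Frame N f → Frame N (rotated m f x z)
  rotate-frame {m} {f} {x} {y} {z} T F = move {hexagonal} {N} {f} {rotated m f x z} hexagonal-similarity
      (rotated-moved {m} {f} {x} {y} {z} T) F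

  rotate-tail : ∀ {m f x y z} → Tail (+ 2 * m) f x y z →
    Tail m (rotated m f x z) (λ c → x c + + 3 * z c) (λ c → + 2 * y c) (λ c → x c - z c)
  rotate-tail {m} {f} {x} {y} {z} T = record { f₀≡ = λ c → refl ; f₁≡ = λ c → trans (f₁≡ T c) (assoc m (y c)) ; f₅≡ =
      λ c → refl }
    where
    assoc : ∀ m y → + 2 * m * y ≡ m * (+ 2 * y)
    assoc = solve-∀

  -- The rotation takes 2m·(x, y, z) to m·(x + 3z, 2y, x - z), and x + 3z is odd at c.
  step₀ : ∀ {m} → Step m → ∀ {f x y z} → Frame N f → Columns f → Tail (+ 2 * m) f x y z → ∀ c → par (x c) xor par (z
      c) ≡ true → Goal
  step₀ {m} ih {f} {x} {y} {z} F cols T c odd =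
    ih {rotated m f x z} (rotate-frame {m} {f} {x} {y} {z} T F) cols (rotate-tail {m} {f} {x} {y} {z} T)
      (c , inj₁ (trans (par-+ (x c) (+ 3 * z c)) (trans (cong (par (x c) xor_) (par-* (+ 3) (z c))) odd)))

  -- The coordinates 0F and 1F both have weight 1, so y can take the place of x in the rotation.
  step₁ : ∀ {m} → Step m → ∀ {f x y z} → Frame N f → Columns f → Tail (+ 2 * m) f x y z → ∀ c → par (y c) xor par (z
      c) ≡ true → Goal
  step₁ {m} ih {f} {x} {y} {z} F cols T c odd =
    step₀ {m} ih {permuted (Fin.fromℕ 11) f} {y} {x} {z} (permute-frame (Fin.fromℕ 11) {f} F) cols (swap {+ 2 * m}
        {f} {x} {y} {z} T) c odd

  -- When x, y, z agree modulo 2, rotate (x, z) by either sixth root of unity: the two results for z differ by z.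
  step₂ : ∀ {m} → Step m → ∀ {f x y z} → Frame N f → Columns f → Tail (+ 2 * m) f x y z →
    (∀ c → par (x c) xor par (z c) ≡ false) → ∀ c → par (z c) ≡ true → Goal
  step₂ {m} ih {f} {x} {y} {z} F cols T agree c odd = choose (par (y c) xor par (z′ c)) refl
    where
    2∣ : ∀ c → + 2 ∣ x c - z c
    2∣ c = par⇒even {x c - z c} (trans (par-+ (x c) (- z c)) (trans (cong (par (x c) xor_) (par-neg (z c))) (agree c)))
    z′ : Fin 3 → ℤ
    z′ c = quotient (2∣ c)
    x≡ : ∀ c → x c ≡ + 2 * z′ c + z c
    x≡ c = trans (isolate (x c) (z c)) (trans (cong (λ t → t + z c) (_∣_.equality (2∣ c))) (cong (λ t → t + z c)
        (ℤ.*-comm (z′ c) (+ 2))))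
      where
      isolate : ∀ x z → x ≡ x - z + z
      isolate = solve-∀
    σ : Vec ℤ 6
    σ = + 1 ∷ + 1 ∷ + 1 ∷ + 1 ∷ + 1 ∷ ℤ.-1ℤ ∷ []
    σ² : ∀ r → lookup σ r * lookup σ r ≡ + 1
    σ² = from-yes (Fin.all? λ r → lookup σ r * lookup σ r ℤ.≟ + 1)
    turned : (Fin 3 → Vect 6) → (x z : Fin 3 → ℤ) → Fin 3 → Vect 6
    turned f x z c = lookup (+ 2 * m * x c ∷ f c 1F ∷ f c 2F ∷ f c 3F ∷ f c 4F ∷ + 2 * m * z c ∷ [])
    -- When x + 3z and x - z are even, the rotation keeps the factor 2m instead of lowering it.
    turn : ∀ f (x z x₁ z₁ : Fin 3 → ℤ) → (∀ c → f c 0F ≡ + 2 * m * x c) → (∀ c → f c 5F ≡ + 2 * m * z c) →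
      (∀ c → x c + + 3 * z c ≡ + 2 * x₁ c) → (∀ c → x c - z c ≡ + 2 * z₁ c) → Frame N f → Frame N (turned f x₁ z₁)
    turn f x z x₁ z₁ f₀ f₅ ex ez F = move {hexagonal} {N} {f} {turned f x₁ z₁} hexagonal-similarity moved F
      where
      moved : Moved hexagonal f (turned f x₁ z₁)
      moved c 0F = trans (apply-hexagonal (f c) 0F) (trans (cong₂ (λ s t → s + + 3 * t) (f₀ c) (f₅ c))
        (trans (factor (+ 2 * m) (x c) (z c)) (trans (cong (+ 2 * m *_) (ex c)) (commute (+ 2 * m) (x₁ c)))))
        where
        factor : ∀ m x z → m * x + + 3 * (m * z) ≡ m * (x + + 3 * z)
        factor = solve-∀
        commute : ∀ m x → m * (+ 2 * x) ≡ + 2 * (m * x)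
        commute = solve-∀
      moved c 1F = apply-hexagonal (f c) 1F
      moved c 2F = apply-hexagonal (f c) 2F
      moved c 3F = apply-hexagonal (f c) 3F
      moved c 4F = apply-hexagonal (f c) 4F
      moved c 5F = trans (apply-hexagonal (f c) 5F) (trans (cong₂ _-_ (f₀ c) (f₅ c))
        (trans (factor (+ 2 * m) (x c) (z c)) (trans (cong (+ 2 * m *_) (ez c)) (commute (+ 2 * m) (z₁ c)))))
        where
        factor : ∀ m x z → m * x - m * z ≡ m * (x - z)
        factor = solve-∀
        commute : ∀ m x → m * (+ 2 * x) ≡ + 2 * (m * x)
        commute = solve-∀
    choose : ∀ b → par (y c) xor par (z′ c) ≡ b → Goal
    choose true e = step₁ {m} ih {turned f x₁ z′} {x₁} {y} {z′}
        (turn f x z x₁ z′ (f₀≡ T) (f₅≡ T) (λ c → trans (cong (λ t → t + + 3 * z c) (x≡ c)) (ex (z′ c) (z c)))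
          (λ c → trans (cong (λ t → t - z c) (x≡ c)) (ez (z′ c) (z c))) F)
        cols (record { f₀≡ = λ c → refl ; f₁≡ = f₁≡ T ; f₅≡ = λ c → refl }) c e
      where
      x₁ : Fin 3 → ℤ
      x₁ c = z′ c + + 2 * z c
      ex : ∀ t z → + 2 * t + z + + 3 * z ≡ + 2 * (t + + 2 * z)
      ex = solve-∀
      ez : ∀ t z → + 2 * t + z - z ≡ + 2 * t
      ez = solve-∀
    choose false e = step₁ {m} ih {turned (signs σ f) x₁ z₁} {x₁} {λ c → + 1 * y c} {z₁}
        (turn (signs σ f) x (λ c → - z c) x₁ z₁ (λ c → trans (ℤ.*-identityˡ (f c 0F)) (f₀≡ T c)) (λ c → trans (cong
            (ℤ.-1ℤ *_) (f₅≡ T c)) (negate (+ 2 * m) (z c)))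
          (λ c → trans (cong (λ t → t + + 3 * - z c) (x≡ c)) (ex (z′ c) (z c)))
          (λ c → trans (cong (λ t → t - - z c) (x≡ c)) (ez (z′ c) (z c)))
          (resign {N} {f} (lookup σ) (B-resign (lookup σ) σ²) F))
        cols′ (record { f₀≡ = λ c → refl ; f₁≡ = λ c → trans (ℤ.*-identityˡ (f c 1F)) (trans (f₁≡ T c) (cong (+ 2 * m
            *_) (sym (ℤ.*-identityˡ (y c))))) ; f₅≡ = λ c → refl }) c
        (trans (cong₂ _xor_ (cong par (ℤ.*-identityˡ (y c))) (par-+ (z′ c) (z c))) (toggle (par (y c)) (par (z′ c))
            (par (z c)) e odd))
      where
      x₁ : Fin 3 → ℤ
      x₁ c = z′ c - z c
      z₁ : Fin 3 → ℤ
      z₁ c = z′ c + z c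
      ex : ∀ t z → + 2 * t + z + + 3 * - z ≡ + 2 * (t - z)
      ex = solve-∀
      ez : ∀ t z → + 2 * t + z - - z ≡ + 2 * (t + z)
      ez = solve-∀
      negate : ∀ m z → ℤ.-1ℤ * (m * z) ≡ m * - z
      negate = solve-∀
      toggle : ∀ a b c → a xor b ≡ false → c ≡ true → a xor (b xor c) ≡ true
      toggle false false true _ _ = refl
      toggle true  true  true _ _ = refl
      par-1 : ∀ c r → par (+ 1 * f c r) ≡ par (f c r)
      par-1 c r = cong par (ℤ.*-identityˡ (f c r))
      column : ∀ r → par (+ 1 * f 0F r) ∨ (par (+ 1 * f 1F r) ∨ par (+ 1 * f 2F r)) ≡ par (f 0F r) ∨ (par (f 1F r) ∨
          par (f 2F r))
      column r = cong₂ _∨_ (par-1 0F r) (cong₂ _∨_ (par-1 1F r) (par-1 2F r))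
      cols′ : Columns (turned (signs σ f) x₁ z₁)
      cols′ = trans (cong₂ _∧_ (column 2F) (cong₂ _∧_ (column 3F) (column 4F))) cols

  lower : ∀ {m} → Step m → Step (+ 2 * m)
  lower {m} ih {f} {x} {y} {z} F cols T (c , odd) = first (Fin.any? λ c → (par (x c) xor par (z c)) Bool.≟ true)
    where
    first : Dec (∃ λ c → par (x c) xor par (z c) ≡ true) → Goal
    first (yes (d , e)) = step₀ {m} ih {f} {x} {y} {z} F cols T d e
    first (no ¬xz) = second (Fin.any? λ c → (par (y c) xor par (z c)) Bool.≟ true)
      where
      x~z : ∀ c → par (x c) xor par (z c) ≡ false
      x~z c = Bool-≢ (λ e → ¬xz (c , e))
      second : Dec (∃ λ c → par (y c) xor par (z c) ≡ true) → Goal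
      second (yes (d , e)) = step₁ {m} ih {f} {x} {y} {z} F cols T d e
      second (no ¬yz) = step₂ {m} ih {f} {x} {y} {z} F cols T x~z c
          ([ agree (par (x c)) (par (z c)) (x~z c) , [ agree (par (y c)) (par (z c)) y~z , (λ e → e) ]′ ]′ odd)
        where
        y~z : par (y c) xor par (z c) ≡ false
        y~z = Bool-≢ (λ e → ¬yz (c , e))
        agree : ∀ a b → a xor b ≡ false → a ≡ true → b ≡ true
        agree true true _ _ = refl

  loop : ∀ e → Step (+ (2 ℕ.^ e))
  loop zero    {f} {x} {y} {z} F cols T odd = solve-odd-tail {f} {x} {y} {z} F cols T odd
  loop (suc e) {f} {x} {y} {z} F cols T odd = lower {+ (2 ℕ.^ e)} (loop e) {f} {x} {y} {z} F cols
    (subst (λ m → Tail m f x y z) (ℤ.pos-* 2 (2 ℕ.^ e)) T) odd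

module OddIndex (p : ℕ) (h : ℤ) (p-odd : + p ≡ + 2 * h + + 1) (p≢0 : + p ≢ + 0) {k} (v : Fin k → Vect 3) (a : Vect 3)
    where

  open Loop p h p-odd p≢0 v a public

  N-odd : N ≡ + 2 * (+ 2 * (h * h + h)) + + 1
  N-odd = trans (cong (λ P → P * P) p-odd) (square h)
    where
    square : ∀ h → (+ 2 * h + + 1) * (+ 2 * h + + 1) ≡ + 2 * (+ 2 * (h * h + h)) + + 1
    square = solve-∀

  -- If all three vectors lie in the coordinates 2, 3, 4, they span ℚ³, so the dual vector g
  -- projects onto a/p², up to a power of 2: then N ∣ a·a.
  degenerate : ∀ {f} → Frame N f → Dual f → (∀ c → f c 0F ≡ + 0) → (∀ c → f c 1F ≡ + 0) → (∀ c → f c 5F ≡ + 0) → N ∣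
      dot a a
  degenerate {f} F (g , e , g·f) f₀ f₁ f₅ = odd-cancel-^ (+ 2 * (h * h + h)) N-odd e (odd-cancel-^ (+ 2 * (h * h +
      h)) N-odd e
      (divides (dot g′ g′) (trans (sym (trans (cong₂ _+_ (square 0F) (cong₂ _+_ (square 1F) (square 2F))) (factor t
          (a 0F) (a 1F) (a 2F))))
        (trans (sym (parseval N (*-nonZero p≢0 p≢0) x x-orth g′)) (ℤ.*-comm N (dot g′ g′))))))
    where
    t : ℤ
    t = + (2 ℕ.^ e)
    x : Fin 3 → Vect 3
    x c = lookup (f c 2F ∷ f c 3F ∷ f c 4F ∷ [])
    g′ : Vect 3
    g′ = lookup (g 2F ∷ g 3F ∷ g 4F ∷ [])
    restrict : ∀ y c → B J y (f c) ≡ y 2F * f c 2F + (y 3F * f c 3F + y 4F * f c 4F)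
    restrict y c = trans (J-form y (f c)) (trans (cong₂ (λ s t → y 0F * s + t) (f₀ c) (cong₂ (λ s t → y 1F * s + (y
        2F * f c 2F + (y 3F * f c 3F + (y 4F * f c 4F + + 3 * (y 5F * t))))) (f₁ c) (f₅ c)))
      (drop (y 0F) (y 1F) (y 2F * f c 2F) (y 3F * f c 3F) (y 4F * f c 4F) (y 5F)))
      where
      drop : ∀ a b c d e f → a * + 0 + (b * + 0 + (c + (d + (e + + 3 * (f * + 0))))) ≡ c + (d + e)
      drop = solve-∀
    x-orth : ∀ c d → dot (x c) (x d) ≡ N * δ c d
    x-orth c d = trans (sym (restrict (f c) d)) (orth F c d)
    square : ∀ c → dot (x c) g′ * dot (x c) g′ ≡ t * a c * (t * a c)
    square c = cong (λ s → s * s) (trans (dot-comm (x c) g′) (trans (sym (restrict g c)) (g·f c)))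
    factor : ∀ t a b c → t * a * (t * a) + (t * b * (t * b) + t * c * (t * c)) ≡ t * (t * (a * a + (b * b + c * c)))
    factor = solve-∀

  -- A tail that vanishes identically is excluded by `degenerate`. Any other tail contains only a
  -- finite power of 2, which bounds the number of rounds of the loop.
  solve-frame : ∀ {f} → Data N f → ¬ N ∣ dot a a → Goal
  solve-frame {f} (F , D) N∤a² = [ solve-solvable {f} F , tail ]′
      (∨-true (solvable (bitsOf f)) (classify {f} F (λ β → solvable β ∨ some (λ π → evenTail β π ∧ nonzeroColumns β
          π) permutations) trichotomy))
    where
    tail : some (λ π → evenTail (bitsOf f) π ∧ nonzeroColumns (bitsOf f) π) permutations ≡ true → Goal
    tail s = found (some-sound (λ π → evenTail (bitsOf f) π ∧ nonzeroColumns (bitsOf f) π) permutations s)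
      where
      found : (∃[ n ] (evenTail (bitsOf f) (lookup permutations n) ∧ nonzeroColumns (bitsOf f) (lookup permutations
          n)) ≡ true) → Goal
      found (n , e) = decide (Fin.any? λ c → Fin.any? λ s → nonzero? (z c s))
        where
        π = lookup permutations n
        f′ = permuted n f
        column≡ : ∀ r → lookup (bitsOf f 0F) (lookup π r) ∨ (lookup (bitsOf f 1F) (lookup π r) ∨ lookup (bitsOf f 2F)
            (lookup π r)) ≡
          par (f′ 0F r) ∨ (par (f′ 1F r) ∨ par (f′ 2F r))
        column≡ r = cong₂ _∨_ (lookup-bits f 0F (lookup π r)) (cong₂ _∨_ (lookup-bits f 1F (lookup π r)) (lookup-bits
            f 2F (lookup π r)))
        cols : Columns f′
        cols = trans (sym (cong₂ _∧_ (column≡ 2F) (cong₂ _∧_ (column≡ 3F) (column≡ 4F)))) (proj₂ (∧-true (evenTail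
            (bitsOf f) π) e))
        z : Fin 3 → Fin 3 → ℤ
        z c 0F = f′ c 0F
        z c 1F = f′ c 1F
        z c 2F = f′ c 5F
        decide : Dec (∃ λ c → ∃ λ s → z c s ≢ + 0) → Goal
        decide (no allZero) = ⊥-elim (N∤a² (degenerate {f′} (permute-frame n {f} F) (permute-dual n {f} D) (zero′ 0F)
            (zero′ 1F) (zero′ 2F)))
          where
          zero′ : ∀ s c → z c s ≡ + 0
          zero′ s c = ¬nonzero (λ t≢0 → allZero (c , s , t≢0))
        decide (yes (c , s , z≢0)) = start (valuation z c s z≢0 (<-wellFounded ∣ z c s ∣))
          where
          start : (∃[ e ] Σ (Fin 3 → Fin 3 → ℤ) λ w → (∀ c s → z c s ≡ + (2 ℕ.^ e) * w c s) × ∃ λ c → ∃ λ s → par (w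
              c s) ≡ true) → Goal
          start (e , w , z≡ , c , s , odd) = loop e {f′} {λ c → w c 0F} {λ c → w c 1F} {λ c → w c 2F} (permute-frame
              n {f} F) cols
              (record { f₀≡ = λ c → z≡ c 0F ; f₁≡ = λ c → z≡ c 1F ; f₅≡ = λ c → z≡ c 2F }) (c , which s odd)
            where
            which : ∀ s → par (w c s) ≡ true → par (w c 0F) ≡ true ⊎ par (w c 1F) ≡ true ⊎ par (w c 2F) ≡ true
            which 0F o = inj₁ o
            which 1F o = inj₂ (inj₁ o)
            which 2F o = inj₂ (inj₂ o)

-- Sums of two squares modulo an odd prime

euclid : ∀ {p} → Prime p → ∀ x y → + p ∣ x * y → (+ p ∣ x) ⊎ (+ p ∣ y)
euclid pr x y d with euclidsLemma ∣ x ∣ ∣ y ∣ pr (subst (_ ℕ∣.∣_) (ℤ.abs-* x y) (∣⇒∣ᵤ d))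
... | inj₁ e = inj₁ (∣ᵤ⇒∣ e)
... | inj₂ e = inj₂ (∣ᵤ⇒∣ e)

≡%⇒∣ : ∀ p .{{_ : ℕ.NonZero p}} x y → x ℤ.%ℕ p ≡ y ℤ.%ℕ p → + p ∣ x - y
≡%⇒∣ p x y e = divides (x ℤ./ℕ p - y ℤ./ℕ p) (trans (cong₂ _-_ (ℤ.a≡a%ℕn+[a/ℕn]*n x p) (ℤ.a≡a%ℕn+[a/ℕn]*n y p))
  (trans (cong (λ r → + (x ℤ.%ℕ p) + x ℤ./ℕ p * + p - (+ r + y ℤ./ℕ p * + p)) (sym e)) (cancel (+ (x ℤ.%ℕ p)) (x ℤ./ℕ
      p) (y ℤ./ℕ p) (+ p))))
  where
  cancel : ∀ r q q′ p → r + q * p - (r + q′ * p) ≡ (q - q′) * p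
  cancel = solve-∀

small-∣ : ∀ {p n} → n < p → p ℕ∣.∣ n → n ≡ 0
small-∣ {p} {zero}  n<p d = refl
small-∣ {p} {suc n} n<p d = ⊥-elim (ℕ.<⇒≱ n<p (ℕ∣.∣⇒≤ d))

module TwoSquares (m : ℕ) (pr : Prime (1 ℕ.+ 2 ℕ.* m)) where

  p : ℕ
  p = 1 ℕ.+ 2 ℕ.* m

  squares-distinct : ∀ {a b} → a ℕ.≤ m → b ℕ.≤ m → + p ∣ + a * + a - + b * + b → a ≡ b
  squares-distinct {a} {b} a≤m b≤m d = [ difference , sum ]′ (euclid pr (+ a - + b) (+ a + + b) (subst (+ p ∣_)
      (factor (+ a) (+ b)) d))
    where
    factor : ∀ a b → a * a - b * b ≡ (a - b) * (a + b)
    factor = solve-∀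
    difference : + p ∣ + a - + b → a ≡ b
    difference d = ℤ.+-injective (ℤ.i-j≡0⇒i≡j (+ a) (+ b) (ℤ.∣i∣≡0⇒i≡0 (small-∣ small (∣⇒∣ᵤ d))))
      where
      small : ∣ + a - + b ∣ < p
      small = ℕ.s≤s (ℕ.≤-trans (subst (λ t → ∣ t ∣ ℕ.≤ a ℕ.⊔ b) (sym (ℤ.m-n≡m⊖n a b)) (ℤ.∣m⊝n∣≤m⊔n a b))
        (ℕ.≤-trans (ℕ.⊔-lub a≤m b≤m) (ℕ.m≤m+n m (m ℕ.+ 0))))
    sum : + p ∣ + a + + b → a ≡ b
    sum d = trans (ℕ.m+n≡0⇒m≡0 a zeroSum) (sym (ℕ.m+n≡0⇒n≡0 a zeroSum))
      where
      zeroSum : a ℕ.+ b ≡ 0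
      zeroSum = small-∣ (ℕ.s≤s (ℕ.≤-trans (ℕ.+-mono-≤ a≤m b≤m) (ℕ.≤-reflexive (cong (m ℕ.+_) (sym (ℕ.+-identityʳ
          m)))))) (∣⇒∣ᵤ d)

  -- The m + 1 values of k² and the m + 1 values of - c - l² cannot all be distinct modulo 2m + 1.
  two-squares : ∀ c → ∃[ k ] ∃[ l ] (+ p ∣ k * k + l * l + c)
  two-squares c = collide (Fin.pigeonhole p< (residue ∘ value ∘ Fin.splitAt (suc m)))
    where
    value : Fin (suc m) ⊎ Fin (suc m) → ℤ
    value (inj₁ a) = + Fin.toℕ a * + Fin.toℕ a
    value (inj₂ b) = - c - + Fin.toℕ b * + Fin.toℕ b
    residue : ℤ → Fin p
    residue x = Fin.fromℕ< (ℤ.n%ℕd<d x p)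
    p< : p < suc m ℕ.+ suc m
    p< = ℕ.≤-reflexive (double m)
      where
      double : ∀ m → suc (1 ℕ.+ 2 ℕ.* m) ≡ suc m ℕ.+ suc m
      double = solveℕ-∀
    residue-∣ : ∀ x y → residue x ≡ residue y → + p ∣ x - y
    residue-∣ x y e = ≡%⇒∣ p x y (trans (sym (Fin.toℕ-fromℕ< (ℤ.n%ℕd<d x p))) (trans (cong Fin.toℕ e) (Fin.toℕ-fromℕ<
        (ℤ.n%ℕd<d y p))))
    distinct : ∀ (a b : Fin (suc m)) → + p ∣ + Fin.toℕ a * + Fin.toℕ a - + Fin.toℕ b * + Fin.toℕ b → a ≡ b
    distinct a b d = Fin.toℕ-injective (squares-distinct (ℕ.≤-pred (Fin.toℕ<n a)) (ℕ.≤-pred (Fin.toℕ<n b)) d)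
    meet : ∀ s t → s ≢ t → + p ∣ value s - value t → ∃[ k ] ∃[ l ] (+ p ∣ k * k + l * l + c)
    meet (inj₁ a) (inj₁ b) s≢t d = ⊥-elim (s≢t (cong inj₁ (distinct a b d)))
    meet (inj₁ a) (inj₂ b) s≢t d = + Fin.toℕ a , + Fin.toℕ b , subst (+ p ∣_) (regroup (+ Fin.toℕ a) (+ Fin.toℕ b) c) d
      where
      regroup : ∀ a b c → a * a - (- c - b * b) ≡ a * a + b * b + c
      regroup = solve-∀
    meet (inj₂ a) (inj₁ b) s≢t d = + Fin.toℕ a , + Fin.toℕ b , subst (+ p ∣_) (regroup (+ Fin.toℕ a) (+ Fin.toℕ b) c)
        (∣m⇒∣-m d)
      where
      regroup : ∀ a b c → - ((- c - a * a) - b * b) ≡ a * a + b * b + c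
      regroup = solve-∀
    meet (inj₂ a) (inj₂ b) s≢t d = ⊥-elim (s≢t (cong inj₂ (sym (distinct b a (subst (+ p ∣_) (regroup (+ Fin.toℕ a)
        (+ Fin.toℕ b) c) d)))))
      where
      regroup : ∀ a b c → (- c - a * a) - (- c - b * b) ≡ b * b - a * a
      regroup = solve-∀
    collide : (∃[ i ] ∃[ j ] (i Fin.< j × residue (value (Fin.splitAt (suc m) i)) ≡ residue (value (Fin.splitAt (suc
        m) j)))) →
      ∃[ k ] ∃[ l ] (+ p ∣ k * k + l * l + c)
    collide (i , j , i<j , e) = meet (Fin.splitAt (suc m) i) (Fin.splitAt (suc m) j) s≢t
        (residue-∣ (value (Fin.splitAt (suc m) i)) (value (Fin.splitAt (suc m) j)) e)
      where
      s≢t : Fin.splitAt (suc m) i ≢ Fin.splitAt (suc m) j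
      s≢t e = Fin.<⇒≢ i<j (trans (sym (Fin.join-splitAt (suc m) (suc m) i)) (trans (cong (Fin.join (suc m) (suc m))
          e) (Fin.join-splitAt (suc m) (suc m) j)))

  private
    N : ℤ
    N = + p * + p

  p≢0 : + p ≢ + 0
  p≢0 ()

  p-odd : + p ≡ + 2 * + m + + 1
  p-odd = trans (ℤ.pos-+ 1 (2 ℕ.* m)) (trans (cong (λ t → + 1 + t) (ℤ.pos-* 2 m)) (ℤ.+-comm (+ 1) (+ 2 * + m)))

  1<p : 1 < p
  1<p = ℕ.nonTrivial⇒n>1 p {{prime⇒nonTrivial pr}}

  ∣N⇒ : ∀ {x} → N ∣ + p * x → + p ∣ x
  ∣N⇒ {x} (divides q e) = divides q (*-cancelˡ (+ p) x (q * + p) p≢0 (trans e (regroup q (+ p))))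
    where
    regroup : ∀ q p → q * (p * p) ≡ p * (q * p)
    regroup = solve-∀

  -- The two values differ by p(2k + p), which p² divides only if p ∣ 2k.
  shifted : ∀ k l → N ∣ k * k + l * l + + 3 → ¬ (+ p ∣ k) → ¬ (N ∣ (k + + p) * (k + + p) + l * l + + 3)
  shifted k l d p∤k d′ = p∤k (odd-cancel (+ m) p-odd {k} (subst (+ p ∣_) (cancel k (+ p))
      (∣m∣n⇒∣m-n (∣N⇒ {+ 2 * k + + p} (subst (N ∣_) (difference k l (+ p)) (∣m∣n⇒∣m-n d′ d))) ∣-refl)))
    where
    difference : ∀ k l p → (k + p) * (k + p) + l * l + + 3 - (k * k + l * l + + 3) ≡ p * (+ 2 * k + p)
    difference = solve-∀
    cancel : ∀ k p → + 2 * k + p - p ≡ + 2 * k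
    cancel = solve-∀

  -- Here c stands for |a|². Once a is lifted so that p² ∣ |a|² + k² + l² + 3, the second condition
  -- says p² ∤ |a|². A bad choice is repaired by adding p to k or to l; this could fail only if p
  -- divided both, and then p² would divide 3.
  two-squares-primitive : ∀ c → ∃[ k ] ∃[ l ] (+ p ∣ k * k + l * l + + 3 + c) × ¬ (N ∣ k * k + l * l + + 3)
  two-squares-primitive c = adjust (two-squares (+ 3 + c))
    where
    adjust : (∃[ k ] ∃[ l ] (+ p ∣ k * k + l * l + (+ 3 + c))) → ∃[ k ] ∃[ l ] (+ p ∣ k * k + l * l + + 3 + c) × ¬ (N
        ∣ k * k + l * l + + 3)
    adjust (k , l , d) = decide (N ∣? k * k + l * l + + 3) (+ p ∣? k) (+ p ∣? l)
      where
      d₀ : + p ∣ k * k + l * l + + 3 + c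
      d₀ = subst (+ p ∣_) (sym (ℤ.+-assoc (k * k + l * l) (+ 3) c)) d
      decide : Dec (N ∣ k * k + l * l + + 3) → Dec (+ p ∣ k) → Dec (+ p ∣ l) → ∃[ k ] ∃[ l ] (+ p ∣ k * k + l * l + +
          3 + c) × ¬ (N ∣ k * k + l * l + + 3)
      decide (no N∤) _ _ = k , l , d₀ , N∤
      decide (yes N∣) (no p∤k) _ = k + + p , l , subst (+ p ∣_) (regroup k l c (+ p)) (∣m∣n⇒∣m+n d₀ (∣m⇒∣m*n (+ 2 * k
          + + p) ∣-refl)) , shifted k l N∣ p∤k
        where
        regroup : ∀ k l c p → k * k + l * l + + 3 + c + p * (+ 2 * k + p) ≡ (k + p) * (k + p) + l * l + + 3 + c
        regroup = solve-∀
      decide (yes N∣) (yes _) (no p∤l) = k , l + + p , subst (+ p ∣_) (regroup k l c (+ p)) (∣m∣n⇒∣m+n d₀ (∣m⇒∣m*n (+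
          2 * l + + p) ∣-refl)) ,
          λ d′ → shifted l k (subst (N ∣_) (comm k l) N∣) p∤l (subst (N ∣_) (comm k (l + + p)) d′)
        where
        regroup : ∀ k l c p → k * k + l * l + + 3 + c + p * (+ 2 * l + p) ≡ k * k + (l + p) * (l + p) + + 3 + c
        regroup = solve-∀
        comm : ∀ k l → k * k + l * l + + 3 ≡ l * l + k * k + + 3
        comm = solve-∀
      decide (yes N∣) (yes (divides q k≡)) (yes (divides r l≡)) = ⊥-elim (ℕ.<⇒≱ 3<p² (ℕ∣.∣⇒≤ (∣⇒∣ᵤ N∣3)))
        where
        N∣3 : N ∣ + 3
        N∣3 = subst (N ∣_) (trans (cong₂ (λ k l → k * k + l * l + + 3 - (q * q + r * r) * N) k≡ l≡) (cancel q r (+ p)))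
          (∣m∣n⇒∣m-n N∣ (∣n⇒∣m*n (q * q + r * r) ∣-refl))
          where
          cancel : ∀ q r p → q * p * (q * p) + r * p * (r * p) + + 3 - (q * q + r * r) * (p * p) ≡ + 3
          cancel = solve-∀
        3<p² : 3 < ∣ N ∣
        3<p² = ℕ.<-≤-trans (ℕ.s≤s (ℕ.s≤s (ℕ.s≤s (ℕ.s≤s ℕ.z≤n)))) (subst (4 ℕ.≤_) (sym (ℤ.abs-* (+ p) (+ p)))
            (ℕ.*-mono-≤ 1<p 1<p))

  -- Hensel's argument: adding p·t to aᵢ changes |a|² by 2p·t·aᵢ modulo p², and 2aᵢ is invertible
  -- modulo p.
  lift : ∀ (a : Vect 3) i → ¬ (+ p ∣ a i) → ∀ K → + p ∣ dot a a + K →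
    Σ (Vect 3) λ z → N ∣ dot (λ c → a c + + p * z c) (λ c → a c + + p * z c) + K
  lift a i p∤aᵢ K (divides n e) = solveLinear (bezout (+ 2 * a i) (+ p))
    where
    solveLinear : (∃[ d ] ∃[ x ] ∃[ y ] (+ d ∣ + 2 * a i) × (+ d ∣ + p) × (+ d ≡ x * (+ 2 * a i) + y * + p)) →
      Σ (Vect 3) λ z → N ∣ dot (λ c → a c + + p * z c) (λ c → a c + + p * z c) + K
    solveLinear (d , x , y , d∣2a , d∣p , d≡) = z , divides (n * y + (- (x * n)) * (- (x * n))) (trans (cong (λ t → t
        + K) (expand i))
        (trans (regroup (dot a a) (+ p) (a i) (- (x * n)) K) (trans (cong (λ t → t + + 2 * + p * a i * (- (x * n)) +
            + p * + p * ((- (x * n)) * (- (x * n)))) e)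
        (trans (collect n (+ p) (a i) x) (trans (cong (λ u → n * + p * (u - x * (+ 2 * a i)) + + p * + p * ((- (x *
            n)) * (- (x * n)))) unit) (collect′ n (+ p) (a i) x y))))))
      where
      d≡1 : d ≡ 1
      d≡1 = divisor (prime⇒irreducible pr (∣⇒∣ᵤ d∣p))
        where
        divisor : d ≡ 1 ⊎ d ≡ p → d ≡ 1
        divisor (inj₁ e) = e
        divisor (inj₂ e) = ⊥-elim (p∤aᵢ (odd-cancel (+ m) p-odd {a i} (subst (λ t → + t ∣ + 2 * a i) e d∣2a)))
      unit : + 1 ≡ x * (+ 2 * a i) + y * + p
      unit = trans (cong +_ (sym d≡1)) d≡
      z : Vect 3
      z c = - (x * n) * δ i c
      expand : ∀ i → dot (λ c → a c + + p * (- (x * n) * δ i c)) (λ c → a c + + p * (- (x * n) * δ i c)) ≡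
        dot a a + + 2 * + p * a i * (- (x * n)) + + p * + p * ((- (x * n)) * (- (x * n)))
      expand 0F = identity (a 0F) (a 1F) (a 2F) (+ p) (- (x * n))
        where
        identity : ∀ a b c p w → (a + p * (w * + 1)) * (a + p * (w * + 1)) + ((b + p * (w * + 0)) * (b + p * (w * +
            0)) + (c + p * (w * + 0)) * (c + p * (w * + 0))) ≡
          a * a + (b * b + c * c) + + 2 * p * a * w + p * p * (w * w)
        identity = solve-∀
      expand 1F = identity (a 0F) (a 1F) (a 2F) (+ p) (- (x * n))
        where
        identity : ∀ a b c p w → (a + p * (w * + 0)) * (a + p * (w * + 0)) + ((b + p * (w * + 1)) * (b + p * (w * +
            1)) + (c + p * (w * + 0)) * (c + p * (w * + 0))) ≡
          a * a + (b * b + c * c) + + 2 * p * b * w + p * p * (w * w)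
        identity = solve-∀
      expand 2F = identity (a 0F) (a 1F) (a 2F) (+ p) (- (x * n))
        where
        identity : ∀ a b c p w → (a + p * (w * + 0)) * (a + p * (w * + 0)) + ((b + p * (w * + 0)) * (b + p * (w * +
            0)) + (c + p * (w * + 1)) * (c + p * (w * + 1))) ≡
          a * a + (b * b + c * c) + + 2 * p * c * w + p * p * (w * w)
        identity = solve-∀
      regroup : ∀ A p a w K → A + + 2 * p * a * w + p * p * (w * w) + K ≡ A + K + + 2 * p * a * w + p * p * (w * w)
      regroup = solve-∀
      collect : ∀ n p a x → n * p + + 2 * p * a * (- (x * n)) + p * p * ((- (x * n)) * (- (x * n))) ≡
        n * p * (+ 1 - x * (+ 2 * a)) + p * p * ((- (x * n)) * (- (x * n)))
      collect = solve-∀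
      collect′ : ∀ n p a x y → n * p * (x * (+ 2 * a) + y * p - x * (+ 2 * a)) + p * p * ((- (x * n)) * (- (x * n))) ≡
        (n * y + (- (x * n)) * (- (x * n))) * (p * p)
      collect′ = solve-∀

-- The integral vectors of ⟨1,1,1,1,1,3⟩ inside the Hurwitz–Eisenstein lattice

fromJ : Vect 6 → Vect 6
fromJ x = lookup (x 0F - x 5F ∷ + 2 * x 1F ∷ x 2F - x 1F ∷ x 3F - x 1F ∷ x 4F - x 1F ∷ + 2 * x 5F ∷ [])

doubled-fromJ : ∀ x r → doubled-coords (fromJ x) r ≡ + 2 * x r
doubled-fromJ x 0F = identity (x 0F) (x 5F)
  where
  identity : ∀ a f → + 2 * (a - f) + + 2 * f ≡ + 2 * a
  identity = solve-∀
doubled-fromJ x 1F = refl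
doubled-fromJ x 2F = identity (x 1F) (x 2F)
  where
  identity : ∀ b c → + 2 * b + + 2 * (c - b) ≡ + 2 * c
  identity = solve-∀
doubled-fromJ x 3F = identity (x 1F) (x 3F)
  where
  identity : ∀ b c → + 2 * b + + 2 * (c - b) ≡ + 2 * c
  identity = solve-∀
doubled-fromJ x 4F = identity (x 1F) (x 4F)
  where
  identity : ∀ b c → + 2 * b + + 2 * (c - b) ≡ + 2 * c
  identity = solve-∀
doubled-fromJ x 5F = refl

doubled-product : ∀ x y → B J (doubled-coords x) (doubled-coords y) ≡ + 2 * B HE x y
doubled-product x y = trans (sym (B-cong J (lincomb-doubled x) (lincomb-doubled y))) (HE-doubled x y)

fromJ-product : ∀ x y → B HE (fromJ x) (fromJ y) ≡ + 2 * B J x y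
fromJ-product x y = *-cancelˡ (+ 2) (B HE (fromJ x) (fromJ y)) (+ 2 * B J x y) (λ ())
  (trans (sym (doubled-product (fromJ x) (fromJ y))) (trans (B-cong J (doubled-fromJ x) (doubled-fromJ y))
    (trans (B-*ˡ J (+ 2) x (λ r → + 2 * y r)) (cong (+ 2 *_) (B-*ʳ J (+ 2) y x)))))

spaced : Vect 3 → Vect 6
spaced x = lookup (+ 0 ∷ x 0F ∷ x 1F ∷ x 2F ∷ + 0 ∷ + 0 ∷ [])

spaced-product : ∀ x y → B J (spaced x) (spaced y) ≡ dot x y
spaced-product x y = trans (J-form (spaced x) (spaced y)) (identity (x 0F * y 0F) (x 1F * y 1F) (x 2F * y 2F))
  where
  identity : ∀ a b c → + 0 * + 0 + (a + (b + (c + (+ 0 * + 0 + + 3 * (+ 0 * + 0))))) ≡ a + (b + c)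
  identity = solve-∀

-- The vector w: k and the final 1 form its Eisenstein component, a and l its Hurwitz component.
glue : Vect 3 → ℤ → ℤ → Vect 6
glue a k l = lookup (k ∷ a 0F ∷ a 1F ∷ a 2F ∷ l ∷ + 1 ∷ [])

glue-spaced : ∀ a k l y → B J (glue a k l) (spaced y) ≡ dot a y
glue-spaced a k l y = trans (J-form (glue a k l) (spaced y)) (identity k l (a 0F * y 0F) (a 1F * y 1F) (a 2F * y 2F))
  where
  identity : ∀ k l a b c → k * + 0 + (a + (b + (c + (l * + 0 + + 3 * (+ 1 * + 0))))) ≡ a + (b + c)
  identity = solve-∀

glue-norm : ∀ a k l → B J (glue a k l) (glue a k l) ≡ dot a a + (k * k + l * l + + 3)
glue-norm a k l = trans (J-form (glue a k l) (glue a k l)) (identity k l (a 0F * a 0F) (a 1F * a 1F) (a 2F * a 2F))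
  where
  identity : ∀ k l a b c → k * k + (a + (b + (c + (l * l + + 3 * (+ 1 * + 1))))) ≡ a + (b + c) + (k * k + l * l + + 3)
  identity = solve-∀

multiple : ℤ → Fin 3 → Vect 3
multiple n c r = n * δ c r

dot-multiple : ∀ n c y → dot (multiple n c) y ≡ n * y c
dot-multiple n 0F y = identity n (y 0F) (y 1F) (y 2F)
  where
  identity : ∀ n a b c → n * + 1 * a + (n * + 0 * b + n * + 0 * c) ≡ n * a
  identity = solve-∀
dot-multiple n 1F y = identity n (y 0F) (y 1F) (y 2F)
  where
  identity : ∀ n a b c → n * + 0 * a + (n * + 1 * b + n * + 0 * c) ≡ n * b
  identity = solve-∀
dot-multiple n 2F y = identity n (y 0F) (y 1F) (y 2F)
  where
  identity : ∀ n a b c → n * + 0 * a + (n * + 0 * b + n * + 1 * c) ≡ n * c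
  identity = solve-∀

dot-multiples : ∀ n c d → dot (multiple n c) (multiple n d) ≡ n * n * δ c d
dot-multiples n c d = trans (dot-multiple n c (multiple n d)) (trans (sym (ℤ.*-assoc n n (δ d c))) (cong (n * n *_)
    (δ-sym c d)))
  where
  δ-sym : ∀ (c d : Fin 3) → δ d c ≡ δ c d
  δ-sym = from-yes (≡Mat? (λ (c d : Fin 3) → δ d c) δ)

open Descent HE-covering
open FullDescent HE-covering

module Construction (p : ℕ) (p>0 : 0 < p) (a : Vect 3) (k l : ℤ) (K≡ : + p * + p ∣ dot a a + (k * k + l * l + + 3))
  {n} (x : Fin n → Vect 3) (a·x : ∀ i → + p ∣ dot a (x i)) where

  ρ : Fin (suc n) → ℤ
  ρ zero    = + 1
  ρ (suc i) = + 0

  y : Fin (suc n) → Vect 6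
  y zero    = λ _ → + 0
  y (suc i) = fromJ (spaced (x i))

  w : Vect 6
  w = fromJ (glue a k l)

  -- The Gram matrix of w/p and the vectors `x i`, integral because p² divides the norm of w and p
  -- divides each a·xᵢ.
  γ : Mat (suc n)
  γ zero    zero    = quotient K≡
  γ zero    (suc j) = quotient (a·x j)
  γ (suc i) zero    = quotient (a·x i)
  γ (suc i) (suc j) = dot (x i) (x j)

  V : Fin (suc n) → Vect 6
  V zero    = w
  V (suc i) = λ j → + p * fromJ (spaced (x i)) j

  V≡ : ∀ i j → V i j ≡ frac (+ p) ρ w y i j
  V≡ zero    j = identity (w j) (+ p)
    where
    identity : ∀ w p → w ≡ + 1 * w + p * + 0
    identity = solve-∀
  V≡ (suc i) j = identity (w j) (+ p * fromJ (spaced (x i)) j)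
    where
    identity : ∀ w t → t ≡ + 0 * w + t
    identity = solve-∀

  w·x : ∀ i → B HE w (fromJ (spaced (x i))) ≡ + 2 * (quotient (a·x i) * + p)
  w·x i = trans (fromJ-product (glue a k l) (spaced (x i))) (cong (+ 2 *_) (trans (glue-spaced a k l (x i))
      (_∣_.equality (a·x i))))

  HE-sym : ∀ x y → B HE x y ≡ B HE y x
  HE-sym = B-sym HE (Covering.symmetric HE-covering)

  gramV : ∀ i j → B HE (V i) (V j) ≡ + p * + p * (+ 2 * γ i j)
  gramV zero    zero    = trans (fromJ-product (glue a k l) (glue a k l)) (trans (cong (+ 2 *_) (trans (glue-norm a k
      l) (_∣_.equality K≡))) (regroup (quotient K≡) (+ p * + p)))
    where
    regroup : ∀ q n → + 2 * (q * n) ≡ n * (+ 2 * q)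
    regroup = solve-∀
  gramV zero    (suc j) = trans (B-*ʳ HE (+ p) (fromJ (spaced (x j))) w) (trans (cong (+ p *_) (w·x j)) (regroup (+
      p) (quotient (a·x j))))
    where
    regroup : ∀ p q → p * (+ 2 * (q * p)) ≡ p * p * (+ 2 * q)
    regroup = solve-∀
  gramV (suc i) zero    = trans (HE-sym (V (suc i)) w) (gramV zero (suc i))
  gramV (suc i) (suc j) = trans (B-*ˡ HE (+ p) (fromJ (spaced (x i))) (V (suc j))) (trans (cong (+ p *_) (B-*ʳ HE (+
      p) (fromJ (spaced (x j))) (fromJ (spaced (x i)))))
    (trans (cong (λ t → + p * (+ p * t)) (trans (fromJ-product (spaced (x i)) (spaced (x j))) (cong (+ 2 *_)
        (spaced-product (x i) (x j))))) (sym (ℤ.*-assoc (+ p) (+ p) (+ 2 * dot (x i) (x j))))))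

  embedded : ∃ (Gram γ 1)
  embedded = descend γ p (<-wellFounded p) p>0 ρ w y (Gram-cong p V≡ (gramian gramV))

  doubled-images : Σ (Fin (suc n) → Vect 6) λ U → ∀ i j → B J (doubled-coords (U i)) (doubled-coords (U j)) ≡ + 4 * γ
      i j
  doubled-images = proj₁ embedded , λ i j → trans (doubled-product (proj₁ embedded i) (proj₁ embedded j))
      (trans (cong (+ 2 *_) (Gram.products (proj₂ embedded) i j)) (four (γ i j)))
    where
    four : ∀ g → + 2 * (+ 1 * + 1 * (+ 2 * g)) ≡ + 4 * g
    four = solve-∀

-- Sublattices annihilated by a form modulo an odd prime

module OddPrime (m : ℕ) (pr : Prime (1 ℕ.+ 2 ℕ.* m)) {k} (v : Fin k → Vect 3) where

  open TwoSquares m pr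

  -- The given v need not span ℚ³, so the vectors p·eᵢ, which also lie in M, are carried along:
  -- their images form the frame.
  module Family (a : Vect 3) (a·v : ∀ i → + p ∣ dot a (v i)) where

    x : Fin (3 ℕ.+ k) → Vect 3
    x 0F = multiple (+ p) 0F
    x 1F = multiple (+ p) 1F
    x 2F = multiple (+ p) 2F
    x (suc (suc (suc i))) = v i
    inj : Fin 3 → Fin (3 ℕ.+ k)
    inj 0F = 0F
    inj 1F = 1F
    inj 2F = 2F
    x-inj : ∀ c → x (inj c) ≡ multiple (+ p) c
    x-inj 0F = refl
    x-inj 1F = refl
    x-inj 2F = refl
    p∣a·pe : ∀ c → + p ∣ dot a (multiple (+ p) c)
    p∣a·pe c = subst (+ p ∣_) (sym (trans (dot-comm a (multiple (+ p) c)) (dot-multiple (+ p) c a))) (∣m⇒∣m*n (a c)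
        ∣-refl)
    a·x : ∀ i → + p ∣ dot a (x i)
    a·x 0F = p∣a·pe 0F
    a·x 1F = p∣a·pe 1F
    a·x 2F = p∣a·pe 2F
    a·x (suc (suc (suc i))) = a·v i

  module Primitive (a : Vect 3) (s t : ℤ) (K∣ : + p * + p ∣ dot a a + (s * s + t * t + + 3)) (K∤ : ¬ (+ p * + p ∣ s *
      s + t * t + + 3))
    (a·v : ∀ i → + p ∣ dot a (v i)) where

    open OddIndex p (+ m) p-odd p≢0 v a
    open Family a a·v
    open Construction p (ℕ.s≤s ℕ.z≤n) a s t K∣ x a·x using (γ; doubled-images)

    solve : (Σ (Fin (4 ℕ.+ k) → Vect 6) λ U → ∀ i j → B J (doubled-coords (U i)) (doubled-coords (U j)) ≡ + 4 * γ i
        j) → Goal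
    solve (U , u·u) = continue (normalise {f} (F , D) (λ c → doubled-InHE (U (suc (inj c)))))
      where
      u : Fin (4 ℕ.+ k) → Vect 6
      u i = doubled-coords (U i)
      f : Fin 3 → Vect 6
      f c = u (suc (inj c))
      pe·x : ∀ c j → dot (x (inj c)) (x j) ≡ + p * x j c
      pe·x c j = trans (cong (λ z → dot z (x j)) (x-inj c)) (dot-multiple (+ p) c (x j))
      f-orth : ∀ c d → B J (f c) (f d) ≡ S * δ c d
      f-orth c d = trans (u·u (suc (inj c)) (suc (inj d))) (trans (cong (+ 4 *_) (trans (cong₂ dot (x-inj c) (x-inj
          d)) (dot-multiples (+ p) c d)))
        (sym (ℤ.*-assoc (+ 4) (+ p * + p) (δ c d))))
      f·v : ∀ c i → B J (f c) (u (suc (suc (suc (suc i))))) ≡ + 4 * (+ p * v i c)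
      f·v c i = trans (u·u (suc (inj c)) (suc (suc (suc (suc i))))) (cong (+ 4 *_) (pe·x c (suc (suc (suc i)))))
      -- p · u(v) and Σ v_c f_c have the same inner products, hence are equal.
      f-lin : ∀ i r → lincomb f (v i) r ≡ + p * u (suc (suc (suc (suc i)))) r
      f-lin i r = equal (J-definite difference zeroNorm r)
        where
        z = u (suc (suc (suc (suc i))))
        lc = lincomb f (v i)
        difference : Vect 6
        difference r = + 1 * lc r + - + p * z r
        lc·lc : B J lc lc ≡ S * dot (v i) (v i)
        lc·lc = trans (B-lincomb₂ J f (v i) (v i)) (trans (B-congᴳ (subGram J f) (v i) (v i) f-orth) (trans (B-*ᴳ δ S
            (v i) (v i)) (cong (S *_) (B-δ (v i)))))
          where
          B-δ : ∀ x → B δ x x ≡ dot x x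
          B-δ x = identity (x 0F) (x 1F) (x 2F)
            where
            identity : ∀ a b c → (a * + 1 * a + (a * + 0 * b + (a * + 0 * c + + 0))) + ((b * + 0 * a + (b * + 1 * b +
                (b * + 0 * c + + 0))) +
              ((c * + 0 * a + (c * + 0 * b + (c * + 1 * c + + 0))) + + 0)) ≡ a * a + (b * b + c * c)
            identity = solve-∀
        lc·z : B J lc z ≡ + 4 * (+ p * dot (v i) (v i))
        lc·z = trans (B-lincombˡ J f (v i) z) (trans (cong₂ (λ s t → v i 0F * s + t) (f·v 0F i) (cong₂ (λ s t → v i
            1F * s + (v i 2F * t + + 0)) (f·v 1F i) (f·v 2F i)))
          (regroup (v i 0F) (v i 1F) (v i 2F) (+ p)))
          where
          regroup : ∀ a b c p → a * (+ 4 * (p * a)) + (b * (+ 4 * (p * b)) + (c * (+ 4 * (p * c)) + + 0)) ≡ + 4 * (p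
              * (a * a + (b * b + c * c)))
          regroup = solve-∀
        zeroNorm : B J difference difference ≡ + 0
        zeroNorm = trans (B-comb₂ J (+ 1) lc (- + p) z (+ 1) lc (- + p) z)
          (cancel (+ p) (dot (v i) (v i)) lc·lc lc·z (trans (B-sym J J-sym z lc) lc·z) (u·u (suc (suc (suc (suc i))))
              (suc (suc (suc (suc i))))))
          where
          cancel : ∀ p d {α β γ ε} → α ≡ + 4 * (p * p) * d → β ≡ + 4 * (p * d) → γ ≡ + 4 * (p * d) → ε ≡ + 4 * d →
            + 1 * + 1 * α + + 1 * - p * β + - p * + 1 * γ + - p * - p * ε ≡ + 0
          cancel p d refl refl refl refl = identity p d
            where
            identity : ∀ p d → + 1 * + 1 * (+ 4 * (p * p) * d) + + 1 * - p * (+ 4 * (p * d)) + - p * + 1 * (+ 4 * (p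
                * d)) + - p * - p * (+ 4 * d) ≡ + 0
            identity = solve-∀
        equal : difference r ≡ + 0 → lc r ≡ + p * z r
        equal e = ℤ.i-j≡0⇒i≡j (lc r) (+ p * z r) (trans (regroup (lc r) (+ p) (z r)) e)
          where
          regroup : ∀ x p z → x - p * z ≡ + 1 * x + - p * z
          regroup = solve-∀
      F : Frame S f
      F = record { orth = f-orth ; div = λ i r → divides (u (suc (suc (suc (suc i)))) r) (trans (f-lin i r) (ℤ.*-comm
          (+ p) (u (suc (suc (suc (suc i)))) r))) }
      -- The product of w/p with p·e_c is a c. In doubled coordinates both factors are doubled,
      -- hence the exponent 2.
      D : Dual f
      D = u zero , 2 , λ c → trans (u·u zero (suc (inj c))) (cong (+ 4 *_) (q≡ c))
        where
        q≡ : ∀ c → quotient (a·x (inj c)) ≡ a c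
        q≡ c = *-cancelˡ (+ p) (quotient (a·x (inj c))) (a c) p≢0 (trans (ℤ.*-comm (+ p) (quotient (a·x (inj c))))
            (trans (sym (_∣_.equality (a·x (inj c))))
          (trans (dot-comm a (x (inj c))) (trans (cong (λ z → dot z a) (x-inj c)) (dot-multiple (+ p) c a)))))
      continue : ∃ (Data (+ p * + p)) → Goal
      continue (f′ , data′) = solve-frame {f′} data′ λ N∣a² → K∤ (∣m+n∣m⇒∣n {+ p * + p} {dot a a} {s * s + t * t + +
          3} K∣ N∣a²)

    solved : Goal
    solved = solve doubled-images

  represents-odd : ∀ (a : Vect 3) i → ¬ (+ p ∣ a i) → (∀ j → + p ∣ dot a (v j)) → Represents L6 (subGram (I 3) v)
  represents-odd a i p∤aᵢ a·v = withSquares (two-squares-primitive (dot a a))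
    where
    withSquares : (∃[ s ] ∃[ t ] (+ p ∣ s * s + t * t + + 3 + dot a a) × ¬ (+ p * + p ∣ s * s + t * t + + 3)) →
        Represents L6 (subGram (I 3) v)
    withSquares (s , t , d , K∤) = withLift (lift a i p∤aᵢ (s * s + t * t + + 3) (subst (+ p ∣_) (ℤ.+-comm (s * s + t
        * t + + 3) (dot a a)) d))
      where
      withLift : (Σ (Vect 3) λ z → + p * + p ∣ dot (λ c → a c + + p * z c) (λ c → a c + + p * z c) + (s * s + t * t +
          + 3)) → Represents L6 (subGram (I 3) v)
      withLift (z , K∣) = Primitive.solved (λ c → a c + + p * z c) s t K∣ K∤ λ j →
          subst (+ p ∣_) (regroup (a 0F) (a 1F) (a 2F) (z 0F) (z 1F) (z 2F) (v j 0F) (v j 1F) (v j 2F) (+ p))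
            (∣m∣n⇒∣m+n (a·v j) (∣m⇒∣m*n (dot z (v j)) ∣-refl))
        where
        regroup : ∀ a b c x y z u v w p → a * u + (b * v + c * w) + p * (x * u + (y * v + z * w)) ≡
          (a + p * x) * u + ((b + p * y) * v + (c + p * z) * w)
        regroup = solve-∀

-- Proper subgroups of ℤⁿ lie in the kernel of a nonzero linear form modulo a prime

prime-divisor : ∀ d → d ≢ 1 → ∃[ p ] Prime p × (+ p ∣ + d)
-- Every prime divides 0, so 2 serves as well as any other.
prime-divisor zero    _   = 2 , prime[2] , divides (+ 0) refl
prime-divisor d@(suc _) d≢1 = first (PrimeFactorisation.factors F) (PrimeFactorisation.isFactorisation F)
    (PrimeFactorisation.factorsPrime F)
  where
  F = factorise d
  first : ∀ ps → d ≡ product ps → All Prime ps → ∃[ p ] Prime p × (+ p ∣ + d)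
  first []       d≡ []         = ⊥-elim (d≢1 d≡)
  first (p ∷ ps) d≡ (pr ∷ prs) = p , pr , ∣ᵤ⇒∣ (ℕ∣.divides (product ps) (trans d≡ (ℕ.*-comm p (product ps))))

lincomb-shift : ∀ {k n} (v : Fin k → Vect n) c t b j →
  lincomb v (λ i → c i + t * b i) j ≡ lincomb v c j + t * lincomb v b j
lincomb-shift {k} v c t b j = trans (sumF-cong k (λ i → expand (c i) t (b i) (v i j)))
  (trans (sumF-+ k (λ i → c i * v i j) (λ i → t * (b i * v i j))) (+-congʳ (lincomb v c j) (sumF-*ˡ k t (λ i → b i *
      v i j))))
  where
  expand : ∀ c t b v → (c + t * b) * v ≡ c * v + t * (b * v)
  expand = solve-∀

Annihilated : ∀ {k n} → (Fin k → Vect n) → Set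
Annihilated {k} {n} v = ∃[ p ] Prime p × Σ (Vect n) λ a → (∃ λ i → ¬ (+ p ∣ a i)) × ∀ j → + p ∣ sumF n (λ r → a r * v
    j r)

prime∤1 : ∀ {p} → Prime p → ¬ (+ p ∣ + 1)
prime∤1 {p} pr d = ℕ.<⇒≢ (ℕ.nonTrivial⇒n>1 p {{prime⇒nonTrivial pr}}) (sym (ℕ∣.∣1⇒≡1 (∣⇒∣ᵤ d)))

-- If a prime divides all first coordinates, the first coordinate is the required form. Otherwise
-- some combination of v has the shape (1, g), and subtracting multiples of it clears the first
-- coordinates. A form a that annihilates the remainders extends to v by the first coefficient -a·g.
spans-or-annihilated : ∀ n {k} (v : Fin k → Vect n) → Spans v ⊎ Annihilated v
spans-or-annihilated zero    v = inj₁ λ x → (λ _ → + 0) , λ ()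
spans-or-annihilated (suc n) {k} v = split (bezoutF k (λ j → v j zero))
  where
  split : (∃[ d ] Σ (Vect k) λ c → (∀ i → + d ∣ v i zero) × (+ d ≡ sumF k (λ i → c i * v i zero))) → Spans v ⊎
      Annihilated v
  split (d , c , d∣ , d≡) = decide (d ℕ.≟ 1)
    where
    decide : Dec (d ≡ 1) → Spans v ⊎ Annihilated v
    decide (no d≢1) = inj₂ (build (prime-divisor d d≢1))
      where
      build : (∃[ p ] Prime p × (+ p ∣ + d)) → Annihilated v
      build (p , pr , p∣d) = p , pr , δ zero , (zero , prime∤1 pr) ,
        λ j → subst (+ p ∣_) (sym (sumF-δ (suc n) zero (v j))) (∣-trans p∣d (d∣ j))
    decide (yes d≡1) = [ inj₁ ∘ spans , inj₂ ∘ annihilated ]′ (spans-or-annihilated n v′)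
      where
      g : Vect n
      g r = lincomb v c (suc r)
      g₀ : lincomb v c zero ≡ + 1
      g₀ = trans (sym d≡) (cong +_ d≡1)
      v′ : Fin k → Vect n
      v′ j r = v j (suc r) + - v j zero * g r
      annihilated : Annihilated v′ → Annihilated v
      annihilated (p , pr , a , (i , p∤a) , p∣) = p , pr , b , (suc i , p∤a) , λ j → subst (+ p ∣_) (pairing j) (p∣ j)
        where
        s : ℤ
        s = sumF n (λ r → a r * g r)
        b : Vect (suc n)
        b zero    = - s
        b (suc r) = a r
        pairing : ∀ j → sumF n (λ r → a r * v′ j r) ≡ sumF (suc n) (λ r → b r * v j r)
        pairing j = trans (sumF-cong n (λ r → expand (a r) (v j (suc r)) (v j zero) (g r)))
          (trans (sumF-+ n (λ r → - v j zero * (a r * g r)) (λ r → a r * v j (suc r)))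
            (cong (λ t → t + sumF n (λ r → a r * v j (suc r))) (trans (sumF-*ˡ n (- v j zero) (λ r → a r * g r))
                (commute (v j zero) s))))
          where
          expand : ∀ a v v₀ g → a * (v + - v₀ * g) ≡ - v₀ * (a * g) + a * v
          expand = solve-∀
          commute : ∀ v s → - v * s ≡ - s * v
          commute = solve-∀
      spans : Spans v′ → Spans v
      spans sp x = solution (sp (λ r → x (suc r) + - x zero * g r))
        where
        solution : (Σ (Vect k) λ e → ∀ r → x (suc r) + - x zero * g r ≡ lincomb v′ e r) → Σ (Vect k) λ c → ∀ j → x j
            ≡ lincomb v c j
        solution (e , eq) = (λ j → e j + t * c j) , coords
          where
          s : ℤ
          s = lincomb v e zero
          t : ℤ
          t = x zero - s
          coords : ∀ j → x j ≡ lincomb v (λ i → e i + t * c i) j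
          coords zero    = sym (trans (lincomb-shift v e t c zero) (trans (cong (λ u → s + t * u) g₀) (cancel s (x
              zero))))
            where
            cancel : ∀ s x → s + (x - s) * + 1 ≡ x
            cancel = solve-∀
          coords (suc r) = sym (trans (lincomb-shift v e t c (suc r)) (trans (cong (λ u → u + t * g r) reduced)
              (cancel (x (suc r)) (x zero) s (g r))))
            where
            expand : ∀ e v v₀ g → e * (v + - v₀ * g) ≡ e * v + - g * (e * v₀)
            expand = solve-∀
            v′-comb : lincomb v′ e r ≡ lincomb v e (suc r) + - g r * s
            v′-comb = trans (sumF-cong k (λ i → expand (e i) (v i (suc r)) (v i zero) (g r)))
              (trans (sumF-+ k (λ i → e i * v i (suc r)) (λ i → - g r * (e i * v i zero)))
                (+-congʳ (lincomb v e (suc r)) (sumF-*ˡ k (- g r) (λ i → e i * v i zero))))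
            reduced : lincomb v e (suc r) ≡ x (suc r) + - x zero * g r + g r * s
            reduced = trans (isolate (lincomb v e (suc r)) (g r) s) (cong (λ u → u + g r * s) (trans (sym v′-comb)
                (sym (eq r))))
              where
              isolate : ∀ a g s → a ≡ a + - g * s + g * s
              isolate = solve-∀
            cancel : ∀ x x₀ s g → x + - x₀ * g + g * s + (x₀ - s) * g ≡ x
            cancel = solve-∀

-- Index 2: the coordinates at which a is odd go to D₃ and the others to I₂

-- The fourth entry is the zero that fills the coordinates of `J` left unoccupied.
padded : Vect 3 → Fin 4 → ℤ
padded x = lookup (x 0F ∷ x 1F ∷ x 2F ∷ + 0 ∷ [])

placed : Vec (Fin 4) 6 → Vect 3 → Vect 6
placed π x r = padded x (lookup π r)

Isometric : Vec (Fin 4) 6 → Set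
Isometric π = ∀ x y → B J (placed π x) (placed π y) ≡ dot x y

B-I≡dot : ∀ x y → B (I 3) x y ≡ dot x y
B-I≡dot x y = trans (B-congᴳ (I 3) x y I≡δ) (identity (x 0F) (x 1F) (x 2F) (y 0F) (y 1F) (y 2F))
  where
  identity : ∀ a b c d e f → (a * + 1 * d + (a * + 0 * e + (a * + 0 * f + + 0))) + ((b * + 0 * d + (b * + 1 * e + (b
      * + 0 * f + + 0))) +
    ((c * + 0 * d + (c * + 0 * e + (c * + 1 * f + + 0))) + + 0)) ≡ a * d + (b * e + c * f)
  identity = solve-∀

module IndexTwo {k} (v : Fin k → Vect 3) where

  place : ∀ π → Isometric π → (∀ i → par (placed π (v i) 2F + placed π (v i) 3F + placed π (v i) 4F) ≡ false) →
      Represents L6 (subGram (I 3) v)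
  place π iso even = L6-represents (subGram (I 3) v) (λ i → placed π (v i))
    (λ i j → trans (iso (v i) (v j)) (sym (B-I≡dot (v i) (v j)))) (λ i → par⇒even {placed π (v i) 2F + placed π (v i)
        3F + placed π (v i) 4F} (even i))

  represents-even : ∀ (a : Vect 3) i → ¬ (+ 2 ∣ a i) → (∀ j → + 2 ∣ dot a (v j)) → Represents L6 (subGram (I 3) v)
  represents-even a i odd 2∣ = byParity (par (a 0F)) (par (a 1F)) (par (a 2F)) refl refl refl
    where
    parity : ∀ j → (par (a 0F) ∧ par (v j 0F)) xor ((par (a 1F) ∧ par (v j 1F)) xor (par (a 2F) ∧ par (v j 2F))) ≡ false
    parity j = trans (sym (trans (par-+ (a 0F * v j 0F) (a 1F * v j 1F + a 2F * v j 2F)) (cong₂ _xor_ (par-* (a 0F)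
        (v j 0F))
      (trans (par-+ (a 1F * v j 1F) (a 2F * v j 2F)) (cong₂ _xor_ (par-* (a 1F) (v j 1F)) (par-* (a 2F) (v j
          2F))))))) (even⇒par (2∣ j))
    byParity : ∀ b₀ b₁ b₂ → par (a 0F) ≡ b₀ → par (a 1F) ≡ b₁ → par (a 2F) ≡ b₂ → Represents L6 (subGram (I 3) v)
    byParity b₀ b₁ b₂ e₀ e₁ e₂ = choose b₀ b₁ b₂ odd′ even
      where
      even : ∀ j → (b₀ ∧ par (v j 0F)) xor ((b₁ ∧ par (v j 1F)) xor (b₂ ∧ par (v j 2F))) ≡ false
      even j = trans (sym (cong₂ _xor_ (cong (_∧ par (v j 0F)) e₀) (cong₂ _xor_ (cong (_∧ par (v j 1F)) e₁) (cong (_∧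
          par (v j 2F)) e₂)))) (parity j)
      odd′ : ¬ (b₀ ≡ false × b₁ ≡ false × b₂ ≡ false)
      odd′ (f₀ , f₁ , f₂) = odd (all i)
        where
        all : ∀ i → + 2 ∣ a i
        all 0F = par⇒even (trans e₀ f₀)
        all 1F = par⇒even (trans e₁ f₁)
        all 2F = par⇒even (trans e₂ f₂)
      sum₃ : ∀ j π → par (placed π (v j) 2F + placed π (v j) 3F + placed π (v j) 4F) ≡
        (par (placed π (v j) 2F) xor par (placed π (v j) 3F)) xor par (placed π (v j) 4F)
      sum₃ j π = trans (par-+ (placed π (v j) 2F + placed π (v j) 3F) (placed π (v j) 4F)) (cong (_xor par (placed π
          (v j) 4F)) (par-+ (placed π (v j) 2F) (placed π (v j) 3F)))
      x-ff : ∀ x → (x xor false) xor false ≡ x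
      x-ff false = refl
      x-ff true  = refl
      xy-f : ∀ x y → (x xor y) xor false ≡ x xor y
      xy-f false false = refl
      xy-f false true  = refl
      xy-f true  false = refl
      xy-f true  true  = refl
      x-f : ∀ x → x xor false ≡ x
      x-f false = refl
      x-f true  = refl
      choose : ∀ b₀ b₁ b₂ → ¬ (b₀ ≡ false × b₁ ≡ false × b₂ ≡ false) →
        (∀ j → (b₀ ∧ par (v j 0F)) xor ((b₁ ∧ par (v j 1F)) xor (b₂ ∧ par (v j 2F))) ≡ false) → Represents L6
            (subGram (I 3) v)
      choose false false false odd even = ⊥-elim (odd (refl , refl , refl))
      choose true false false odd even = place π (λ x y → trans (J-form (placed π x) (placed π y)) (identity (x 0F *
          y 0F) (x 1F * y 1F) (x 2F * y 2F)))
          (λ j → trans (sum₃ j π) (trans (x-ff (par (v j 0F))) (trans (sym (x-f (par (v j 0F)))) (even j))))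
        where
        π : Vec (Fin 4) 6
        π = 1F ∷ 2F ∷ 0F ∷ 3F ∷ 3F ∷ 3F ∷ []
        identity : ∀ a b c → b + (c + (a + (+ 0 * + 0 + (+ 0 * + 0 + + 3 * (+ 0 * + 0))))) ≡ a + (b + c)
        identity = solve-∀
      choose false true false odd even = place π (λ x y → trans (J-form (placed π x) (placed π y)) (identity (x 0F *
          y 0F) (x 1F * y 1F) (x 2F * y 2F)))
          (λ j → trans (sum₃ j π) (trans (x-ff (par (v j 1F))) (trans (sym (x-f (par (v j 1F)))) (even j))))
        where
        π : Vec (Fin 4) 6
        π = 0F ∷ 2F ∷ 1F ∷ 3F ∷ 3F ∷ 3F ∷ []
        identity : ∀ a b c → a + (c + (b + (+ 0 * + 0 + (+ 0 * + 0 + + 3 * (+ 0 * + 0))))) ≡ a + (b + c)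
        identity = solve-∀
      choose false false true odd even = place π (λ x y → trans (J-form (placed π x) (placed π y)) (identity (x 0F *
          y 0F) (x 1F * y 1F) (x 2F * y 2F)))
          (λ j → trans (sum₃ j π) (trans (x-ff (par (v j 2F))) (even j)))
        where
        π : Vec (Fin 4) 6
        π = 0F ∷ 1F ∷ 2F ∷ 3F ∷ 3F ∷ 3F ∷ []
        identity : ∀ a b c → a + (b + (c + (+ 0 * + 0 + (+ 0 * + 0 + + 3 * (+ 0 * + 0))))) ≡ a + (b + c)
        identity = solve-∀
      choose true true false odd even = place π (λ x y → trans (J-form (placed π x) (placed π y)) (identity (x 0F * y
          0F) (x 1F * y 1F) (x 2F * y 2F)))
          (λ j → trans (sum₃ j π) (trans (xy-f (par (v j 0F)) (par (v j 1F))) (trans (cong (par (v j 0F) xor_) (sym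
              (x-f (par (v j 1F))))) (even j))))
        where
        π : Vec (Fin 4) 6
        π = 2F ∷ 3F ∷ 0F ∷ 1F ∷ 3F ∷ 3F ∷ []
        identity : ∀ a b c → c + (+ 0 * + 0 + (a + (b + (+ 0 * + 0 + + 3 * (+ 0 * + 0))))) ≡ a + (b + c)
        identity = solve-∀
      choose true false true odd even = place π (λ x y → trans (J-form (placed π x) (placed π y)) (identity (x 0F * y
          0F) (x 1F * y 1F) (x 2F * y 2F)))
          (λ j → trans (sum₃ j π) (trans (xy-f (par (v j 0F)) (par (v j 2F))) (even j)))
        where
        π : Vec (Fin 4) 6
        π = 1F ∷ 3F ∷ 0F ∷ 2F ∷ 3F ∷ 3F ∷ []
        identity : ∀ a b c → b + (+ 0 * + 0 + (a + (c + (+ 0 * + 0 + + 3 * (+ 0 * + 0))))) ≡ a + (b + c)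
        identity = solve-∀
      choose false true true odd even = place π (λ x y → trans (J-form (placed π x) (placed π y)) (identity (x 0F * y
          0F) (x 1F * y 1F) (x 2F * y 2F)))
          (λ j → trans (sum₃ j π) (trans (xy-f (par (v j 1F)) (par (v j 2F))) (even j)))
        where
        π : Vec (Fin 4) 6
        π = 0F ∷ 3F ∷ 1F ∷ 2F ∷ 3F ∷ 3F ∷ []
        identity : ∀ a b c → a + (+ 0 * + 0 + (b + (c + (+ 0 * + 0 + + 3 * (+ 0 * + 0))))) ≡ a + (b + c)
        identity = solve-∀
      choose true true true odd even = place π (λ x y → trans (J-form (placed π x) (placed π y)) (identity (x 0F * y
          0F) (x 1F * y 1F) (x 2F * y 2F)))
          (λ j → trans (sum₃ j π) (trans (Bool.xor-assoc (par (v j 0F)) (par (v j 1F)) (par (v j 2F))) (even j)))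
        where
        π : Vec (Fin 4) 6
        π = 3F ∷ 3F ∷ 0F ∷ 1F ∷ 2F ∷ 3F ∷ []
        identity : ∀ a b c → + 0 * + 0 + (+ 0 * + 0 + (a + (b + (c + + 3 * (+ 0 * + 0))))) ≡ a + (b + c)
        identity = solve-∀

-- `L6` is an isolation of I₃

parity : ∀ n → ∃[ m ] (n ≡ 2 ℕ.* m ⊎ n ≡ 1 ℕ.+ 2 ℕ.* m)
parity zero    = 0 , inj₁ refl
parity (suc n) with parity n
... | m , inj₁ e = m , inj₂ (cong suc e)
... | m , inj₂ e = suc m , inj₁ (trans (cong suc e) (sym (ℕ.*-suc 2 m)))

L6-represents-proper : ∀ {k} (v : Fin k → Vect 3) → ¬ Spans v → Represents L6 (subGram (I 3) v)
L6-represents-proper {k} v ¬spans = [ (λ sp → ⊥-elim (¬spans sp)) , byPrime ]′ (spans-or-annihilated 3 v)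
  where
  byPrime : Annihilated v → Represents L6 (subGram (I 3) v)
  byPrime (p , pr , a , (i , p∤a) , p∣) = split (parity p) pr p∤a a·v
    where
    a·v : ∀ j → + p ∣ dot a (v j)
    a·v j = subst (+ p ∣_) (drop (a 0F * v j 0F) (a 1F * v j 1F) (a 2F * v j 2F)) (p∣ j)
      where
      drop : ∀ x y z → x + (y + (z + + 0)) ≡ x + (y + z)
      drop = solve-∀
    split : ∀ {p} → (∃[ m ] (p ≡ 2 ℕ.* m ⊎ p ≡ 1 ℕ.+ 2 ℕ.* m)) → Prime p → ¬ (+ p ∣ a i) → (∀ j → + p ∣ dot a (v j)) →
      Represents L6 (subGram (I 3) v)
    split (m , inj₂ refl) pr p∤a p∣ = OddPrime.represents-odd m pr v a i p∤a p∣
    split (m , inj₁ refl) pr p∤a p∣ = two (prime⇒irreducible pr (ℕ∣.divides m (ℕ.*-comm 2 m)))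
      where
      two : 2 ≡ 1 ⊎ 2 ≡ 2 ℕ.* m → Represents L6 (subGram (I 3) v)
      two (inj₂ e) = IndexTwo.represents-even v a i (subst (λ q → ¬ (+ q ∣ a i)) (sym e) p∤a) (subst (λ q → ∀ j → + q
          ∣ dot a (v j)) (sym e) p∣)

L6-isLattice : IsLattice L6
L6-isLattice = from-yes (≡Mat? L6 (λ i j → L6 j i)) , positive
  where
  positive : ∀ x → ¬ (∀ i → x i ≡ + 0) → + 0 ℤ.< B L6 x x
  positive x x≢0 = subst (+ 0 ℤ.<_) (sym (trans (L6-in-J x x) (J-norm-correct y))) (ℤ.+<+ (ℕ.n≢0⇒n>0 (λ e → x≢0
      (vanish e))))
    where
    y = lincomb rootsInJ x
    vanish : J-norm y ≡ 0 → ∀ i → x i ≡ + 0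
    vanish e = coords
      where
      y≡0 : ∀ i → lookup (x 0F ∷ x 1F ∷ x 3F ∷ x 2F - x 3F + x 4F ∷ x 4F - x 2F ∷ x 5F ∷ []) i ≡ + 0
      y≡0 i = trans (sym (lincomb-roots x i)) (J-definite y (trans (J-norm-correct y) (cong +_ e)) i)
      x₄≡x₂ : x 4F ≡ x 2F
      x₄≡x₂ = ℤ.i-j≡0⇒i≡j (x 4F) (x 2F) (y≡0 4F)
      x₂≡0 : x 2F ≡ + 0
      x₂≡0 = *-cancelˡ (+ 2) (x 2F) (+ 0) (λ ()) (trans (double (x 2F)) (trans (cong₂ (λ s t → x 2F - s + t) (sym
          (y≡0 2F)) (sym x₄≡x₂)) (y≡0 3F)))
        where
        double : ∀ x → + 2 * x ≡ x - + 0 + x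
        double = solve-∀
      coords : ∀ i → x i ≡ + 0
      coords 0F = y≡0 0F
      coords 1F = y≡0 1F
      coords 2F = x₂≡0
      coords 3F = y≡0 2F
      coords 4F = trans x₄≡x₂ x₂≡0
      coords 5F = y≡0 5F

-- An even coordinate sum gives the D₃ component an even norm. In a vector of norm 1 it therefore
-- vanishes, and so does the last coordinate, of weight 3.
unit-in-plane : ∀ y → B J y y ≡ + 1 → + 2 ∣ y 2F + y 3F + y 4F → y 2F ≡ + 0 × y 3F ≡ + 0 × y 4F ≡ + 0 × y 5F ≡ + 0
unit-in-plane y norm even = byValue t refl (ℕ.≤-trans (ℕ.m≤m+n t (3 ℕ.* sq (y 5F))) bound)
  where
  t s : ℕ
  t = sq (y 2F) ℕ.+ (sq (y 3F) ℕ.+ sq (y 4F))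
  s = t ℕ.+ 3 ℕ.* sq (y 5F)
  bound : s ℕ.≤ 1
  bound = ℕ.≤-trans (ℕ.m≤n+m s (sq (y 0F) ℕ.+ sq (y 1F))) (ℕ.≤-reflexive (trans (regroup (sq (y 0F)) (sq (y 1F)) (sq
      (y 2F)) (sq (y 3F)) (sq (y 4F)) (sq (y 5F)))
    (ℤ.+-injective (trans (sym (J-norm-correct y)) norm))))
    where
    regroup : ∀ a b c d e f → a ℕ.+ b ℕ.+ (c ℕ.+ (d ℕ.+ e) ℕ.+ 3 ℕ.* f) ≡ a ℕ.+ (b ℕ.+ (c ℕ.+ (d ℕ.+ (e ℕ.+ 3 ℕ.* f))))
    regroup = solveℕ-∀
  t-even : par (+ t) ≡ false
  t-even = trans (cong par t≡) (trans (par-+ (y 2F * y 2F) (y 3F * y 3F + y 4F * y 4F)) (trans (cong₂ _xor_ (self 2F)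
      (trans (par-+ (y 3F * y 3F) (y 4F * y 4F)) (cong₂ _xor_ (self 3F) (self 4F))))
      (trans (sym (Bool.xor-assoc (par (y 2F)) (par (y 3F)) (par (y 4F)))) (trans (sym (trans (par-+ (y 2F + y 3F) (y
          4F)) (cong (_xor par (y 4F)) (par-+ (y 2F) (y 3F))))) (even⇒par even)))))
    where
    self : ∀ r → par (y r * y r) ≡ par (y r)
    self r = trans (par-* (y r) (y r)) (Bool.∧-idem (par (y r)))
    t≡ : + t ≡ y 2F * y 2F + (y 3F * y 3F + y 4F * y 4F)
    t≡ = sym (cong₂ _+_ (+sq (y 2F)) (cong₂ _+_ (+sq (y 3F)) (+sq (y 4F))))
  y₅≡0 : sq (y 5F) ≡ 0
  y₅≡0 = small (sq (y 5F)) (ℕ.≤-trans (ℕ.m≤n+m (3 ℕ.* sq (y 5F)) t) bound)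
    where
    small : ∀ n → 3 ℕ.* n ℕ.≤ 1 → n ≡ 0
    small zero    _ = refl
    small (suc n) h with subst (ℕ._≤ 1) (ℕ.*-suc 3 n) h
    ... | ℕ.s≤s ()
  byValue : ∀ n → t ≡ n → n ℕ.≤ 1 → y 2F ≡ + 0 × y 3F ≡ + 0 × y 4F ≡ + 0 × y 5F ≡ + 0
  byValue 0 e _ = sq≡0 (ℕ.m+n≡0⇒m≡0 (sq (y 2F)) e) , sq≡0 (ℕ.m+n≡0⇒m≡0 (sq (y 3F)) (ℕ.m+n≡0⇒n≡0 (sq (y 2F)) e)) ,
    sq≡0 (ℕ.m+n≡0⇒n≡0 (sq (y 3F)) (ℕ.m+n≡0⇒n≡0 (sq (y 2F)) e)) , sq≡0 y₅≡0
  byValue 1 e _ = ⊥-elim (true≢false (trans (sym (cong (par ∘ +_) e)) t-even))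
  byValue (suc (suc n)) _ (ℕ.s≤s ())

-- By Lagrange's identity the determinant of the first two vectors has square 1, so a vector
-- orthogonal to both is zero and cannot have norm 1.
no-orthonormal-triple : ∀ a b c d e f → a * a + b * b ≡ + 1 → c * c + d * d ≡ + 1 → e * e + f * f ≡ + 1 →
  a * c + b * d ≡ + 0 → a * e + b * f ≡ + 0 → c * e + d * f ≢ + 0
no-orthonormal-triple a b c d e f u v w o₁ o₂ o₃ = 0≢1 (trans (sym (trans (cong₂ (λ e f → e * e + f * f) e≡0 f≡0)
    refl)) w)
  where
  0≢1 : + 0 ≢ + 1
  0≢1 ()
  Δ : ℤ
  Δ = a * d - b * c
  Δ² : Δ * Δ ≡ + 1
  Δ² = trans (lagrange a b c d) (trans (cong₂ (λ s t → s - t * t) (cong₂ _*_ u v) o₁) refl)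
    where
    lagrange : ∀ a b c d → (a * d - b * c) * (a * d - b * c) ≡ (a * a + b * b) * (c * c + d * d) - (a * c + b * d) *
        (a * c + b * d)
    lagrange = solve-∀
  Δ≢0 : Δ ≢ + 0
  Δ≢0 z = 0≢1 (trans (sym (cong (λ t → t * t) z)) Δ²)
  kill : ∀ x → Δ * x ≡ + 0 → x ≡ + 0
  kill x z = [ (λ z → ⊥-elim (Δ≢0 z)) , (λ z → z) ]′ (ℤ.i*j≡0⇒i≡0∨j≡0 Δ z)
  e≡0 : e ≡ + 0
  e≡0 = kill e (trans (identity a b c d e f) (trans (cong₂ (λ s t → d * s - b * t) o₂ o₃) (zeros b d)))
    where
    identity : ∀ a b c d e f → (a * d - b * c) * e ≡ d * (a * e + b * f) - b * (c * e + d * f)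
    identity = solve-∀
    zeros : ∀ b d → d * + 0 - b * + 0 ≡ + 0
    zeros = solve-∀
  f≡0 : f ≡ + 0
  f≡0 = kill f (trans (identity a b c d e f) (trans (cong₂ (λ s t → a * t - c * s) o₂ o₃) (zeros a c)))
    where
    identity : ∀ a b c d e f → (a * d - b * c) * f ≡ a * (c * e + d * f) - c * (a * e + b * f)
    identity = solve-∀
    zeros : ∀ a c → a * + 0 - c * + 0 ≡ + 0
    zeros = solve-∀

L6-¬represents-I3 : ¬ Represents L6 (I 3)
L6-¬represents-I3 (T , gram) = no-orthonormal-triple (y 0F 0F) (y 0F 1F) (y 1F 0F) (y 1F 1F) (y 2F 0F) (y 2F 1F)
    (planar 0F 0F) (planar 1F 1F) (planar 2F 2F) (planar 0F 1F) (planar 0F 2F) (planar 1F 2F)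
  where
  y : Fin 3 → Vect 6
  y c = lincomb rootsInJ (T c)
  y·y : ∀ c d → B J (y c) (y d) ≡ I 3 c d
  y·y c d = trans (sym (L6-in-J (T c) (T d))) (gram c d)
  even : ∀ c → + 2 ∣ y c 2F + y c 3F + y c 4F
  even c = divides (T c 4F) (trans (cong₂ _+_ (cong₂ _+_ (lincomb-roots (T c) 2F) (lincomb-roots (T c) 3F))
      (lincomb-roots (T c) 4F)) (identity (T c 2F) (T c 3F) (T c 4F)))
    where
    identity : ∀ x y z → y + (x - y + z) + (z - x) ≡ z * + 2
    identity = solve-∀
  norms : ∀ c → I 3 c c ≡ + 1
  norms = from-yes (Fin.all? λ c → I 3 c c ℤ.≟ + 1)
  plane : ∀ c → y c 2F ≡ + 0 × y c 3F ≡ + 0 × y c 4F ≡ + 0 × y c 5F ≡ + 0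
  plane c = unit-in-plane (y c) (trans (y·y c c) (norms c)) (even c)
  planar : ∀ c d → y c 0F * y d 0F + y c 1F * y d 1F ≡ I 3 c d
  planar c d = reduce (plane c)
    where
    reduce : y c 2F ≡ + 0 × y c 3F ≡ + 0 × y c 4F ≡ + 0 × y c 5F ≡ + 0 → y c 0F * y d 0F + y c 1F * y d 1F ≡ I 3 c d
    reduce (z₂ , z₃ , z₄ , z₅) = trans (drop (y c 0F * y d 0F) (y c 1F * y d 1F) (y d 2F) (y d 3F) (y d 4F) (y d 5F))
      (trans (sym (cong (λ s → y c 0F * y d 0F + (y c 1F * y d 1F + s)) (cong₂ _+_ (cong (_* y d 2F) z₂) (cong₂ _+_
          (cong (_* y d 3F) z₃)
        (cong₂ _+_ (cong (_* y d 4F) z₄) (cong (λ t → + 3 * (t * y d 5F)) z₅)))))) (trans (sym (J-form (y c) (y d)))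
            (y·y c d)))
      where
      drop : ∀ a b p q r s → a + b ≡ a + (b + (+ 0 * p + (+ 0 * q + (+ 0 * r + + 3 * (+ 0 * s)))))
      drop = solve-∀

L6-isIsolation : IsIsolation L6 (I 3)
L6-isIsolation = (λ k v _ ¬spans → L6-represents-proper v ¬spans) , L6-¬represents-I3

-- More than n vectors in ℤⁿ are dependent

Dependent : ∀ {k n} → (Fin k → Vect n) → Set
Dependent {k} v = Σ (Vect k) λ c → (∃ λ i → c i ≢ + 0) × (∀ j → lincomb v c j ≡ + 0)

dependent : ∀ n {k} → n < k → (v : Fin k → Vect n) → Dependent v
dependent zero    (ℕ.s≤s _)    v = (λ _ → + 1) , (zero , +suc≢0) , λ ()
dependent (suc n) {suc k} (ℕ.s≤s n<k) v = pivot (Fin.any? λ i → nonzero? (v i zero))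
  where
  pivot : Dec (∃ λ i → v i zero ≢ + 0) → Dependent v
  pivot (no none) = prepend (dependent n (ℕ.m<n⇒m<1+n n<k) (λ i r → v i (suc r)))
    where
    column≡0 : ∀ i → v i zero ≡ + 0
    column≡0 i = ¬nonzero (λ vᵢ≢0 → none (i , vᵢ≢0))
    prepend : Dependent (λ i r → v i (suc r)) → Dependent v
    prepend (c , c≢0 , rel) = c , c≢0 , λ where
      zero    → sumF-0 (suc k) (λ i → trans (cong (c i *_) (column≡0 i)) (ℤ.*-zeroʳ (c i)))
      (suc r) → rel r
  pivot (yes (i , vᵢ≢0)) = extend (dependent n n<k w)
    where
    q : ℤ
    q = v i zero
    w : Fin k → Vect n
    w j r = q * v (punchIn i j) (suc r) + - v (punchIn i j) zero * v i (suc r)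
    extend : Dependent w → Dependent v
    extend (c , (j , c≢0) , rel) = c′ , (punchIn i j , λ e → *-nonZero c≢0 vᵢ≢0 (trans (sym (c′-punchIn j)) e)) ,
        relation
      where
      s : ℤ
      s = sumF k (λ j → c j * v (punchIn i j) zero)
      c′ : Vect (suc k)
      c′ = insertAt (λ j → c j * q) i (- s)
      c′-punchIn : ∀ j → c′ (punchIn i j) ≡ c j * q
      c′-punchIn j = insertAt-punchIn (λ j → c j * q) i (- s) j
      split : ∀ r → lincomb v c′ r ≡ - s * v i r + sumF k (λ j → c j * q * v (punchIn i j) r)
      split r = trans (sumF-punchIn k i (λ l → c′ l * v l r)) (cong₂ _+_ (cong (_* v i r) (insertAt-lookup (λ j → c j
          * q) i (- s)))
        (sumF-cong k (λ j → cong (_* v (punchIn i j) r) (c′-punchIn j))))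
      relation : ∀ r → lincomb v c′ r ≡ + 0
      relation zero = trans (split zero) (trans (+-congʳ (- s * q) (trans (sumF-cong k (λ j → swap (c j) q (v
          (punchIn i j) zero))) (sumF-*ˡ k q (λ j → c j * v (punchIn i j) zero)))) (cancel s q))
        where
        swap : ∀ c q v → c * q * v ≡ q * (c * v)
        swap = solve-∀
        cancel : ∀ s q → - s * q + q * s ≡ + 0
        cancel = solve-∀
      relation (suc r) = trans (split (suc r)) (trans (sym (trans (sumF-cong k (λ j → expand (c j) q (v (punchIn i j)
          (suc r)) (v (punchIn i j) zero) (v i (suc r))))
          (trans (sumF-+ k (λ j → - v i (suc r) * (c j * v (punchIn i j) zero)) (λ j → c j * q * v (punchIn i j) (suc
              r)))
            (cong (λ t → t + sumF k (λ j → c j * q * v (punchIn i j) (suc r))) (trans (sumF-*ˡ k (- v i (suc r)) (λ j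
                → c j * v (punchIn i j) zero)) (commute (v i (suc r)) s))))))
          (rel r))
        where
        expand : ∀ c q v v₀ u → c * (q * v + - v₀ * u) ≡ - u * (c * v₀) + c * q * v
        expand = solve-∀
        commute : ∀ u s → - u * s ≡ - s * u
        commute = solve-∀

-- Sublattices of I₃ forcing rank 6

-- The factor 3 is odd, so the norm 9 is odd, which the final parity argument relies on.
stretched : Fin 3 → Vect 3
stretched = rows ((+ 1 ∷ + 0 ∷ + 0 ∷ []) ∷ (+ 0 ∷ + 1 ∷ + 0 ∷ []) ∷ (+ 0 ∷ + 0 ∷ + 3 ∷ []) ∷ [])

roots : Fin 3 → Vect 3
roots = rows ((+ 0 ∷ + 1 ∷ -[1+ 0 ] ∷ []) ∷ (+ 1 ∷ -[1+ 0 ] ∷ + 0 ∷ []) ∷ (+ 0 ∷ + 1 ∷ + 1 ∷ []) ∷ [])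

stretched-comb : ∀ c r → lincomb stretched c r ≡ lookup (c 0F ∷ c 1F ∷ + 3 * c 2F ∷ []) r
stretched-comb c = λ where
    0F → e₀ (c 0F) (c 1F) (c 2F)
    1F → e₁ (c 0F) (c 1F) (c 2F)
    2F → e₂ (c 0F) (c 1F) (c 2F)
  where
  e₀ : ∀ a b c → a * + 1 + (b * + 0 + (c * + 0 + + 0)) ≡ a
  e₀ = solve-∀
  e₁ : ∀ a b c → a * + 0 + (b * + 1 + (c * + 0 + + 0)) ≡ b
  e₁ = solve-∀
  e₂ : ∀ a b c → a * + 0 + (b * + 0 + (c * + 3 + + 0)) ≡ + 3 * c
  e₂ = solve-∀

roots-comb : ∀ c r → lincomb roots c r ≡ lookup (c 1F ∷ c 0F - c 1F + c 2F ∷ c 2F - c 0F ∷ []) r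
roots-comb c = λ where
    0F → e₀ (c 0F) (c 1F) (c 2F)
    1F → e₁ (c 0F) (c 1F) (c 2F)
    2F → e₂ (c 0F) (c 1F) (c 2F)
  where
  e₀ : ∀ a b c → a * + 0 + (b * + 1 + (c * + 0 + + 0)) ≡ b
  e₀ = solve-∀
  e₁ : ∀ a b c → a * + 1 + (b * -[1+ 0 ] + (c * + 1 + + 0)) ≡ a - b + c
  e₁ = solve-∀
  e₂ : ∀ a b c → a * -[1+ 0 ] + (b * + 0 + (c * + 1 + + 0)) ≡ c - a
  e₂ = solve-∀

stretched-independent : LinIndep stretched
stretched-independent c e 0F = trans (sym (stretched-comb c 0F)) (e 0F)
stretched-independent c e 1F = trans (sym (stretched-comb c 1F)) (e 1F)
stretched-independent c e 2F = *-cancelˡ (+ 3) (c 2F) (+ 0) (λ ()) (trans (sym (stretched-comb c 2F)) (e 2F))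

stretched-proper : ¬ Spans stretched
stretched-proper sp = contradict (sp (λ _ → + 1))
  where
  contradict : ¬ (Σ (Vect 3) λ c → ∀ j → + 1 ≡ lincomb stretched c j)
  contradict (c , e) = from-no (+ 3 ∣? + 1) (divides (c 2F) (trans (e 2F) (trans (stretched-comb c 2F) (ℤ.*-comm (+
      3) (c 2F)))))

roots-independent : LinIndep roots
roots-independent c e = coords
  where
  c₁≡0 : c 1F ≡ + 0
  c₁≡0 = trans (sym (roots-comb c 0F)) (e 0F)
  c₂≡c₀ : c 2F ≡ c 0F
  c₂≡c₀ = ℤ.i-j≡0⇒i≡j (c 2F) (c 0F) (trans (sym (roots-comb c 2F)) (e 2F))
  c₀≡0 : c 0F ≡ + 0
  c₀≡0 = *-cancelˡ (+ 2) (c 0F) (+ 0) (λ ()) (trans (double (c 0F)) (trans (cong₂ (λ s t → c 0F - s + t) (sym c₁≡0)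
      (sym c₂≡c₀)) (trans (sym (roots-comb c 1F)) (e 1F))))
    where
    double : ∀ x → + 2 * x ≡ x - + 0 + x
    double = solve-∀
  coords : ∀ i → c i ≡ + 0
  coords 0F = c₀≡0
  coords 1F = c₁≡0
  coords 2F = trans c₂≡c₀ c₀≡0

roots-proper : ¬ Spans roots
roots-proper sp = contradict (sp (λ _ → + 1))
  where
  contradict : ¬ (Σ (Vect 3) λ c → ∀ j → + 1 ≡ lincomb roots c j)
  contradict (c , e) = from-no (+ 2 ∣? + 3) (divides (c 2F) (trans (cong₂ _+_ (e 0F) (cong₂ _+_ (e 1F) (e 2F)))
      (trans (cong₂ _+_ (roots-comb c 0F) (cong₂ _+_ (roots-comb c 1F) (roots-comb c 2F))) (identity (c 0F) (c 1F) (c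
          2F)))))
    where
    identity : ∀ a b c → b + ((a - b + c) + (c - a)) ≡ c * + 2
    identity = solve-∀

-- Roots in a lattice without a unit vector orthogonal to I₂

module LowerBound {n} (L : Mat n) (lattice : IsLattice L) (¬I₃ : ¬ Represents L (I 3)) where

  private
    sym-L : ∀ x y → B L x y ≡ B L y x
    sym-L = B-sym L (proj₁ lattice)

  norm-cases : ∀ x → (∀ i → x i ≡ + 0) ⊎ + 0 ℤ.< B L x x
  norm-cases x = decide (Fin.all? λ i → x i ℤ.≟ + 0)
    where
    decide : Dec (∀ i → x i ≡ + 0) → (∀ i → x i ≡ + 0) ⊎ + 0 ℤ.< B L x x
    decide (yes z) = inj₁ z
    decide (no nz) = inj₂ (proj₂ lattice x nz)

  module Plane (e₁ e₂ : Vect n) (e₁₁ : B L e₁ e₁ ≡ + 1) (e₁₂ : B L e₁ e₂ ≡ + 0) (e₂₂ : B L e₂ e₂ ≡ + 1) where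

    no-unit : ∀ y → B L e₁ y ≡ + 0 → B L e₂ y ≡ + 0 → B L y y ≢ + 1
    no-unit y o₁ o₂ u = ¬I₃ (T , gram)
      where
      T : Fin 3 → Vect n
      T 0F = e₁
      T 1F = e₂
      T 2F = y
      gram : ∀ i j → B L (T i) (T j) ≡ I 3 i j
      gram 0F 0F = e₁₁
      gram 0F 1F = e₁₂
      gram 0F 2F = o₁
      gram 1F 0F = trans (sym-L e₂ e₁) e₁₂
      gram 1F 1F = e₂₂
      gram 1F 2F = o₂
      gram 2F 0F = trans (sym-L y e₁) o₁
      gram 2F 1F = trans (sym-L y e₂) o₂
      gram 2F 2F = u

    module Root (α : Vect n) (norm : B L α α ≡ + 2) where

      m₁ m₂ : ℤ
      m₁ = B L e₁ α
      m₂ = B L e₂ α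

      plane rest : Vect n
      plane j = m₁ * e₁ j + m₂ * e₂ j
      rest  j = + 1 * α j + - + 1 * plane j

      e₁·plane : B L e₁ plane ≡ m₁
      e₁·plane = trans (B-combʳ L m₁ e₁ m₂ e₂ e₁) (trans (cong₂ (λ s t → m₁ * s + m₂ * t) e₁₁ e₁₂) (tidy m₁ m₂))
        where
        tidy : ∀ a b → a * + 1 + b * + 0 ≡ a
        tidy = solve-∀

      e₂·plane : B L e₂ plane ≡ m₂
      e₂·plane = trans (B-combʳ L m₁ e₁ m₂ e₂ e₂) (trans (cong₂ (λ s t → m₁ * s + m₂ * t) (trans (sym-L e₂ e₁) e₁₂)
          e₂₂) (tidy m₁ m₂))
        where
        tidy : ∀ a b → a * + 0 + b * + 1 ≡ b
        tidy = solve-∀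

      plane·α : B L plane α ≡ m₁ * m₁ + m₂ * m₂
      plane·α = B-combˡ L m₁ e₁ m₂ e₂ α

      plane·plane : B L plane plane ≡ m₁ * m₁ + m₂ * m₂
      plane·plane = trans (B-combˡ L m₁ e₁ m₂ e₂ plane) (cong₂ (λ s t → m₁ * s + m₂ * t) e₁·plane e₂·plane)

      rest·rest : B L rest rest ≡ + 2 - (m₁ * m₁ + m₂ * m₂)
      rest·rest = trans (B-comb₂ L (+ 1) α (- + 1) plane (+ 1) α (- + 1) plane)
        (cancel norm (trans (sym-L α plane) plane·α) plane·α plane·plane)
        where
        cancel : ∀ {a b c d s} → a ≡ + 2 → b ≡ s → c ≡ s → d ≡ s →
          + 1 * + 1 * a + + 1 * - + 1 * b + - + 1 * + 1 * c + - + 1 * - + 1 * d ≡ + 2 - s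
        cancel {s = s} refl refl refl refl = identity s
          where
          identity : ∀ s → + 1 * + 1 * + 2 + + 1 * - + 1 * s + - + 1 * + 1 * s + - + 1 * - + 1 * s ≡ + 2 - s
          identity = solve-∀

      e₁·rest : B L e₁ rest ≡ + 0
      e₁·rest = trans (B-combʳ L (+ 1) α (- + 1) plane e₁) (trans (cong (λ t → + 1 * m₁ + - + 1 * t) e₁·plane)
          (cancel m₁))
        where
        cancel : ∀ m → + 1 * m + - + 1 * m ≡ + 0
        cancel = solve-∀

      e₂·rest : B L e₂ rest ≡ + 0
      e₂·rest = trans (B-combʳ L (+ 1) α (- + 1) plane e₂) (trans (cong (λ t → + 1 * m₂ + - + 1 * t) e₂·plane)
          (cancel m₂))
        where
        cancel : ∀ m → + 1 * m + - + 1 * m ≡ + 0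
        cancel = solve-∀

      Orthogonal InPlane : Set
      Orthogonal = m₁ ≡ + 0 × m₂ ≡ + 0
      InPlane    = ∀ β → B L α β ≡ m₁ * B L e₁ β + m₂ * B L e₂ β

      -- The projection `rest` of α orthogonal to the plane has norm 2 - (m₁² + m₂²), so m₁² + m₂²
      -- is at most 2. The value 1 would make `rest` a unit vector orthogonal to I₂. Hence the value
      -- is 0 or 2, which is even, and for 2 the vector `rest` vanishes.
      kind : par m₁ ≡ par m₂ × (Orthogonal ⊎ InPlane)
      kind = bySize (sq m₁ ℕ.+ sq m₂) refl
        where
        rest-norm : ∀ s → sq m₁ ℕ.+ sq m₂ ≡ s → B L rest rest ≡ + 2 - + s
        rest-norm s e = trans rest·rest (cong (λ t → + 2 - t) (trans (cong₂ _+_ (+sq m₁) (+sq m₂)) (cong +_ e)))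
        parity≡ : ∀ s → sq m₁ ℕ.+ sq m₂ ≡ s → par (+ s) ≡ false → par m₁ ≡ par m₂
        parity≡ s e ev = xor-false (par m₁) (par m₂) (cong not (trans (sym (trans (par-+ (m₁ * m₁) (m₂ * m₂)) (cong₂
            _xor_ (self m₁) (self m₂))))
          (trans (cong par (trans (cong₂ _+_ (+sq m₁) (+sq m₂)) (cong +_ e))) ev)))
          where
          self : ∀ m → par (m * m) ≡ par m
          self m = trans (par-* m m) (Bool.∧-idem (par m))
        inPlane : (∀ i → rest i ≡ + 0) → InPlane
        inPlane z β = trans (B-congˡ L {α} {plane} β α≡) (B-combˡ L m₁ e₁ m₂ e₂ β)
          where
          α≡ : ∀ i → α i ≡ plane i
          α≡ i = ℤ.i-j≡0⇒i≡j (α i) (plane i) (trans (regroup (α i) (plane i)) (z i))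
            where
            regroup : ∀ a b → a - b ≡ + 1 * a + - + 1 * b
            regroup = solve-∀
        bySize : ∀ s → sq m₁ ℕ.+ sq m₂ ≡ s → par m₁ ≡ par m₂ × (Orthogonal ⊎ InPlane)
        bySize 0 e = parity≡ 0 e refl , inj₁ (sq≡0 (ℕ.m+n≡0⇒m≡0 (sq m₁) e) , sq≡0 (ℕ.m+n≡0⇒n≡0 (sq m₁) e))
        bySize 1 e = ⊥-elim (no-unit rest e₁·rest e₂·rest (rest-norm 1 e))
        bySize 2 e = parity≡ 2 e refl , inj₂ (inPlane ([ (λ z → z) , (λ pos → ⊥-elim (ℤ.<-irrefl refl (subst (+ 0
            ℤ.<_) (rest-norm 2 e) pos))) ]′ (norm-cases rest)))
        bySize (suc (suc (suc s))) e = ⊥-elim ([ (λ z → -≢0 (trans (sym (rest-norm _ e)) (B-0ˡ L rest z))) , (λ pos →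
            0≮- (subst (+ 0 ℤ.<_) (rest-norm _ e) pos)) ]′ (norm-cases rest))
          where
          -≢0 : + 2 - + suc (suc (suc s)) ≢ + 0
          -≢0 ()
          0≮- : ¬ (+ 0 ℤ.< + 2 - + suc (suc (suc s)))
          0≮- ()

    -- If α lay in the plane, α·β would be a sum of two products, congruent modulo 2 because each
    -- root has products of equal parity with e₁ and e₂. It would then be even, but it is -1.
    orthogonal-root : ∀ α β (norm-α : B L α α ≡ + 2) (norm-β : B L β β ≡ + 2) → B L α β ≡ -[1+ 0 ] → B L e₁ α ≡ + 0 ×
        B L e₂ α ≡ + 0
    orthogonal-root α β norm-α norm-β α·β = [ (λ z → z) , (λ inPlane → ⊥-elim (true≢false (trans (sym (cong par α·β))
        (evenProduct inPlane)))) ]′ (proj₂ A.kind)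
      where
      module A = Root α norm-α
      module Β = Root β norm-β
      evenProduct : A.InPlane → par (B L α β) ≡ false
      evenProduct inPlane = trans (cong par (inPlane β)) (trans (par-+ (A.m₁ * Β.m₁) (A.m₂ * Β.m₂))
        (trans (cong₂ _xor_ (trans (par-* A.m₁ Β.m₁) (cong₂ _∧_ (proj₁ A.kind) (proj₁ Β.kind))) (par-* A.m₂ Β.m₂))
            (Bool.xor-same (par A.m₂ ∧ par Β.m₂))))

  module SixVectors (S R : Fin 3 → Vect n) (S-gram : ∀ i j → B L (S i) (S j) ≡ subGram (I 3) stretched i j)
    (R-gram : ∀ i j → B L (R i) (R j) ≡ subGram (I 3) roots i j) where

    open Plane (S 0F) (S 1F) (S-gram 0F 0F) (S-gram 0F 1F) (S-gram 1F 1F)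

    b : Fin 3 → ℤ
    b j = B L (S 2F) (R j)

    cross : Fin 3 → Fin 3 → ℤ
    cross 0F j = + 0
    cross 1F j = + 0
    cross 2F j = b j

    R⊥ : ∀ j → B L (S 0F) (R j) ≡ + 0 × B L (S 1F) (R j) ≡ + 0
    R⊥ 0F = orthogonal-root (R 0F) (R 1F) (R-gram 0F 0F) (R-gram 1F 1F) (R-gram 0F 1F)
    R⊥ 1F = orthogonal-root (R 1F) (R 0F) (R-gram 1F 1F) (R-gram 0F 0F) (R-gram 1F 0F)
    R⊥ 2F = orthogonal-root (R 2F) (R 1F) (R-gram 2F 2F) (R-gram 1F 1F) (R-gram 2F 1F)

    cross-gram : ∀ i j → B L (S i) (R j) ≡ cross i j
    cross-gram 0F j = proj₁ (R⊥ j)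
    cross-gram 1F j = proj₂ (R⊥ j)
    cross-gram 2F j = refl

    vectors : Fin 3 ⊎ Fin 3 → Vect n
    vectors = [ S , R ]′

    gram : Fin 3 ⊎ Fin 3 → Fin 3 ⊎ Fin 3 → ℤ
    gram (inj₁ i) (inj₁ j) = subGram (I 3) stretched i j
    gram (inj₁ i) (inj₂ j) = cross i j
    gram (inj₂ i) (inj₁ j) = cross j i
    gram (inj₂ i) (inj₂ j) = subGram (I 3) roots i j

    gram-correct : ∀ s t → B L (vectors s) (vectors t) ≡ gram s t
    gram-correct (inj₁ i) (inj₁ j) = S-gram i j
    gram-correct (inj₁ i) (inj₂ j) = cross-gram i j
    gram-correct (inj₂ i) (inj₁ j) = trans (sym-L (R i) (S j)) (cross-gram j i)
    gram-correct (inj₂ i) (inj₂ j) = R-gram i j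

    F : Fin 6 → Vect n
    F i = vectors (Fin.splitAt 3 i)

    row : Vect 6 → Fin 6 → ℤ
    row c j = sumF 6 (λ i → c i * gram (Fin.splitAt 3 i) (Fin.splitAt 3 j))

    row-correct : ∀ c j → B L (lincomb F c) (F j) ≡ row c j
    row-correct c j = trans (B-lincombˡ L F c (F j)) (sumF-cong 6 (λ i → cong (c i *_) (gram-correct (Fin.splitAt 3
        i) (Fin.splitAt 3 j))))

    -- The equations b j = ξ·`roots j` read b₀ = ξ₂ - ξ₃, b₁ = ξ₁ - ξ₂ and b₂ = ξ₂ + ξ₃; solving
    -- them for 2ξ gives these expressions.
    X₁ X₂ X₃ : ℤ
    X₁ = + 2 * b 1F + b 0F + b 2F
    X₂ = b 0F + b 2F
    X₃ = b 2F - b 0F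

    -- The coordinates of 2x in ℤ³ ⊇ D₃: a relation among the six vectors puts x into the span of the roots.
    norm-36 : (∃ λ (c : Vect 6) → (∃ λ i → c i ≢ + 0) × (∀ j → lincomb F c j ≡ + 0)) → X₁ * X₁ + (X₂ * X₂ + X₃ * X₃)
        ≡ + 36
    norm-36 (c , (i , cᵢ≢0) , rel) = *-cancelˡ (γ * γ) (X₁ * X₁ + (X₂ * X₂ + X₃ * X₃)) (+ 36) (*-nonZero γ≢0 γ≢0)
        (trans (spread γ X₁ X₂ X₃) (trans (cong₂ _+_ (square γX₁) (cong₂ _+_ (square γX₂) (square γX₃)))
          (trans (norms l₁ l₂ l₃) (trans (cong (λ t → + 4 * t) (sym 9γ²)) (assoc γ)))))
      where
      row≡0 : ∀ j → row c j ≡ + 0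
      row≡0 j = trans (sym (row-correct c j)) (B-0ˡ L (F j) rel)
      γ l₁ l₂ l₃ : ℤ
      γ  = c 2F
      l₁ = c 3F
      l₂ = c 4F
      l₃ = c 5F
      square : ∀ {x y} → x ≡ y → x * x ≡ y * y
      square refl = refl
      assoc : ∀ γ → + 4 * (γ * γ * + 9) ≡ γ * γ * + 36
      assoc = solve-∀
      spread : ∀ γ a b c → γ * γ * (a * a + (b * b + c * c)) ≡ γ * a * (γ * a) + (γ * b * (γ * b) + γ * c * (γ * c))
      spread = solve-∀
      eq-e₁ : c 0F ≡ + 0
      eq-e₁ = trans (simplify (c 0F) (c 1F) γ l₁ l₂ l₃) (row≡0 0F)
        where
        simplify : ∀ a b c d e f → a ≡ a * + 1 + (b * + 0 + (c * + 0 + (d * + 0 + (e * + 0 + (f * + 0 + + 0)))))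
        simplify = solve-∀
      eq-e₂ : c 1F ≡ + 0
      eq-e₂ = trans (simplify (c 0F) (c 1F) γ l₁ l₂ l₃) (row≡0 1F)
        where
        simplify : ∀ a b c d e f → b ≡ a * + 0 + (b * + 1 + (c * + 0 + (d * + 0 + (e * + 0 + (f * + 0 + + 0)))))
        simplify = solve-∀
      eq-x : γ * + 9 + (l₁ * b 0F + (l₂ * b 1F + l₃ * b 2F)) ≡ + 0
      eq-x = trans (simplify (c 0F) (c 1F) γ l₁ l₂ l₃ (b 0F) (b 1F) (b 2F)) (row≡0 2F)
        where
        simplify : ∀ a b c d e f s t u → c * + 9 + (d * s + (e * t + f * u)) ≡ a * + 0 + (b * + 0 + (c * + 9 + (d * s
            + (e * t + (f * u + + 0)))))
        simplify = solve-∀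
      eq-α₁ : γ * b 0F + (+ 2 * l₁ - l₂) ≡ + 0
      eq-α₁ = trans (simplify (c 0F) (c 1F) γ l₁ l₂ l₃ (b 0F)) (row≡0 3F)
        where
        simplify : ∀ a b c d e f s → c * s + (+ 2 * d - e) ≡ a * + 0 + (b * + 0 + (c * s + (d * + 2 + (e * -[1+ 0 ] +
            (f * + 0 + + 0)))))
        simplify = solve-∀
      eq-α₂ : γ * b 1F + (+ 2 * l₂ - l₁ - l₃) ≡ + 0
      eq-α₂ = trans (simplify (c 0F) (c 1F) γ l₁ l₂ l₃ (b 1F)) (row≡0 4F)
        where
        simplify : ∀ a b c d e f s → c * s + (+ 2 * e - d - f) ≡ a * + 0 + (b * + 0 + (c * s + (d * -[1+ 0 ] + (e * +
            2 + (f * -[1+ 0 ] + + 0)))))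
        simplify = solve-∀
      eq-α₃ : γ * b 2F + (+ 2 * l₃ - l₂) ≡ + 0
      eq-α₃ = trans (simplify (c 0F) (c 1F) γ l₁ l₂ l₃ (b 2F)) (row≡0 5F)
        where
        simplify : ∀ a b c d e f s → c * s + (+ 2 * f - e) ≡ a * + 0 + (b * + 0 + (c * s + (d * + 0 + (e * -[1+ 0 ] +
            (f * + 2 + + 0)))))
        simplify = solve-∀
      γb₁ : γ * b 0F ≡ l₂ - + 2 * l₁
      γb₁ = trans (isolate (γ * b 0F) l₁ l₂) (trans (cong (λ t → t + (l₂ - + 2 * l₁)) eq-α₁) (ℤ.+-identityˡ (l₂ - + 2
          * l₁)))
        where
        isolate : ∀ x l m → x ≡ x + (+ 2 * l - m) + (m - + 2 * l)
        isolate = solve-∀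
      γb₂ : γ * b 1F ≡ l₁ + l₃ - + 2 * l₂
      γb₂ = trans (isolate (γ * b 1F) l₁ l₂ l₃) (trans (cong (λ t → t + (l₁ + l₃ - + 2 * l₂)) eq-α₂) (ℤ.+-identityˡ
          (l₁ + l₃ - + 2 * l₂)))
        where
        isolate : ∀ x l m n → x ≡ x + (+ 2 * m - l - n) + (l + n - + 2 * m)
        isolate = solve-∀
      γb₃ : γ * b 2F ≡ l₂ - + 2 * l₃
      γb₃ = trans (isolate (γ * b 2F) l₃ l₂) (trans (cong (λ t → t + (l₂ - + 2 * l₃)) eq-α₃) (ℤ.+-identityˡ (l₂ - + 2
          * l₃)))
        where
        isolate : ∀ x l m → x ≡ x + (+ 2 * l - m) + (m - + 2 * l)
        isolate = solve-∀
      γX₁ : γ * X₁ ≡ - (+ 2 * l₂)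
      γX₁ = trans (expand γ (b 0F) (b 1F) (b 2F)) (trans (cong₂ _+_ (cong₂ (λ s t → + 2 * s + t) γb₂ γb₁) γb₃)
          (collect l₁ l₂ l₃))
        where
        expand : ∀ γ s t u → γ * (+ 2 * t + s + u) ≡ + 2 * (γ * t) + γ * s + γ * u
        expand = solve-∀
        collect : ∀ l m n → + 2 * (l + n - + 2 * m) + (m - + 2 * l) + (m - + 2 * n) ≡ - (+ 2 * m)
        collect = solve-∀
      γX₂ : γ * X₂ ≡ + 2 * (l₂ - l₁ - l₃)
      γX₂ = trans (ℤ.*-distribˡ-+ γ (b 0F) (b 2F)) (trans (cong₂ _+_ γb₁ γb₃) (collect l₁ l₂ l₃))
        where
        collect : ∀ l m n → (m - + 2 * l) + (m - + 2 * n) ≡ + 2 * (m - l - n)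
        collect = solve-∀
      γX₃ : γ * X₃ ≡ + 2 * (l₁ - l₃)
      γX₃ = trans (expand γ (b 2F) (b 0F)) (trans (cong₂ _-_ γb₃ γb₁) (collect l₁ l₂ l₃))
        where
        expand : ∀ γ s t → γ * (s - t) ≡ γ * s - γ * t
        expand = solve-∀
        collect : ∀ l m n → (m - + 2 * n) - (m - + 2 * l) ≡ + 2 * (l - n)
        collect = solve-∀
      norms : ∀ l m n → - (+ 2 * m) * - (+ 2 * m) + (+ 2 * (m - l - n) * (+ 2 * (m - l - n)) + + 2 * (l - n) * (+ 2 *
          (l - n))) ≡
        + 4 * - (l * (m - + 2 * l) + (m * (l + n - + 2 * m) + n * (m - + 2 * n)))
      norms = solve-∀
      9γ² : γ * γ * + 9 ≡ - (l₁ * (l₂ - + 2 * l₁) + (l₂ * (l₁ + l₃ - + 2 * l₂) + l₃ * (l₂ - + 2 * l₃)))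
      9γ² = trans (isolate γ l₁ l₂ l₃ (b 0F) (b 1F) (b 2F)) (trans (cong (λ t → γ * t - (l₁ * (γ * b 0F) + (l₂ * (γ *
          b 1F) + l₃ * (γ * b 2F)))) eq-x)
        (trans (cong₂ (λ s t → γ * + 0 - (l₁ * s + t)) γb₁ (cong₂ (λ s t → l₂ * s + l₃ * t) γb₂ γb₃)) (drop γ _)))
        where
        isolate : ∀ γ l m n s t u → γ * γ * + 9 ≡ γ * (γ * + 9 + (l * s + (m * t + n * u))) - (l * (γ * s) + (m * (γ
            * t) + n * (γ * u)))
        isolate = solve-∀
        drop : ∀ γ x → γ * + 0 - x ≡ - x
        drop = solve-∀
      -- With γ = 0 the three equations for the roots put (l₁, l₂, l₃) into the kernel of the
      -- nonsingular matrix `A3`, and the whole relation becomes trivial.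
      γ≢0 : γ ≢ + 0
      γ≢0 z = cᵢ≢0 (vanish i)
        where
        pad : ∀ b x → x ≡ + 0 * b + x
        pad = solve-∀
        2l₁≡l₂ : + 2 * l₁ ≡ l₂
        2l₁≡l₂ = ℤ.i-j≡0⇒i≡j (+ 2 * l₁) l₂ (trans (pad (b 0F) (+ 2 * l₁ - l₂)) (trans (cong (λ γ → γ * b 0F + (+ 2 *
            l₁ - l₂)) (sym z)) eq-α₁))
        2l₃≡l₂ : + 2 * l₃ ≡ l₂
        2l₃≡l₂ = ℤ.i-j≡0⇒i≡j (+ 2 * l₃) l₂ (trans (pad (b 2F) (+ 2 * l₃ - l₂)) (trans (cong (λ γ → γ * b 2F + (+ 2 *
            l₃ - l₂)) (sym z)) eq-α₃))
        l₂≡0 : l₂ ≡ + 0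
        l₂≡0 = *-cancelˡ (+ 2) l₂ (+ 0) (λ ()) (trans (expand l₁ l₂ l₃) (trans (cong₂ (λ s t → + 2 * (+ 2 * l₂ - l₁ -
            l₃) + (s - l₂) + (t - l₂)) 2l₁≡l₂ 2l₃≡l₂)
            (trans (cong (λ t → + 2 * t + (l₂ - l₂) + (l₂ - l₂)) (trans (pad (b 1F) (+ 2 * l₂ - l₁ - l₃)) (trans
                (cong (λ γ → γ * b 1F + (+ 2 * l₂ - l₁ - l₃)) (sym z)) eq-α₂))) (cancel l₂))))
          where
          expand : ∀ l m n → + 2 * m ≡ + 2 * (+ 2 * m - l - n) + (+ 2 * l - m) + (+ 2 * n - m)
          expand = solve-∀
          cancel : ∀ m → + 2 * + 0 + (m - m) + (m - m) ≡ + 0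
          cancel = solve-∀
        vanish : ∀ i → c i ≡ + 0
        vanish 0F = eq-e₁
        vanish 1F = eq-e₂
        vanish 2F = z
        vanish 3F = *-cancelˡ (+ 2) l₁ (+ 0) (λ ()) (trans 2l₁≡l₂ l₂≡0)
        vanish 4F = l₂≡0
        vanish 5F = *-cancelˡ (+ 2) l₃ (+ 0) (λ ()) (trans 2l₃≡l₂ l₂≡0)

module Contradiction {n} (n<6 : n < 6) (L : Mat n) (lattice : IsLattice L) (¬I₃ : ¬ Represents L (I 3)) (S R : Fin 3
    → Vect n)
  (S-gram : ∀ i j → B L (S i) (S j) ≡ subGram (I 3) stretched i j) (R-gram : ∀ i j → B L (R i) (R j) ≡ subGram (I 3)
      roots i j) where

  open LowerBound L lattice ¬I₃
  open SixVectors S R S-gram R-gram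
  open Plane (S 0F) (S 1F) (S-gram 0F 0F) (S-gram 0F 1F) (S-gram 1F 1F)

  norm≡36 : X₁ * X₁ + (X₂ * X₂ + X₃ * X₃) ≡ + 36
  norm≡36 = norm-36 (dependent n n<6 F)

  -- The three Xᵢ have the same parity, so the sum of their squares is congruent to X₂ modulo 2, and
  -- 36 is even. Hence ξ is integral.
  X₂-even : par X₂ ≡ false
  X₂-even = trans (sym sameParity) (cong par norm≡36)
    where
    par-X₁ : par X₁ ≡ par X₂
    par-X₁ = trans (cong par (ℤ.+-assoc (+ 2 * b 1F) (b 0F) (b 2F))) (trans (par-+ (+ 2 * b 1F) X₂) (cong (_xor par
        X₂) (par-* (+ 2) (b 1F))))
    par-X₃ : par X₃ ≡ par X₂
    par-X₃ = trans (par-+ (b 2F) (- b 0F)) (trans (cong (par (b 2F) xor_) (par-neg (b 0F))) (trans (Bool.xor-comm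
        (par (b 2F)) (par (b 0F))) (sym (par-+ (b 0F) (b 2F)))))
    self : ∀ x → par (x * x) ≡ par x
    self x = trans (par-* x x) (Bool.∧-idem (par x))
    sameParity : par (X₁ * X₁ + (X₂ * X₂ + X₃ * X₃)) ≡ par X₂
    sameParity = trans (par-+ (X₁ * X₁) (X₂ * X₂ + X₃ * X₃)) (trans (cong₂ _xor_ (trans (self X₁) par-X₁)
      (trans (par-+ (X₂ * X₂) (X₃ * X₃)) (trans (cong₂ _xor_ (self X₂) (trans (self X₃) par-X₃)) (Bool.xor-same (par
          X₂))))) (Bool.xor-identityʳ (par X₂)))

  -- Subtract from x the element ξ - (1,0,0) of D₃, where ξ ∈ ℤ³ are the coordinates of x: the difference is a unit vector.
  contradiction : (∃[ x ] X₂ ≡ x * + 2) → Empty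
  contradiction (x , X₂≡) = withHalf (odd⇒ oddSum)
    where
    ξ₁ ξ₃ : ℤ
    ξ₁ = b 1F + x
    ξ₃ = x - b 0F
    b₂≡ : b 2F ≡ + 2 * x - b 0F
    b₂≡ = trans (isolate (b 0F) (b 2F)) (trans (cong (λ t → t - b 0F) X₂≡) (cong (λ t → t - b 0F) (ℤ.*-comm x (+ 2))))
      where
      isolate : ∀ s u → u ≡ s + u - s
      isolate = solve-∀
    norm≡9 : ξ₁ * ξ₁ + (x * x + ξ₃ * ξ₃) ≡ + 9
    norm≡9 = *-cancelˡ (+ 4) (ξ₁ * ξ₁ + (x * x + ξ₃ * ξ₃)) (+ 9) (λ ()) (trans (expand (b 0F) (b 1F) x)
        (trans (sym (cong (λ u → (+ 2 * b 1F + b 0F + u) * (+ 2 * b 1F + b 0F + u) + ((b 0F + u) * (b 0F + u) + (u -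
            b 0F) * (u - b 0F))) b₂≡)) norm≡36))
      where
      expand : ∀ s t x → + 4 * ((t + x) * (t + x) + (x * x + (x - s) * (x - s))) ≡
        (+ 2 * t + s + (+ 2 * x - s)) * (+ 2 * t + s + (+ 2 * x - s)) + ((s + (+ 2 * x - s)) * (s + (+ 2 * x - s)) +
            (+ 2 * x - s - s) * (+ 2 * x - s - s))
      expand = solve-∀
    self : ∀ x → par (x * x) ≡ par x
    self x = trans (par-* x x) (Bool.∧-idem (par x))
    oddSum : par (ξ₁ + (x + ξ₃)) ≡ true
    oddSum = trans (sym (trans (par-+ (ξ₁ * ξ₁) (x * x + ξ₃ * ξ₃)) (trans (cong₂ _xor_ (self ξ₁) (trans (par-+ (x *
        x) (ξ₃ * ξ₃)) (trans (cong₂ _xor_ (self x) (self ξ₃)) (sym (par-+ x ξ₃)))))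
      (sym (par-+ ξ₁ (x + ξ₃)))))) (cong par norm≡9)
    withHalf : (∃[ d ] ξ₁ + (x + ξ₃) ≡ + 2 * d + + 1) → Empty
    withHalf (d , sum≡) = no-unit y (trans (sym-L (S 0F) y) (trans (row-correct c 0F) row₀)) (trans (sym-L (S 1F) y)
        (trans (row-correct c 1F) row₁)) unit
      where
      sym-L = B-sym L (proj₁ lattice)
      s : ℤ
      s = b 0F
      b₁≡ : b 1F ≡ + 2 * d + + 1 - + 3 * x + s
      b₁≡ = trans (isolate (b 1F) x s) (cong (λ t → t - + 3 * x + s) sum≡)
        where
        isolate : ∀ t x s → t ≡ (t + x) + (x + (x - s)) - + 3 * x + s
        isolate = solve-∀
      -- By `roots-comb`, d₁, d₂, d are the coefficients of ξ - (1,0,0) with respect to `roots`; its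
      -- coordinate sum is 2d.
      d₁ d₂ : ℤ
      d₁ = d - x + s
      d₂ = + 2 * d - + 2 * x + s
      c : Vect 6
      c = lookup (+ 0 ∷ + 0 ∷ + 1 ∷ - d₁ ∷ - d₂ ∷ - d ∷ [])
      y : Vect n
      y = lincomb F c
      row₀ : row c 0F ≡ + 0
      row₀ = zeros (- d₁) (- d₂) (- d)
        where
        zeros : ∀ e f g → + 0 * + 1 + (+ 0 * + 0 + (+ 1 * + 0 + (e * + 0 + (f * + 0 + (g * + 0 + + 0))))) ≡ + 0
        zeros = solve-∀
      row₁ : row c 1F ≡ + 0
      row₁ = zeros (- d₁) (- d₂) (- d)
        where
        zeros : ∀ e f g → + 0 * + 0 + (+ 0 * + 1 + (+ 1 * + 0 + (e * + 0 + (f * + 0 + (g * + 0 + + 0))))) ≡ + 0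
        zeros = solve-∀
      row₂ : row c 2F ≡ + 9 - d₁ * b 0F - d₂ * b 1F - d * b 2F
      row₂ = simplify d₁ d₂ d (b 0F) (b 1F) (b 2F)
        where
        simplify : ∀ e f g s t u → + 0 * + 0 + (+ 0 * + 0 + (+ 1 * + 9 + (- e * s + (- f * t + (- g * u + + 0))))) ≡
            + 9 - e * s - f * t - g * u
        simplify = solve-∀
      row₃ : row c 3F ≡ b 0F - + 2 * d₁ + d₂
      row₃ = simplify d₁ d₂ d (b 0F)
        where
        simplify : ∀ e f g s → + 0 * + 0 + (+ 0 * + 0 + (+ 1 * s + (- e * + 2 + (- f * -[1+ 0 ] + (- g * + 0 + +
            0))))) ≡ s - + 2 * e + f
        simplify = solve-∀
      row₄ : row c 4F ≡ b 1F + d₁ - + 2 * d₂ + d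
      row₄ = simplify d₁ d₂ d (b 1F)
        where
        simplify : ∀ e f g s → + 0 * + 0 + (+ 0 * + 0 + (+ 1 * s + (- e * -[1+ 0 ] + (- f * + 2 + (- g * -[1+ 0 ] + +
            0))))) ≡ s + e - + 2 * f + g
        simplify = solve-∀
      row₅ : row c 5F ≡ b 2F + d₂ - + 2 * d
      row₅ = simplify d₁ d₂ d (b 2F)
        where
        simplify : ∀ e f g s → + 0 * + 0 + (+ 0 * + 0 + (+ 1 * s + (- e * + 0 + (- f * -[1+ 0 ] + (- g * + 2 + +
            0))))) ≡ s + f - + 2 * g
        simplify = solve-∀
      norm : B L y y ≡ (+ 9 - d₁ * b 0F - d₂ * b 1F - d * b 2F) - d₁ * (b 0F - + 2 * d₁ + d₂) - d₂ * (b 1F + d₁ - + 2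
          * d₂ + d) - d * (b 2F + d₂ - + 2 * d)
      norm = trans (B-lincombʳ L F c y) (trans (sumF-cong 6 (λ j → cong (c j *_) (row-correct c j)))
        (combine d₁ d₂ d {row c 0F} {row c 1F} {row c 2F} {row c 3F} {row c 4F} {row c 5F} row₂ row₃ row₄ row₅))
        where
        combine : ∀ e f g {r₀ r₁ r₂ r₃ r₄ r₅ s₂ s₃ s₄ s₅} → r₂ ≡ s₂ → r₃ ≡ s₃ → r₄ ≡ s₄ → r₅ ≡ s₅ →
          + 0 * r₀ + (+ 0 * r₁ + (+ 1 * r₂ + (- e * r₃ + (- f * r₄ + (- g * r₅ + + 0))))) ≡ s₂ - e * s₃ - f * s₄ - g
              * s₅
        combine e f g {r₀} {r₁} {r₂} {r₃} {r₄} {r₅} refl refl refl refl = identity e f g r₀ r₁ r₂ r₃ r₄ r₅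
          where
          identity : ∀ e f g r₀ r₁ r₂ r₃ r₄ r₅ → + 0 * r₀ + (+ 0 * r₁ + (+ 1 * r₂ + (- e * r₃ + (- f * r₄ + (- g * r₅
              + + 0))))) ≡ r₂ - e * r₃ - f * r₄ - g * r₅
          identity = solve-∀
      -- Since `S 2F` pairs with the roots as ξ does, y has norm 9 - 2ξ·(ξ - e) + |ξ - e|² = 10 -
      -- |ξ|² with e = (1,0,0). The bound on the rank enters through |ξ|² = 9.
      unit : B L y y ≡ + 1
      unit = trans norm (trans (cong₂ (λ t u → (+ 9 - d₁ * s - d₂ * t - d * u) - d₁ * (s - + 2 * d₁ + d₂) - d₂ * (t +
          d₁ - + 2 * d₂ + d) - d * (u + d₂ - + 2 * d)) b₁≡ b₂≡)
        (trans (identity s x d) (cong (λ t → + 10 - t) (trans (sym (cong (λ t → (t + x) * (t + x) + (x * x + ξ₃ *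
            ξ₃)) b₁≡)) norm≡9))))
        where
        identity : ∀ s x d →
          (+ 9 - (d - x + s) * s - (+ 2 * d - + 2 * x + s) * (+ 2 * d + + 1 - + 3 * x + s) - d * (+ 2 * x - s))
            - (d - x + s) * (s - + 2 * (d - x + s) + (+ 2 * d - + 2 * x + s))
            - (+ 2 * d - + 2 * x + s) * (+ 2 * d + + 1 - + 3 * x + s + (d - x + s) - + 2 * (+ 2 * d - + 2 * x + s) + d)
            - d * (+ 2 * x - s + (+ 2 * d - + 2 * x + s) - + 2 * d) ≡
          + 10 - ((+ 2 * d + + 1 - + 3 * x + s + x) * (+ 2 * d + + 1 - + 3 * x + s + x) + (x * x + (x - s) * (x - s)))
        identity = solve-∀

  impossible : Empty
  impossible = contradiction (halves (par⇒even {X₂} X₂-even))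
    where
    halves : + 2 ∣ X₂ → ∃[ x ] X₂ ≡ x * + 2
    halves (divides q e) = q , e

no-small-isolation : ∀ (n : ℕ) (L : Mat n) → IsLattice L → n < 6 → ¬ IsIsolation L (I 3)
no-small-isolation n L lattice n<6 (represents , ¬I₃) = combine (represents 3 stretched stretched-independent
    stretched-proper)
    (represents 3 roots roots-independent roots-proper)
  where
  combine : Represents L (subGram (I 3) stretched) → Represents L (subGram (I 3) roots) → Empty
  combine (S , S-gram) (R , R-gram) = Contradiction.impossible n<6 L lattice ¬I₃ S R S-gram R-gram

theorem3p2 : (IsLattice L6 × IsIsolation L6 (I 3)) ×
    (∀ (n : ℕ) (L : Mat n) → IsLattice L → n < 6 → ¬ IsIsolation L (I 3))
theorem3p2 = (L6-isLattice , L6-isIsolation) , no-small-isolation
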